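{- Let $G$ be a simple 3-connected claw-free plane graph. Then $G$ is cycle-nice if and only if $G$ is isomorphic to $K_4$, to the wheel $W_5$, or to $\overline{C_6}$.
   Context: $G$ is claw-free if it has no induced subgraph isomorphic to $K_{1,3}$. $G$ is cycle-nice if for every even cycle $C$ of $G$, $G-V(C)$ has a perfect matching (the empty graph has one). $W_5$ is the wheel on six vertices: a cycle of length five together with a vertex adjacent to all five cycle vertices. $\overline{C_6}$ is the complement of the 6-cycle (the triangular prism). -}

module Defs where

open import Data.Nat using (ℕ; zero; suc; _+_; _*_; _≤_; _%_; _≡ᵇ_; _≤ᵇ_)
open import Data.Nat.Divisibility using (_∣_)
open import Data.Bool using (Bool; true; false; not; _∧_; _∨_; T)
open import Data.Fin using (Fin; toℕ)
open import Data.List using (List; []; _∷_; length; filter; upTo; allFin; _∷ʳ_; concatMap; filterᵇ; map)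
open import Data.Bool.ListAction using (all)
open import Data.List.Membership.Propositional using (_∈_; _∉_)
open import Data.List.Relation.Unary.Unique.Propositional using (Unique)
open import Data.List.Relation.Unary.Linked using (Linked)
open import Data.Product using (Σ; _×_; _,_; ∃; proj₁; proj₂)
open import Data.Empty using (⊥)
open import Function using (_∘_)
open import Function.Bundles using (_↔_; Inverse)
open import Relation.Binary.PropositionalEquality using (_≡_; _≢_)
open import Relation.Nullary using (¬_)

Graph : ℕ → Set
Graph n = Fin n → Fin n → Bool

record IsSimple {n : ℕ} (G : Graph n) : Set where
  field
    sym     : ∀ u v → G u v ≡ G v u
    irrefl  : ∀ u → G u u ≡ false

Adj : ∀ {n} → Graph n → Fin n → Fin n → Set
Adj G u v = G u v ≡ true

data WalkAvoiding {n : ℕ} (G : Graph n) (S : List (Fin n)) : Fin n → Fin n → Set where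
  here : ∀ {u} → WalkAvoiding G S u u
  step : ∀ {u w v} → Adj G u w → w ∉ S → WalkAvoiding G S w v → WalkAvoiding G S u v

ConnectedAvoiding : ∀ {n} → Graph n → List (Fin n) → Set
ConnectedAvoiding G S = ∀ u v → u ∉ S → v ∉ S → WalkAvoiding G S u v

ThreeConnected : ∀ {n} → Graph n → Set
ThreeConnected {n} G = 4 ≤ n × (∀ (S : List (Fin n)) → Unique S → length S ≤ 2 → ConnectedAvoiding G S)

ClawFree : ∀ {n} → Graph n → Set
ClawFree G = ∀ c a b d → a ≢ b → a ≢ d → b ≢ d →
  Adj G c a → Adj G c b → Adj G c d →
  G a b ≡ false → G a d ≡ false → G b d ≡ false → ⊥

IsEvenCycle : ∀ {n} → Graph n → Fin n → List (Fin n) → Set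
IsEvenCycle G v rest =
  Unique (v ∷ rest) × 3 ≤ length (v ∷ rest) × 2 ∣ length (v ∷ rest)
  × Linked (Adj G) ((v ∷ rest) ∷ʳ v)

HasPerfectMatchingAvoiding : ∀ {n} → Graph n → List (Fin n) → Set
HasPerfectMatchingAvoiding {n} G S =
  Σ (Fin n → Fin n) λ μ → ∀ x → x ∉ S → (μ x ∉ S) × Adj G x (μ x) × μ (μ x) ≡ x

CycleNice : ∀ {n} → Graph n → Set
CycleNice G = ∀ v rest → IsEvenCycle G v rest → HasPerfectMatchingAvoiding G (v ∷ rest)

-- Plane graphs: combinatorial embeddings (rotation systems) of Euler
-- genus 0.  ρ u is a cyclic permutation of the neighbourhood N(u).

iter : ∀ {A : Set} → (A → A) → ℕ → A → A
iter f zero    x = x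
iter f (suc k) x = f (iter f k x)

record IsRotationSystem {n : ℕ} (G : Graph n) (ρ : Fin n → Fin n → Fin n) : Set where
  field
    closed    : ∀ u v → Adj G u v → Adj G u (ρ u v)
    injective : ∀ u v w → Adj G u v → Adj G u w → ρ u v ≡ ρ u w → v ≡ w
    cyclic    : ∀ u v w → Adj G u v → Adj G u w → ∃ λ k → iter (ρ u) k v ≡ w

Dart : ℕ → Set
Dart n = Fin n × Fin n

-- face-tracing permutation  φ = σ ∘ θ : (u , v) ↦ (v , ρ v u)
faceStep : ∀ {n} → (Fin n → Fin n → Fin n) → Dart n → Dart n
faceStep ρ (u , v) = (v , ρ v u)

darts : ∀ {n} → Graph n → List (Dart n)
darts {n} G = filterᵇ (λ d → G (proj₁ d) (proj₂ d)) (concatMap (λ u → map (λ v → (u , v)) (allFin n)) (allFin n))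

dartKey : ∀ {n} → Dart n → ℕ
dartKey {n} (u , v) = toℕ u * n + toℕ v

-- a dart is the representative of its face if it has the least key in its φ-orbit
-- (orbits have length ≤ n * n, so checking n * n iterates suffices)
isFaceRep : ∀ {n} → (Fin n → Fin n → Fin n) → Dart n → Bool
isFaceRep {n} ρ d = all (λ k → dartKey d ≤ᵇ dartKey (iter (faceStep ρ) k d)) (upTo (n * n))

numFaces : ∀ {n} → Graph n → (Fin n → Fin n → Fin n) → ℕ
numFaces G ρ = length (filterᵇ (isFaceRep ρ) (darts G))

-- number of darts = 2 |E|
numDarts : ∀ {n} → Graph n → ℕ
numDarts G = length (darts G)

-- (connected) G is plane: it has a rotation system whose faces satisfy
-- Euler's formula  |V| - |E| + |F| = 2   (written as 2|V| + 2|F| = 4 + 2|E|)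
Plane : ∀ {n} → Graph n → Set
Plane {n} G = Σ (Fin n → Fin n → Fin n) λ ρ →
  IsRotationSystem G ρ × (2 * n + 2 * numFaces G ρ ≡ 4 + numDarts G)

_≅_ : ∀ {n m} → Graph n → Graph m → Set
_≅_ {n} {m} G H = Σ (Fin n ↔ Fin m) λ f → ∀ u v → G u v ≡ H (Inverse.to f u) (Inverse.to f v)

K4 : Graph 4
K4 i j = not (toℕ i ≡ᵇ toℕ j)

-- W5: hub 0, rim cycle 1-2-3-4-5-1
rimW5 : ℕ → ℕ → Bool
rimW5 a b = (a % 5) + 1 ≡ᵇ b

W5 : Graph 6
W5 i j = not (a ≡ᵇ b) ∧ ((a ≡ᵇ 0) ∨ (b ≡ᵇ 0) ∨ rimW5 a b ∨ rimW5 b a)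
  where a = toℕ i ; b = toℕ j

c6 : ℕ → ℕ → Bool
c6 a b = ((a + 1) % 6 ≡ᵇ b) ∨ ((b + 1) % 6 ≡ᵇ a)

C6bar : Graph 6
C6bar i j = not (a ≡ᵇ b) ∧ not (c6 a b)
  where a = toℕ i ; b = toℕ j

{-# OPTIONS --safe #-}
-- Suppose G is cycle-nice. An even cycle containing all neighbours of a vertex v but not v itself would isolate v,
-- so there is none. If u and v are nonadjacent and G − u − v is 2-connected, then claw-freeness at v (the first
-- vertices after the ends of an ear are not independent together with a new neighbour) gives a cycle of G − u − v
-- through all neighbours of v. Being odd, it cannot be changed by inserting or bypassing one vertex; rerouting it
-- through the component of u outside it, and playing the same game with u and v exchanged, forces a triangle and then
-- a contradiction. Hence any two nonadjacent vertices lie in a common 3-cut.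
--
-- Take such a cut {u, v, z} with a side L of minimal size. Uncrossing cuts through a fixed vertex shows that every
-- vertex of L is adjacent to u and v, and then that L is a single vertex. If z sees both u and v, then G is W₅;
-- otherwise u and the vertex of L are joined by an edge between two facing triangles, and G is the prism or K₅ with
-- one vertex split. So a cycle-nice G other than W₅ and the prism is complete or a split K₅.
--
-- Planarity enters only through counting: every face has at least three darts, which leaves K₄ as the only complete
-- graph, and the edge of the split K₅ that lies in no triangle costs two darts more than Euler's formula allows.
module Submission where

open import Defs
open import Data.Bool using (Bool; true; false; not; _∧_; _∨_; T)
open import Data.Bool.Properties using () renaming (_≟_ to _≟ᵇ_)
open import Data.Empty using (⊥; ⊥-elim)
open import Data.Fin using (Fin; zero; suc; toℕ; combine)
open import Data.Fin.Permutation using (↔⇒≡)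
open import Data.Fin.Properties
  using (_≟_; any?; all?; pigeonhole; combine-injective; toℕ-combine; toℕ-injective; toℕ<n)
open import Data.List
  using (List; []; _∷_; _++_; _∷ʳ_; length; map; reverse; filter; filterᵇ; allFin; concatMap; upTo; cartesianProduct;
         initLast; _∷ʳ′_)
open import Data.List.Membership.Propositional using (_∈_; _∉_)
open import Data.List.Membership.Propositional.Properties
  using (∈-∃++; ∈-++⁺ˡ; ∈-++⁺ʳ; ∈-++⁻; ∈-allFin; ∈-filter⁺; ∈-filter⁻; ∈-map⁺; ∈-map⁻; ∈-concat⁺′; ∈-upTo⁺;
         ∈-cartesianProduct⁺)
open import Data.List.Properties using (++-assoc; length-++; length-map; length-tabulate; reverse-++; unfold-reverse)
open import Data.List.Relation.Binary.Permutation.Propositional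
  using (_↭_; ↭-refl; ↭-sym; ↭-trans; ↭-reflexive; prep; ↭⇒↭ₛ)
open import Data.List.Relation.Binary.Permutation.Propositional.Properties
  using (∈-resp-↭; All-resp-↭; ↭-length; ↭-reverse; ++⁺ˡ; ++⁺ʳ; shift; ++-commutativeMonoid)
import Data.List.Relation.Binary.Permutation.Setoid.Properties as PermS
open import Data.List.Relation.Unary.All as All using (All; []; _∷_)
import Data.List.Relation.Unary.All.Properties as AllP
open import Data.List.Relation.Unary.AllPairs as AllPairs using ([]; _∷_)
import Data.List.Relation.Unary.AllPairs.Properties as AllPairsP
open import Data.List.Relation.Unary.Any using (here; there)
open import Data.List.Relation.Unary.Linked using (Linked; []; [-]; _∷_)
open import Data.List.Relation.Unary.Unique.Propositional using (Unique)
import Data.List.Relation.Unary.Unique.Propositional.Properties as Uniq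
open import Data.Nat using (ℕ; zero; suc; _+_; _*_; _∸_; _≤_; _<_; z≤n; s≤s; s≤s⁻¹; _≡ᵇ_; _≤ᵇ_)
open import Data.Nat.Divisibility using (_∣_; divides; _∣?_)
import Data.Nat.Properties as ℕₚ
open import Data.Nat.Tactic.RingSolver using (solve-∀)
open import Data.Product using (∃; ∃₂; _×_; _,_; proj₁; proj₂)
open import Data.Sum using (_⊎_; inj₁; inj₂; [_,_]′)
open import Data.Unit using (⊤; tt)
open import Data.Vec using (Vec; []; _∷_; lookup)
open import Function using (_∘_; id)
open import Function.Bundles using (_⇔_; mk↔ₛ′; mk⇔; Inverse)
open import Relation.Binary.PropositionalEquality
  using (_≡_; _≢_; refl; sym; trans; cong; cong₂; subst; subst₂; ≢-sym; setoid)
open import Relation.Nullary using (¬_; Dec; yes; no; ⌊_⌋)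
open import Relation.Nullary.Decidable using (¬?; _×-dec_; _→-dec_; from-yes; True; toWitness; map′; T?)

module _ {A : Set} where

  Unique-resp-↭ : ∀ {xs ys : List A} → xs ↭ ys → Unique xs → Unique ys
  Unique-resp-↭ p = PermS.Unique-resp-↭ (setoid A) (↭⇒↭ₛ p)

  Unique-++ˡ : ∀ (xs : List A) {ys} → Unique (xs ++ ys) → Unique xs
  Unique-++ˡ []       _        = []
  Unique-++ˡ (x ∷ xs) (p ∷ ps) = AllP.++⁻ˡ xs p ∷ Unique-++ˡ xs ps

  Unique-++ʳ : ∀ (xs : List A) {ys} → Unique (xs ++ ys) → Unique ys
  Unique-++ʳ []       u        = u
  Unique-++ʳ (x ∷ xs) (_ ∷ ps) = Unique-++ʳ xs ps

  Unique-head : ∀ {x : A} {xs} → Unique (x ∷ xs) → x ∉ xs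
  Unique-head (p ∷ _) x∈ = All.lookup p x∈ refl

  ∉-Unique : ∀ {x : A} {xs} → x ∉ xs → Unique xs → Unique (x ∷ xs)
  ∉-Unique x∉ u = All.tabulate (λ y∈ x≡y → x∉ (subst (_∈ _) (sym x≡y) y∈)) ∷ u

  Unique-⊆-length : ∀ (xs : List A) {ys} → Unique xs → (∀ {x} → x ∈ xs → x ∈ ys) → length xs ≤ length ys
  Unique-⊆-length []       _ _ = z≤n
  Unique-⊆-length (x ∷ xs) (p ∷ u) sub with ∈-∃++ (sub (here refl))
  ... | as , bs , refl = subst (suc (length xs) ≤_) (sym (↭-length (shift x as bs)))
          (s≤s (Unique-⊆-length xs u sub′))
    where
    sub′ : ∀ {y} → y ∈ xs → y ∈ as ++ bs
    sub′ y∈ with ∈-resp-↭ (shift x as bs) (sub (there y∈))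
    ... | here refl = ⊥-elim (All.lookup p y∈ refl)
    ... | there z   = z

  Unique-disjoint : ∀ (xs : List A) {ys} → Unique (xs ++ ys) → ∀ {z} → z ∈ xs → z ∉ ys
  Unique-disjoint (x ∷ xs) (p ∷ _) (here refl) z∈ = All.lookup p (∈-++⁺ʳ xs z∈) refl
  Unique-disjoint (x ∷ xs) (_ ∷ u) (there z∈)     = Unique-disjoint xs u z∈

  nonempty : ∀ (xs : List A) {y ys} → 1 ≤ length (xs ++ y ∷ ys)
  nonempty []      = s≤s z≤n
  nonempty (_ ∷ _) = s≤s z≤n

  module ↭-Solver where
    open import Algebra.Solver.CommutativeMonoid (++-commutativeMonoid {A = A}) public
      using (solve; _⊜_; _⊕_)

-- Case distinction and exhaustive choice are available whenever the goal is ⊥.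
by-cases : ∀ (P : Set) → (P → ⊥) → ((P → ⊥) → ⊥) → ⊥
by-cases P f g = g f

decide-all : ∀ {k} (P : Fin k → Set) → ((∀ x → Dec (P x)) → ⊥) → ⊥
decide-all {zero}  P k = k λ ()
decide-all {suc n} P k = decide-all (P ∘ suc) λ d →
  by-cases (P zero) (λ p → k λ { zero → yes p ; (suc i) → d i })
                    (λ ¬p → k λ { zero → no ¬p ; (suc i) → d i })

Even : ℕ → Set
Even k = 2 ∣ k

even-or-odd : ∀ k → Even k ⊎ Even (suc k)
even-or-odd zero = inj₁ (divides 0 refl)
even-or-odd (suc k) with even-or-odd k
... | inj₂ e = inj₁ e
... | inj₁ (divides q refl) = inj₂ (divides (suc q) refl)

module Walks {n : ℕ} (G : Graph n) (simple : IsSimple G) where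

  V : Set
  V = Fin n

  infix 4 _~_
  _~_ : V → V → Set
  x ~ y = Adj G x y

  _~?_ : ∀ x y → Dec (x ~ y)
  x ~? y = G x y ≟ᵇ true

  ~-sym : ∀ {x y} → x ~ y → y ~ x
  ~-sym {x} {y} e = trans (IsSimple.sym simple y x) e

  ~-irrefl : ∀ {x} → ¬ (x ~ x)
  ~-irrefl {x} e with trans (sym e) (IsSimple.irrefl simple x)
  ... | ()

  ~⇒≢ : ∀ {x y} → x ~ y → x ≢ y
  ~⇒≢ e refl = ~-irrefl e

  ≁⇒false : ∀ {x y} → ¬ (x ~ y) → G x y ≡ false
  ≁⇒false {x} {y} ne with G x y
  ... | true  = ⊥-elim (ne refl)
  ... | false = refl

  open import Data.List.Membership.DecPropositional (_≟_ {n}) public using (_∈?_)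

  infixr 5 _◅_
  -- Arc x m y : a walk from x to y whose list of intermediate vertices is m.
  data Arc : V → List V → V → Set where
    edge : ∀ {x y} → x ~ y → Arc x [] y
    _◅_  : ∀ {x w m y} → x ~ w → Arc w m y → Arc x (w ∷ m) y

  arc-++ : ∀ {x m y m′ z} → Arc x m y → Arc y m′ z → Arc x (m ++ y ∷ m′) z
  arc-++ (edge e) q = e ◅ q
  arc-++ (e ◅ p)  q = e ◅ arc-++ p q

  arc-rev : ∀ {x m y} → Arc x m y → Arc y (reverse m) x
  arc-rev (edge e) = edge (~-sym e)
  arc-rev {x} (_◅_ {w = w} {m} {y} e p) =
    subst (λ l → Arc y l x) (sym (unfold-reverse w m)) (arc-++ (arc-rev p) (edge (~-sym e)))

  arc-split : ∀ {x y w} m₁ {m₂} → Arc x (m₁ ++ w ∷ m₂) y → Arc x m₁ w × Arc w m₂ y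
  arc-split []       (e ◅ p) = edge e , p
  arc-split (_ ∷ m₁) (e ◅ p) with arc-split m₁ p
  ... | a , b = e ◅ a , b

  first : List V → V → V
  first []      y = y
  first (x ∷ _) y = x

  arc-first : ∀ {x m y} → Arc x m y → x ~ first m y
  arc-first (edge e) = e
  arc-first (e ◅ _)  = e

  arc-rehead : ∀ {x s m y} → Arc x m y → s ~ first m y → Arc s m y
  arc-rehead (edge _) e = edge e
  arc-rehead (_ ◅ p)  e = e ◅ p

  arc-linked : ∀ {x m y} → Arc x m y → Linked (Adj G) ((x ∷ m) ∷ʳ y)
  arc-linked (edge e)         = e ∷ [-]
  arc-linked (e ◅ p@(edge _)) = e ∷ arc-linked p
  arc-linked (e ◅ p@(_ ◅ _))  = e ∷ arc-linked p

  record Cycle (x : V) (m : List V) : Set where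
    constructor cycle
    field
      arc  : Arc x m x
      uniq : Unique (x ∷ m)
  open Cycle public

  rotate : ∀ {x w} m₁ {m₂} → Cycle x (m₁ ++ w ∷ m₂) → Cycle w (m₂ ++ x ∷ m₁)
  rotate {x} {w} m₁ {m₂} (cycle a u) with arc-split m₁ a
  ... | p , q = cycle (arc-++ q p) (Unique-resp-↭ (rotate-↭ m₁) u)
    where
    rotate-↭ : ∀ m₁ → x ∷ m₁ ++ w ∷ m₂ ↭ w ∷ m₂ ++ x ∷ m₁
    rotate-↭ m₁ = let open ↭-Solver in
      solve 4 (λ x a w b → x ⊕ (a ⊕ (w ⊕ b)) ⊜ w ⊕ (b ⊕ (x ⊕ a))) ↭-refl (x ∷ []) m₁ (w ∷ []) m₂

  -- Reach A x y : y can be reached from x, all vertices after x lying in A.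
  data Reach (A : V → Set) : V → V → Set where
    here : ∀ {x} → Reach A x x
    step : ∀ {x w y} → x ~ w → A w → Reach A w y → Reach A x y

  reach-∷ʳ : ∀ {A x y z} → Reach A x y → y ~ z → A z → Reach A x z
  reach-∷ʳ here         e a = step e a here
  reach-∷ʳ (step f b r) e a = step f b (reach-∷ʳ r e a)

  reach-trans : ∀ {A x y z} → Reach A x y → Reach A y z → Reach A x z
  reach-trans here         s = s
  reach-trans (step f b r) s = step f b (reach-trans r s)

  reach-sym : ∀ {A x y} → A x → Reach A x y → Reach A y x
  reach-sym a here         = here
  reach-sym a (step f b r) = reach-∷ʳ (reach-sym b r) (~-sym f) a

  reach-mono : ∀ {A B x y} → (∀ {z} → A z → B z) → Reach A x y → Reach B x y
  reach-mono f here         = here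
  reach-mono f (step e a r) = step e (f a) (reach-mono f r)

  reach-end : ∀ {A x y} → A x → Reach A x y → A y
  reach-end a here         = a
  reach-end a (step e b r) = reach-end b r

  reach-avoiding : ∀ {S x y} → WalkAvoiding G S x y → Reach (_∉ S) x y
  reach-avoiding here         = here
  reach-avoiding (step e a r) = step e a (reach-avoiding r)

  record HitPath (Tgt Off : V → Set) (A : V → Set) (x : V) : Set where
    constructor hit
    field
      {mid} : List V
      {end} : V
      path  : Arc x mid end
      hits  : Tgt end
      allow : A end
      off   : All (λ w → Off w × A w) mid
      uniq  : Unique (x ∷ mid)

  hit-path : ∀ {Tgt Off A : V → Set} → (∀ w → A w → Tgt w ⊎ Off w) →
             ∀ {x y} → Reach A x y → Off x → Tgt y → ¬ Off y → HitPath Tgt Off A x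
  hit-path dich here ox ty ¬oy = ⊥-elim (¬oy ox)
  hit-path dich {x} (step {w = w} e a r) ox ty ¬oy with dich w a
  ... | inj₁ t = hit (edge e) t a [] ([] ∷ [])
  ... | inj₂ o with hit-path dich r o ty ¬oy
  ... | hit {m} p h al of u with x ∈? m
  ... | no x∉ = hit (e ◅ p) h al ((o , a) ∷ of)
                  (∉-Unique (λ { (here refl) → ~-irrefl e ; (there z) → x∉ z }) u)
  ... | yes x∈ with ∈-∃++ x∈
  ... | m₁ , m₂ , refl = hit (proj₂ (arc-split m₁ p)) h al
                  (All.tail (AllP.++⁻ʳ m₁ of))
                  (Unique-++ʳ (w ∷ m₁) u)

  module Connected3 (conn : ThreeConnected G) where

    abstract
      separated : ∀ (s t : V) (X : V → Set) →
        (∀ x y → X x → x ~ y → y ≢ s → y ≢ t → X y) →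
        ∀ x y → X x → x ≢ s → x ≢ t → ¬ X y → y ≢ s → y ≢ t → ⊥
      separated s t X closed x y Xx x≢s x≢t ¬Xy y≢s y≢t with s ≟ t
      ... | yes refl = ¬Xy (go (proj₂ conn (s ∷ []) ([] ∷ []) (s≤s z≤n) x y (∉1 x≢s) (∉1 y≢s)) Xx)
        where
        ∉1 : ∀ {z} → z ≢ s → z ∉ s ∷ []
        ∉1 ne (here e) = ne e
        go : ∀ {a} → WalkAvoiding G (s ∷ []) a y → X a → X y
        go here         Xa = Xa
        go (step e a r) Xa = go r (closed _ _ Xa e (λ q → a (here q)) (λ q → a (here q)))
      ... | no s≢t = ¬Xy (go (proj₂ conn (s ∷ t ∷ []) ((s≢t ∷ []) ∷ [] ∷ []) (s≤s (s≤s z≤n)) x y (∉2 x≢s x≢t) (∉2 y≢s y≢t)) Xx)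
        where
        ∉2 : ∀ {z} → z ≢ s → z ≢ t → z ∉ s ∷ t ∷ []
        ∉2 ne nf (here e)         = ne e
        ∉2 ne nf (there (here e)) = nf e
        go : ∀ {a} → WalkAvoiding G (s ∷ t ∷ []) a y → X a → X y
        go here         Xa = Xa
        go (step e a r) Xa = go r (closed _ _ Xa e (λ q → a (here q)) (λ q → a (there (here q))))

    abstract
      fourth : ∀ (x s t : V) → ∃ λ y → y ≢ x × y ≢ s × y ≢ t
      fourth x s t with any? (λ y → ¬? (y ∈? (x ∷ s ∷ t ∷ [])))
      ... | yes (y , y∉) = y , (λ e → y∉ (here e)) , (λ e → y∉ (there (here e))) , (λ e → y∉ (there (there (here e))))
      ... | no none = ⊥-elim (ℕₚ.<⇒≱ (s≤s ℕₚ.≤-refl) (ℕₚ.≤-trans (proj₁ conn) (ℕₚ.≤-trans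
                         (ℕₚ.≤-reflexive (sym (length-tabulate id)))
                         (Unique-⊆-length (allFin n) (Uniq.allFin⁺ n) λ {y} _ → in3 y))))
        where
        in3 : ∀ y → y ∈ x ∷ s ∷ t ∷ []
        in3 y with y ∈? (x ∷ s ∷ t ∷ [])
        ... | yes p = p
        ... | no q  = ⊥-elim (none (y , q))

    abstract
      neighbour-avoiding : ∀ (x s t : V) → s ≢ x → t ≢ x → ∃ λ y → x ~ y × y ≢ s × y ≢ t
      neighbour-avoiding x s t s≢x t≢x with any? (λ y → x ~? y ×-dec (¬? (y ≟ s) ×-dec ¬? (y ≟ t)))
      ... | yes r = r
      ... | no none with fourth x s t
      ... | y , y≢x , y≢s , y≢t = ⊥-elim
        (separated s t (_≡ x) (λ { _ y refl e a b → ⊥-elim (none (y , e , a , b)) })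
                   x y refl (≢-sym s≢x) (≢-sym t≢x) y≢x y≢s y≢t)

    record ThreeNeighbours (x : V) : Set where
      field
        a b c : V
        x~a : x ~ a
        x~b : x ~ b
        x~c : x ~ c
        a≢b : a ≢ b
        a≢c : a ≢ c
        b≢c : b ≢ c

    abstract
      three-neighbours : ∀ x → ThreeNeighbours x
      three-neighbours x with fourth x x x
      ... | s , s≢x , _ with neighbour-avoiding x s s s≢x s≢x
      ... | a , x~a , _ with neighbour-avoiding x a a (≢-sym (~⇒≢ x~a)) (≢-sym (~⇒≢ x~a))
      ... | b , x~b , b≢a , _ with neighbour-avoiding x a b (≢-sym (~⇒≢ x~a)) (≢-sym (~⇒≢ x~b))
      ... | c , x~c , c≢a , c≢b = record { a = a ; b = b ; c = c ; x~a = x~a ; x~b = x~b ; x~c = x~c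
                                         ; a≢b = ≢-sym b≢a ; a≢c = ≢-sym c≢a ; b≢c = ≢-sym c≢b }

record Copy {n k : ℕ} (G : Graph n) (H : Graph k) : Set where
  constructor copy
  field
    verts : Vec (Fin n) k
    agree : ∀ i j → G (lookup verts i) (lookup verts j) ≡ H i j
    onto  : ∀ y → ∃ λ i → lookup verts i ≡ y

module Splits {n : ℕ} (G : Graph n) (simple : IsSimple G) (conn : ThreeConnected G) (clawfree : ClawFree G) where

  open Walks G simple
  open Connected3 conn

  claw : ∀ {c a b d} → c ~ a → c ~ b → c ~ d → a ≢ b → a ≢ d → b ≢ d →
         ¬ a ~ b → ¬ a ~ d → ¬ b ~ d → ⊥
  claw ca cb cd a≢b a≢d b≢d ab ad bd =
    clawfree _ _ _ _ a≢b a≢d b≢d ca cb cd (≁⇒false ab) (≁⇒false ad) (≁⇒false bd)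

  infix 4 _∈ˢ_ _∉ˢ_
  _∈ˢ_ _∉ˢ_ : V → (V → Bool) → Set
  x ∈ˢ X = X x ≡ true
  x ∉ˢ X = ¬ x ∈ˢ X

  _∈ˢ?_ : ∀ x X → Dec (x ∈ˢ X)
  x ∈ˢ? X = X x ≟ᵇ true

  toˢ : ∀ {P : V → Set} → (∀ x → Dec (P x)) → V → Bool
  toˢ P? x = ⌊ P? x ⌋

  toˢ⁺ : ∀ {P : V → Set} (P? : ∀ x → Dec (P x)) {x} → P x → x ∈ˢ toˢ P?
  toˢ⁺ P? {x} p with P? x
  ... | yes _ = refl
  ... | no ¬p = ⊥-elim (¬p p)

  toˢ⁻ : ∀ {P : V → Set} (P? : ∀ x → Dec (P x)) {x} → x ∈ˢ toˢ P? → P x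
  toˢ⁻ P? {x} e with P? x
  ... | yes p = p
  toˢ⁻ P? {x} () | no _

  size : (V → Bool) → ℕ
  size X = length (filterᵇ X (allFin n))

  ∈-list : ∀ {X : V → Bool} {x} → x ∈ˢ X → x ∈ filterᵇ X (allFin n)
  ∈-list {X} {x} e = ∈-filter⁺ (T? ∘ X) (∈-allFin x) (subst T (sym e) _)

  ∈-list⁻ : ∀ {X : V → Bool} {x} → x ∈ filterᵇ X (allFin n) → x ∈ˢ X
  ∈-list⁻ {X} {x} e with X x | proj₂ (∈-filter⁻ (T? ∘ X) {xs = allFin n} e)
  ... | true | _ = refl

  Unique-list : ∀ X → Unique (filterᵇ X (allFin n))
  Unique-list X = Uniq.filter⁺ (T? ∘ X) (Uniq.allFin⁺ n)

  size-< : ∀ {X Z : V → Bool} {w} → (∀ {x} → x ∈ˢ X → x ∈ˢ Z) → w ∈ˢ Z → w ∉ˢ X → size X < size Z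
  size-< {X} {Z} {w} sub w∈ w∉ =
    Unique-⊆-length (w ∷ _) (∉-Unique (w∉ ∘ ∈-list⁻) (Unique-list X))
      λ { (here refl) → ∈-list w∈ ; (there x∈) → ∈-list (sub (∈-list⁻ {X} x∈)) }

  record Split (p q r : V) : Set where
    field
      X Y   : V → Bool
      cover : ∀ x → (x ≡ p ⊎ x ≡ q ⊎ x ≡ r) ⊎ (x ∈ˢ X ⊎ x ∈ˢ Y)
      disj  : ∀ {x} → x ∈ˢ X → x ∉ˢ Y
      X≢    : ∀ {x} → x ∈ˢ X → x ≢ p × x ≢ q × x ≢ r
      Y≢    : ∀ {x} → x ∈ˢ Y → x ≢ p × x ≢ q × x ≢ r
      apart : ∀ {x y} → x ∈ˢ X → y ∈ˢ Y → ¬ x ~ y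
      someX : ∃ λ x → x ∈ˢ X
      someY : ∃ λ y → y ∈ˢ Y
  open Split

  module _ {p q r : V} (S : Split p q r) {x : V} where

    X≢p : x ∈ˢ X S → x ≢ p
    X≢p = proj₁ ∘ X≢ S
    X≢q : x ∈ˢ X S → x ≢ q
    X≢q = proj₁ ∘ proj₂ ∘ X≢ S
    X≢r : x ∈ˢ X S → x ≢ r
    X≢r = proj₂ ∘ proj₂ ∘ X≢ S
    Y≢p : x ∈ˢ Y S → x ≢ p
    Y≢p = proj₁ ∘ Y≢ S
    Y≢q : x ∈ˢ Y S → x ≢ q
    Y≢q = proj₁ ∘ proj₂ ∘ Y≢ S
    Y≢r : x ∈ˢ Y S → x ≢ r
    Y≢r = proj₂ ∘ proj₂ ∘ Y≢ S

  flip : ∀ {p q r} → Split p q r → Split p q r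
  flip S = record { X = Y S ; Y = X S ; cover = λ x → flip⊎ (cover S x) ; disj = λ y x → disj S x y
                  ; X≢ = Y≢ S ; Y≢ = X≢ S ; apart = λ y x e → apart S x y (~-sym e)
                  ; someX = someY S ; someY = someX S }
    where
    flip⊎ : ∀ {A B C : Set} → A ⊎ (B ⊎ C) → A ⊎ (C ⊎ B)
    flip⊎ (inj₁ a)        = inj₁ a
    flip⊎ (inj₂ (inj₁ b)) = inj₂ (inj₂ b)
    flip⊎ (inj₂ (inj₂ c)) = inj₂ (inj₁ c)

  swap₁₂ : ∀ {p q r} → Split p q r → Split q p r
  swap₁₂ S = record { X = X S ; Y = Y S ; cover = λ x → sw (cover S x) ; disj = disj S
                    ; X≢ = λ m → let (a , b , c) = X≢ S m in b , a , c
                    ; Y≢ = λ m → let (a , b , c) = Y≢ S m in b , a , c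
                    ; apart = apart S ; someX = someX S ; someY = someY S }
    where
    sw : ∀ {A B C D : Set} → (A ⊎ B ⊎ C) ⊎ D → (B ⊎ A ⊎ C) ⊎ D
    sw (inj₁ (inj₁ a))        = inj₁ (inj₂ (inj₁ a))
    sw (inj₁ (inj₂ (inj₁ b))) = inj₁ (inj₁ b)
    sw (inj₁ (inj₂ (inj₂ c))) = inj₁ (inj₂ (inj₂ c))
    sw (inj₂ d)               = inj₂ d

  swap₂₃ : ∀ {p q r} → Split p q r → Split p r q
  swap₂₃ S = record { X = X S ; Y = Y S ; cover = λ x → sw (cover S x) ; disj = disj S
                    ; X≢ = λ m → let (a , b , c) = X≢ S m in a , c , b
                    ; Y≢ = λ m → let (a , b , c) = Y≢ S m in a , c , b
                    ; apart = apart S ; someX = someX S ; someY = someY S }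
    where
    sw : ∀ {A B C D : Set} → (A ⊎ B ⊎ C) ⊎ D → (A ⊎ C ⊎ B) ⊎ D
    sw (inj₁ (inj₁ a))        = inj₁ (inj₁ a)
    sw (inj₁ (inj₂ (inj₁ b))) = inj₁ (inj₂ (inj₂ b))
    sw (inj₁ (inj₂ (inj₂ c))) = inj₁ (inj₂ (inj₁ c))
    sw (inj₂ d)               = inj₂ d

  module _ {P : V → Set} (P? : ∀ x → Dec (P x)) {p q r : V} where

    private
      Rest : V → Set
      Rest x = ¬ P x × x ≢ p × x ≢ q × x ≢ r
      Rest? : ∀ x → Dec (Rest x)
      Rest? x = ¬? (P? x) ×-dec ¬? (x ≟ p) ×-dec ¬? (x ≟ q) ×-dec ¬? (x ≟ r)

    split : (∀ {x} → P x → x ≢ p × x ≢ q × x ≢ r) →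
            (∀ x y → P x → x ~ y → y ≢ p → y ≢ q → y ≢ r → P y) →
            ∃ P → ∃ Rest → Split p q r
    split P≢ closed (x , Px) (y , Ry) = record
      { X = toˢ P? ; Y = toˢ Rest? ; cover = cov
      ; disj = λ a b → proj₁ (toˢ⁻ Rest? b) (toˢ⁻ P? a)
      ; X≢ = λ a → P≢ (toˢ⁻ P? a) ; Y≢ = λ b → proj₂ (toˢ⁻ Rest? b)
      ; apart = λ a b e → let (¬Pb , b≢p , b≢q , b≢r) = toˢ⁻ Rest? b in
                          ¬Pb (closed _ _ (toˢ⁻ P? a) e b≢p b≢q b≢r)
      ; someX = x , toˢ⁺ P? Px ; someY = y , toˢ⁺ Rest? Ry }
      where
      cov : ∀ z → (z ≡ p ⊎ z ≡ q ⊎ z ≡ r) ⊎ (z ∈ˢ toˢ P? ⊎ z ∈ˢ toˢ Rest?)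
      cov z = go (z ≟ p) (z ≟ q) (z ≟ r) (P? z)
        where
        go : Dec (z ≡ p) → Dec (z ≡ q) → Dec (z ≡ r) → Dec (P z) →
             (z ≡ p ⊎ z ≡ q ⊎ z ≡ r) ⊎ (z ∈ˢ toˢ P? ⊎ z ∈ˢ toˢ Rest?)
        go (yes e) _       _       _       = inj₁ (inj₁ e)
        go (no _)  (yes e) _       _       = inj₁ (inj₂ (inj₁ e))
        go (no _)  (no _)  (yes e) _       = inj₁ (inj₂ (inj₂ e))
        go (no _)  (no _)  (no _)  (yes m) = inj₂ (inj₁ (toˢ⁺ P? m))
        go (no a)  (no b)  (no c)  (no ¬m) = inj₂ (inj₂ (toˢ⁺ Rest? (¬m , a , b , c)))

  module _ {p q r : V} (S : Split p q r) where

    side : ∀ {x} → x ≢ p → x ≢ q → x ≢ r → x ∈ˢ X S ⊎ x ∈ˢ Y S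
    side {x} a b c with cover S x
    ... | inj₁ (inj₁ e)        = ⊥-elim (a e)
    ... | inj₁ (inj₂ (inj₁ e)) = ⊥-elim (b e)
    ... | inj₁ (inj₂ (inj₂ e)) = ⊥-elim (c e)
    ... | inj₂ s               = s

    X-closed : ∀ {x y} → x ∈ˢ X S → x ~ y → y ≢ p → y ≢ q → y ≢ r → y ∈ˢ X S
    X-closed x∈ e a b c with side a b c
    ... | inj₁ y∈ = y∈
    ... | inj₂ y∈ = ⊥-elim (apart S x∈ y∈ e)

    X-nbr : ∀ {x y} → x ∈ˢ X S → x ~ y → y ∈ˢ X S ⊎ (y ≡ p ⊎ y ≡ q ⊎ y ≡ r)
    X-nbr {y = y} x∈ e with cover S y
    ... | inj₁ c         = inj₂ c
    ... | inj₂ (inj₁ y∈) = inj₁ y∈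
    ... | inj₂ (inj₂ y∈) = ⊥-elim (apart S x∈ y∈ e)

    nbrX : ∃ λ x → x ∈ˢ X S × p ~ x
    nbrX with any? (λ x → (x ∈ˢ? X S) ×-dec (p ~? x))
    ... | yes r = r
    ... | no none = ⊥-elim (separated q r (_∈ˢ X S) closed x y x∈ (X≢q S x∈) (X≢r S x∈)
                       (λ m → disj S m y∈) (Y≢q S y∈) (Y≢r S y∈))
      where
      x = proj₁ (someX S)
      x∈ = proj₂ (someX S)
      y = proj₁ (someY S)
      y∈ = proj₂ (someY S)
      closed : ∀ x y → x ∈ˢ X S → x ~ y → y ≢ q → y ≢ r → y ∈ˢ X S
      closed x y x∈ e a b with X-nbr x∈ e
      ... | inj₁ m               = m
      ... | inj₂ (inj₁ refl)     = ⊥-elim (none (x , x∈ , ~-sym e))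
      ... | inj₂ (inj₂ (inj₁ e)) = ⊥-elim (a e)
      ... | inj₂ (inj₂ (inj₂ e)) = ⊥-elim (b e)

  module _ {p q r : V} (S : Split p q r) where

    -- A cut vertex has a neighbour on the other side, so claw-freeness applies.
    X-clique : ∀ {x y} → x ∈ˢ X S → y ∈ˢ X S → p ~ x → p ~ y → x ≢ y → x ~ y
    X-clique {x} {y} x∈ y∈ px py x≢y with x ~? y
    ... | yes e = e
    ... | no ne with nbrX (flip S)
    ... | z , z∈ , pz = ⊥-elim (claw px py pz x≢y (λ { refl → disj S x∈ z∈ }) (λ { refl → disj S y∈ z∈ })
                           ne (apart S x∈ z∈) (apart S y∈ z∈))

    p≢q : p ≢ q
    p≢q refl = separated p r (_∈ˢ X S) (λ x y x∈ e a b → X-closed S x∈ e a a b)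
                 _ _ (proj₂ (someX S)) (X≢p S (proj₂ (someX S))) (X≢r S (proj₂ (someX S)))
                 (λ m → disj S m (proj₂ (someY S)))
                 (Y≢p S (proj₂ (someY S))) (Y≢r S (proj₂ (someY S)))

  p≢r : ∀ {p q r} → Split p q r → p ≢ r
  p≢r S = p≢q (swap₂₃ S)

  q≢r : ∀ {p q r} → Split p q r → q ≢ r
  q≢r S = p≢q (swap₂₃ (swap₁₂ S))

  module Cuts (cuts : ∀ a c → a ≢ c → ¬ a ~ c → (∀ t → Split a c t → ⊥) → ⊥) where

    record Smaller {b p q : V} (S : Split b p q) : Set where
      constructor smaller
      field
        {p′ q′} : V
        S′    : Split b p′ q′
        b≁p′  : ¬ b ~ p′
        sub   : ∀ {x} → x ∈ˢ X S′ → x ∈ˢ X S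
        {w}   : V
        old   : w ∈ˢ X S
        gone  : w ∉ˢ X S′

    shrink : ∀ {b p q} (S : Split b p q) → ¬ b ~ p → ∀ {w} → w ∈ˢ X S → ¬ b ~ w → ¬ ¬ Smaller S
    shrink {b} {p} {q} S b≁p {w} w∈ b≁w k =
      cuts b w (≢-sym (X≢p S w∈)) b≁w λ t S₂ → main t S₂
      where
      w≢p : w ≢ p
      w≢p = X≢q S w∈
      w≢q : w ≢ q
      w≢q = X≢r S w∈

      module _ (t : V) (S₂ : Split b w t) where

        nested : t ∉ˢ Y S → (p ≡ t ⊎ p ∈ˢ X S₂) → (q ≡ t ⊎ q ∈ˢ X S₂) → ⊥
        nested t∉ hp hq = k (smaller (flip S₂) b≁w sub w∈ (λ m → Y≢q S₂ m refl))
          where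
          notCut : ∀ {x y} → x ∈ˢ Y S₂ → y ≢ t → (y ≡ t ⊎ y ∈ˢ X S₂) → ¬ x ~ y
          notCut x∈ y≢t (inj₁ e) = ⊥-elim (y≢t e)
          notCut x∈ y≢t (inj₂ m) e = apart S₂ m x∈ (~-sym e)
          closed : ∀ x y → x ∈ˢ Y S₂ × x ∈ˢ Y S → x ~ y → y ≢ b → y ≢ t → y ∈ˢ Y S₂ × y ∈ˢ Y S
          closed x y (x∈₂ , x∈) e y≢b y≢t with X-nbr (flip S) x∈ e
          ... | inj₂ (inj₁ e′)          = ⊥-elim (y≢b e′)
          ... | inj₂ (inj₂ (inj₁ refl)) = ⊥-elim (notCut x∈₂ y≢t hp e)
          ... | inj₂ (inj₂ (inj₂ refl)) = ⊥-elim (notCut x∈₂ y≢t hq e)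
          ... | inj₁ y∈ = X-closed (flip S₂) x∈₂ e y≢b (λ { refl → disj S w∈ y∈ }) y≢t , y∈
          sub : ∀ {x} → x ∈ˢ Y S₂ → x ∈ˢ X S
          sub {x} x∈₂ with cover S x
          ... | inj₁ (inj₁ e) = ⊥-elim (Y≢p S₂ x∈₂ e)
          ... | inj₁ (inj₂ (inj₁ refl)) = ⊥-elim ([ Y≢r S₂ x∈₂ , (λ m → disj S₂ m x∈₂) ]′ hp)
          ... | inj₁ (inj₂ (inj₂ refl)) = ⊥-elim ([ Y≢r S₂ x∈₂ , (λ m → disj S₂ m x∈₂) ]′ hq)
          ... | inj₂ (inj₁ x∈) = x∈
          ... | inj₂ (inj₂ x∈) with someX S₂
          ... | o , o∈ = ⊥-elim (separated b t _ closed x o (x∈₂ , x∈) (Y≢p S₂ x∈₂) (Y≢r S₂ x∈₂)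
                           (λ m → disj S₂ o∈ (proj₁ m)) (X≢p S₂ o∈) (X≢r S₂ o∈))

        torn : t ∈ˢ X S → p ∈ˢ X S₂ → q ∈ˢ Y S₂ → ⊥
        torn t∈ p∈ q∈ with someY S
        ... | y , y∈ with cover S₂ y
        ... | inj₁ (inj₁ e) = Y≢p S y∈ e
        ... | inj₁ (inj₂ (inj₁ refl)) = disj S w∈ y∈
        ... | inj₁ (inj₂ (inj₂ refl)) = disj S t∈ y∈
        ... | inj₂ (inj₁ y∈₂) = separated b p (λ x → x ∈ˢ X S₂ × x ∈ˢ Y S) closed y q (y∈₂ , y∈)
                 (Y≢p S y∈) (Y≢q S y∈) (λ m → disj S₂ (proj₁ m) q∈) (≢-sym (p≢r S)) (≢-sym (q≢r S))
          where
          closed : ∀ x y → x ∈ˢ X S₂ × x ∈ˢ Y S → x ~ y → y ≢ b → y ≢ p → y ∈ˢ X S₂ × y ∈ˢ Y S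
          closed x y (x∈₂ , x∈) e y≢b y≢p with X-nbr (flip S) x∈ e
          ... | inj₂ (inj₁ e′)          = ⊥-elim (y≢b e′)
          ... | inj₂ (inj₂ (inj₁ e′))   = ⊥-elim (y≢p e′)
          ... | inj₂ (inj₂ (inj₂ refl)) = ⊥-elim (apart S₂ x∈₂ q∈ e)
          ... | inj₁ y∈ = X-closed S₂ x∈₂ e y≢b (λ { refl → disj S w∈ y∈ }) (λ { refl → disj S t∈ y∈ }) , y∈
        ... | inj₂ (inj₂ y∈₂) = separated b q (λ x → x ∈ˢ Y S₂ × x ∈ˢ Y S) closed y p (y∈₂ , y∈)
                 (Y≢p S y∈) (Y≢r S y∈) (λ m → disj S₂ p∈ (proj₁ m)) (≢-sym (p≢q S)) (q≢r S)
          where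
          closed : ∀ x y → x ∈ˢ Y S₂ × x ∈ˢ Y S → x ~ y → y ≢ b → y ≢ q → y ∈ˢ Y S₂ × y ∈ˢ Y S
          closed x y (x∈₂ , x∈) e y≢b y≢q with X-nbr (flip S) x∈ e
          ... | inj₂ (inj₁ e′)          = ⊥-elim (y≢b e′)
          ... | inj₂ (inj₂ (inj₂ e′))   = ⊥-elim (y≢q e′)
          ... | inj₂ (inj₂ (inj₁ refl)) = ⊥-elim (apart S₂ p∈ x∈₂ (~-sym e))
          ... | inj₁ y∈ = X-closed (flip S₂) x∈₂ e y≢b (λ { refl → disj S w∈ y∈ }) (λ { refl → disj S t∈ y∈ }) , y∈

        one-sided : t ∈ˢ Y S → p ∈ˢ X S₂ → q ∈ˢ X S₂ → ⊥
        one-sided t∈ p∈ q∈ with someY S₂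
        ... | y , y∈ with cover S y
        ... | inj₁ (inj₁ e) = Y≢p S₂ y∈ e
        ... | inj₁ (inj₂ (inj₁ refl)) = disj S₂ p∈ y∈
        ... | inj₁ (inj₂ (inj₂ refl)) = disj S₂ q∈ y∈
        ... | inj₂ (inj₁ y∈₁) = separated b w (λ x → x ∈ˢ Y S₂ × x ∈ˢ X S) closed y p (y∈ , y∈₁)
                 (Y≢p S₂ y∈) (Y≢q S₂ y∈) (λ m → disj S₂ p∈ (proj₁ m)) (≢-sym (p≢q S)) (≢-sym w≢p)
          where
          closed : ∀ x y → x ∈ˢ Y S₂ × x ∈ˢ X S → x ~ y → y ≢ b → y ≢ w → y ∈ˢ Y S₂ × y ∈ˢ X S
          closed x y (x∈₂ , x∈) e y≢b y≢w with X-nbr S x∈ e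
          ... | inj₂ (inj₁ e′)          = ⊥-elim (y≢b e′)
          ... | inj₂ (inj₂ (inj₁ refl)) = ⊥-elim (apart S₂ p∈ x∈₂ (~-sym e))
          ... | inj₂ (inj₂ (inj₂ refl)) = ⊥-elim (apart S₂ q∈ x∈₂ (~-sym e))
          ... | inj₁ y∈ = X-closed (flip S₂) x∈₂ e y≢b y≢w (λ { refl → disj S y∈ t∈ }) , y∈
        ... | inj₂ (inj₂ y∈₁) = separated b t (λ x → x ∈ˢ Y S₂ × x ∈ˢ Y S) closed y p (y∈ , y∈₁)
                 (Y≢p S₂ y∈) (Y≢r S₂ y∈) (λ m → disj S₂ p∈ (proj₁ m)) (≢-sym (p≢q S)) (X≢r S₂ p∈)
          where
          closed : ∀ x y → x ∈ˢ Y S₂ × x ∈ˢ Y S → x ~ y → y ≢ b → y ≢ t → y ∈ˢ Y S₂ × y ∈ˢ Y S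
          closed x y (x∈₂ , x∈) e y≢b y≢t with X-nbr (flip S) x∈ e
          ... | inj₂ (inj₁ e′)          = ⊥-elim (y≢b e′)
          ... | inj₂ (inj₂ (inj₁ refl)) = ⊥-elim (apart S₂ p∈ x∈₂ (~-sym e))
          ... | inj₂ (inj₂ (inj₂ refl)) = ⊥-elim (apart S₂ q∈ x∈₂ (~-sym e))
          ... | inj₁ y∈ = X-closed (flip S₂) x∈₂ e y≢b (λ { refl → disj S w∈ y∈ }) y≢t , y∈

        crossing : t ∈ˢ Y S → p ∈ˢ X S₂ → q ∈ˢ Y S₂ → ⊥
        crossing t∈ p∈ q∈ with any? (λ x → (x ∈ˢ? X S) ×-dec (x ∈ˢ? X S₂)) | any? (λ x → (x ∈ˢ? X S) ×-dec (x ∈ˢ? Y S₂))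
        ... | yes (x , x∈ , x∈₂) | _ = k (smaller
              (split {P = P} P? (λ (m , m₂) → X≢p S m , X≢q S m , X≢q S₂ m₂)
                 closed (x , x∈ , x∈₂) (q , (λ m → disj S₂ (proj₂ m) q∈) , ≢-sym (p≢r S) , ≢-sym (q≢r S) , ≢-sym w≢q))
              b≁p (λ m → proj₁ (toˢ⁻ P? m)) w∈ (λ m → X≢q S₂ (proj₂ (toˢ⁻ P? m)) refl))
          where
          P : V → Set
          P x = x ∈ˢ X S × x ∈ˢ X S₂
          P? : ∀ x → Dec (P x)
          P? x = (x ∈ˢ? X S) ×-dec (x ∈ˢ? X S₂)
          closed : ∀ x y → P x → x ~ y → y ≢ b → y ≢ p → y ≢ w → P y
          closed x y (x∈ , x∈₂) e y≢b y≢p y≢w with X-nbr S x∈ e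
          ... | inj₂ (inj₁ e′)          = ⊥-elim (y≢b e′)
          ... | inj₂ (inj₂ (inj₁ e′))   = ⊥-elim (y≢p e′)
          ... | inj₂ (inj₂ (inj₂ refl)) = ⊥-elim (apart S₂ x∈₂ q∈ e)
          ... | inj₁ y∈ = y∈ , X-closed S₂ x∈₂ e y≢b y≢w (λ { refl → disj S y∈ t∈ })
        ... | no _ | yes (x , x∈ , x∈₂) = k (smaller
              (split {P = P} P? (λ (m , m₂) → X≢p S m , Y≢q S₂ m₂ , X≢r S m)
                 closed (x , x∈ , x∈₂) (p , (λ m → disj S₂ p∈ (proj₂ m)) , ≢-sym (p≢q S) , ≢-sym w≢p , q≢r S))
              b≁w (λ m → proj₁ (toˢ⁻ P? m)) w∈ (λ m → Y≢q S₂ (proj₂ (toˢ⁻ P? m)) refl))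
          where
          P : V → Set
          P x = x ∈ˢ X S × x ∈ˢ Y S₂
          P? : ∀ x → Dec (P x)
          P? x = (x ∈ˢ? X S) ×-dec (x ∈ˢ? Y S₂)
          closed : ∀ x y → P x → x ~ y → y ≢ b → y ≢ w → y ≢ q → P y
          closed x y (x∈ , x∈₂) e y≢b y≢w y≢q with X-nbr S x∈ e
          ... | inj₂ (inj₁ e′)          = ⊥-elim (y≢b e′)
          ... | inj₂ (inj₂ (inj₂ e′))   = ⊥-elim (y≢q e′)
          ... | inj₂ (inj₂ (inj₁ refl)) = ⊥-elim (apart S₂ p∈ x∈₂ (~-sym e))
          ... | inj₁ y∈ = y∈ , X-closed (flip S₂) x∈₂ e y≢b y≢w (λ { refl → disj S y∈ t∈ })
        ... | no none | no none′ = separated p q (_≡ w) closed w t refl w≢p w≢q (proj₂ (proj₂ (t≢))) (Y≢q S t∈) (Y≢r S t∈)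
          where
          t≢ : t ≢ b × t ≢ b × t ≢ w
          t≢ = Y≢p S t∈ , Y≢p S t∈ , λ { refl → disj S w∈ t∈ }
          closed : ∀ x y → x ≡ w → x ~ y → y ≢ p → y ≢ q → y ≡ w
          closed _ y refl e y≢p y≢q with X-nbr S w∈ e
          ... | inj₂ (inj₁ refl)      = ⊥-elim (b≁w (~-sym e))
          ... | inj₂ (inj₂ (inj₁ e′)) = ⊥-elim (y≢p e′)
          ... | inj₂ (inj₂ (inj₂ e′)) = ⊥-elim (y≢q e′)
          ... | inj₁ y∈ with cover S₂ y
          ... | inj₁ (inj₁ refl) = ⊥-elim (b≁w (~-sym e))
          ... | inj₁ (inj₂ (inj₁ e′)) = e′
          ... | inj₁ (inj₂ (inj₂ refl)) = ⊥-elim (disj S y∈ t∈)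
          ... | inj₂ (inj₁ m) = ⊥-elim (none (y , y∈ , m))
          ... | inj₂ (inj₂ m) = ⊥-elim (none′ (y , y∈ , m))

      place : ∀ t (S₂ : Split b w t) {x} → x ≢ b → x ≢ w → x ≡ t ⊎ (x ∈ˢ X S₂ ⊎ x ∈ˢ Y S₂)
      place t S₂ {x} x≢b x≢w with x ≟ t
      ... | yes e = inj₁ e
      ... | no ne = inj₂ (side S₂ x≢b x≢w ne)

      t∈X : ∀ t → Split b w t → t ∉ˢ Y S → p ≢ t → q ≢ t → t ∈ˢ X S
      t∈X t S₂ t∉ p≢t q≢t with side S (≢-sym (p≢r S₂)) (≢-sym p≢t) (≢-sym q≢t)
      ... | inj₁ m = m
      ... | inj₂ m = ⊥-elim (t∉ m)

      main : ∀ t → Split b w t → ⊥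
      main t S₂ with t ∈ˢ? Y S | place t S₂ (≢-sym (p≢q S)) (≢-sym w≢p) | place t S₂ (≢-sym (p≢r S)) (≢-sym w≢q)
      ... | yes t∈ | inj₁ refl | _ = Y≢q S t∈ refl
      ... | yes t∈ | inj₂ _ | inj₁ refl = Y≢r S t∈ refl
      ... | yes t∈ | inj₂ (inj₁ p∈) | inj₂ (inj₁ q∈) = one-sided t S₂ t∈ p∈ q∈
      ... | yes t∈ | inj₂ (inj₁ p∈) | inj₂ (inj₂ q∈) = crossing t S₂ t∈ p∈ q∈
      ... | yes t∈ | inj₂ (inj₂ p∈) | inj₂ (inj₁ q∈) = crossing t (flip S₂) t∈ p∈ q∈
      ... | yes t∈ | inj₂ (inj₂ p∈) | inj₂ (inj₂ q∈) = one-sided t (flip S₂) t∈ p∈ q∈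
      ... | no t∉ | inj₁ e | inj₁ e′ = q≢r S (trans e (sym e′))
      ... | no t∉ | inj₁ e | inj₂ (inj₁ q∈) = nested t S₂ t∉ (inj₁ e) (inj₂ q∈)
      ... | no t∉ | inj₁ e | inj₂ (inj₂ q∈) = nested t (flip S₂) t∉ (inj₁ e) (inj₂ q∈)
      ... | no t∉ | inj₂ (inj₁ p∈) | inj₁ e = nested t S₂ t∉ (inj₂ p∈) (inj₁ e)
      ... | no t∉ | inj₂ (inj₂ p∈) | inj₁ e = nested t (flip S₂) t∉ (inj₂ p∈) (inj₁ e)
      ... | no t∉ | inj₂ (inj₁ p∈) | inj₂ (inj₁ q∈) = nested t S₂ t∉ (inj₂ p∈) (inj₂ q∈)
      ... | no t∉ | inj₂ (inj₂ p∈) | inj₂ (inj₂ q∈) = nested t (flip S₂) t∉ (inj₂ p∈) (inj₂ q∈)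
      ... | no t∉ | inj₂ (inj₁ p∈) | inj₂ (inj₂ q∈) = torn t S₂ (t∈X t S₂ t∉ (X≢r S₂ p∈) (Y≢r S₂ q∈)) p∈ q∈
      ... | no t∉ | inj₂ (inj₂ p∈) | inj₂ (inj₁ q∈) = torn t (flip S₂) (t∈X t S₂ t∉ (Y≢r S₂ p∈) (X≢r S₂ q∈)) p∈ q∈

-- K₅ with one vertex split into the adjacent vertices 0 and 1.
SplitK5 : Graph 6
SplitK5 i j = not (a ≡ᵇ b) ∧ not (far a b) ∧ not (far b a)
  where
  a = toℕ i
  b = toℕ j
  far : ℕ → ℕ → Bool
  far a b = ((a ≡ᵇ 0) ∧ ((b ≡ᵇ 4) ∨ (b ≡ᵇ 5))) ∨ ((a ≡ᵇ 1) ∧ ((b ≡ᵇ 2) ∨ (b ≡ᵇ 3)))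

module Copies {n : ℕ} (G : Graph n) (simple : IsSimple G) where

  Row : ∀ {k} → Fin n → Vec (Fin n) k → (Fin k → Bool) → Set
  Row x []       h = ⊤
  Row x (y ∷ ys) h = G x y ≡ h zero × Row x ys (h ∘ suc)

  Upper : ∀ {k} → Vec (Fin n) k → Graph k → Set
  Upper []       H = ⊤
  Upper (x ∷ xs) H = Row x xs (H zero ∘ suc) × Upper xs (λ i j → H (suc i) (suc j))

  row : ∀ {k x} (ys : Vec (Fin n) k) {h} → Row x ys h → ∀ j → G x (lookup ys j) ≡ h j
  row (y ∷ ys) (e , _)  zero    = e
  row (y ∷ ys) (_ , es) (suc j) = row ys es j

  upper⇒agree : ∀ {k} (xs : Vec (Fin n) k) {H : Graph k} → (∀ i j → H i j ≡ H j i) → (∀ i → H i i ≡ false) →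
                Upper xs H → ∀ i j → G (lookup xs i) (lookup xs j) ≡ H i j
  upper⇒agree (x ∷ xs) hs hi u       zero    zero    = trans (IsSimple.irrefl simple x) (sym (hi zero))
  upper⇒agree (x ∷ xs) hs hi (r , _) zero    (suc j) = row xs r j
  upper⇒agree (x ∷ xs) hs hi (r , _) (suc i) zero    = trans (IsSimple.sym simple _ x) (trans (row xs r i) (hs zero (suc i)))
  upper⇒agree (x ∷ xs) hs hi (_ , u) (suc i) (suc j) = upper⇒agree xs (λ i j → hs (suc i) (suc j)) (hi ∘ suc) u i j

  Symmetric? : ∀ {k} (H : Graph k) → Dec (∀ i j → H i j ≡ H j i)
  Symmetric? H = all? λ i → all? λ j → H i j ≟ᵇ H j i

  Irreflexive? : ∀ {k} (H : Graph k) → Dec (∀ i → H i i ≡ false)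
  Irreflexive? H = all? λ i → H i i ≟ᵇ false

  mkCopy : ∀ {k} (H : Graph k) {s : True (Symmetric? H)} {i : True (Irreflexive? H)} (xs : Vec (Fin n) k) →
           Upper xs H → (∀ y → ∃ λ i → lookup xs i ≡ y) → Copy G H
  mkCopy H {s} {i} xs u o = copy xs (upper⇒agree xs (toWitness s) (toWitness i) u) o

module Classify {n : ℕ} (G : Graph n) (simple : IsSimple G) (conn : ThreeConnected G) (clawfree : ClawFree G) where

  open Walks G simple
  open Connected3 conn
  open Splits G simple conn clawfree
  open Split
  open Copies G simple

  module _ (cuts : ∀ a c → a ≢ c → ¬ a ~ c → (∀ t → Split a c t → ⊥) → ⊥)
           (rim4 : ∀ {a b c d z} → a ~ b → b ~ c → c ~ d → d ~ a → a ≢ c → b ≢ d →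
                   z ∉ a ∷ b ∷ c ∷ d ∷ [] → (∀ y → z ~ y → y ∈ a ∷ b ∷ c ∷ d ∷ []) → ⊥)
           (noW5 : ¬ Copy G W5) (noC6bar : ¬ Copy G C6bar) (noSplitK5 : ¬ Copy G SplitK5) where

    open Cuts cuts

    record Frame (u l a b v z : V) : Set where
      field
        u~l : u ~ l
        u~a : u ~ a
        u~b : u ~ b
        l~v : l ~ v
        l~z : l ~ z
        a~b : a ~ b
        v~z : v ~ z
        Nu  : ∀ {y} → u ~ y → y ≡ l ⊎ y ≡ a ⊎ y ≡ b
        Nl  : ∀ {y} → l ~ y → y ≡ u ⊎ y ≡ v ⊎ y ≡ z
        u≢v : u ≢ v
        u≢z : u ≢ z
        l≢a : l ≢ a
        l≢b : l ≢ b
        a≢v : a ≢ v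
        a≢z : a ≢ z
        b≢v : b ≢ v
        b≢z : b ≢ z

      u≁v : ¬ u ~ v
      u≁v e with Nu e
      ... | inj₁ refl        = ~-irrefl l~v
      ... | inj₂ (inj₁ refl) = a≢v refl
      ... | inj₂ (inj₂ refl) = b≢v refl
      u≁z : ¬ u ~ z
      u≁z e with Nu e
      ... | inj₁ refl        = ~-irrefl l~z
      ... | inj₂ (inj₁ refl) = a≢z refl
      ... | inj₂ (inj₂ refl) = b≢z refl

    swapAB : ∀ {u l a b v z} → Frame u l a b v z → Frame u l b a v z
    swapAB F = record { u~l = u~l ; u~a = u~b ; u~b = u~a ; l~v = l~v ; l~z = l~z ; a~b = ~-sym a~b ; v~z = v~z
                      ; Nu = λ e → sw (Nu e) ; Nl = Nl ; u≢v = u≢v ; u≢z = u≢z ; l≢a = l≢b ; l≢b = l≢a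
                      ; a≢v = b≢v ; a≢z = b≢z ; b≢v = a≢v ; b≢z = a≢z }
      where
      open Frame F
      sw : ∀ {A B C : Set} → A ⊎ B ⊎ C → A ⊎ C ⊎ B
      sw (inj₁ a)        = inj₁ a
      sw (inj₂ (inj₁ b)) = inj₂ (inj₂ b)
      sw (inj₂ (inj₂ c)) = inj₂ (inj₁ c)

    mirror : ∀ {u l a b v z} → Frame u l a b v z → Frame l u v z a b
    mirror F = record { u~l = ~-sym u~l ; u~a = l~v ; u~b = l~z ; l~v = u~a ; l~z = u~b ; a~b = v~z ; v~z = a~b
                      ; Nu = Nl ; Nl = Nu ; u≢v = l≢a ; u≢z = l≢b ; l≢a = u≢v ; l≢b = u≢z
                      ; a≢v = ≢-sym a≢v ; a≢z = ≢-sym b≢v ; b≢v = ≢-sym a≢z ; b≢z = ≢-sym b≢z }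
      where open Frame F

    swapVZ : ∀ {u l a b v z} → Frame u l a b v z → Frame u l a b z v
    swapVZ F = mirror (swapAB (mirror F))

    module Core {u l a b v z} (F : Frame u l a b v z) where
      open Frame F
      private
        module M = Frame (mirror F)
        u≢l = ~⇒≢ u~l
        u≢a = ~⇒≢ u~a
        u≢b = ~⇒≢ u~b
        l≢v = ~⇒≢ l~v
        l≢z = ~⇒≢ l~z
        a≢b = ~⇒≢ a~b
        v≢z = ~⇒≢ v~z

      near-a : ∀ {t} (S : Split a v t) → u ∈ˢ X S → ∀ {x} → x ∈ˢ X S → a ~ x → x ≡ u ⊎ x ≡ b
      near-a S u∈ {x} x∈ e with x ≟ u
      ... | yes q = inj₁ q
      ... | no ne with Nu (X-clique S u∈ x∈ (~-sym u~a) e (≢-sym ne))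
      ... | inj₁ refl        = ⊥-elim (M.u≁v (~-sym e))
      ... | inj₂ (inj₁ refl) = ⊥-elim (~-irrefl e)
      ... | inj₂ (inj₂ q)    = inj₂ q

      near-v : ∀ {t} (S : Split a v t) → l ∈ˢ X S → ∀ {x} → x ∈ˢ X S → v ~ x → x ≡ l ⊎ x ≡ z
      near-v S l∈ {x} x∈ e with x ≟ l
      ... | yes q = inj₁ q
      ... | no ne with Nl (X-clique (swap₁₂ S) l∈ x∈ (~-sym l~v) e (≢-sym ne))
      ... | inj₁ refl        = ⊥-elim (u≁v (~-sym e))
      ... | inj₂ (inj₁ refl) = ⊥-elim (~-irrefl e)
      ... | inj₂ (inj₂ q)    = inj₂ q

      through-b : ¬ a ~ v → (S : Split a v b) → u ∈ˢ X S → ⊥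
      through-b a≁v S u∈ = separated v l (λ x → x ∈ˢ X S × x ≢ u × x ≢ l) closed z u
          (z∈ , ≢-sym u≢z , ≢-sym l≢z) (≢-sym v≢z) (≢-sym l≢z) (λ m → proj₁ (proj₂ m) refl) u≢v u≢l
        where
        l∈ = X-closed S u∈ u~l l≢a l≢v l≢b
        z∈ = X-closed S l∈ l~z (≢-sym a≢z) (≢-sym v≢z) (≢-sym b≢z)
        near-b : ∀ {x} → x ∈ˢ X S → b ~ x → x ≡ u
        near-b {x} x∈ e with x ≟ u
        ... | yes q = q
        ... | no ne with Nu (X-clique (swap₁₂ (swap₂₃ S)) u∈ x∈ (~-sym u~b) e (≢-sym ne))
        ... | inj₁ refl        = ⊥-elim (M.u≁z (~-sym e))
        ... | inj₂ (inj₁ refl) = ⊥-elim (X≢p S x∈ refl)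
        ... | inj₂ (inj₂ refl) = ⊥-elim (~-irrefl e)
        closed : ∀ x y → x ∈ˢ X S × x ≢ u × x ≢ l → x ~ y → y ≢ v → y ≢ l → y ∈ˢ X S × y ≢ u × y ≢ l
        closed x y (x∈ , x≢u , x≢l) e y≢v y≢l with X-nbr S x∈ e
        ... | inj₂ (inj₁ refl) = [ ⊥-elim ∘ x≢u , (λ { refl → ⊥-elim (X≢r S x∈ refl) }) ]′ (near-a S u∈ x∈ (~-sym e))
        ... | inj₂ (inj₂ (inj₁ q)) = ⊥-elim (y≢v q)
        ... | inj₂ (inj₂ (inj₂ refl)) = ⊥-elim (x≢u (near-b x∈ (~-sym e)))
        ... | inj₁ y∈ = y∈ , (λ { refl → at-u (Nu (~-sym e)) }) , y≢l
          where
          at-u : x ≡ l ⊎ x ≡ a ⊎ x ≡ b → ⊥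
          at-u (inj₁ q)           = x≢l q
          at-u (inj₂ (inj₁ q)) = X≢p S x∈ q
          at-u (inj₂ (inj₂ q)) = X≢r S x∈ q

      through-u : ¬ a ~ v → (S : Split a v u) → l ∈ˢ X S → ⊥
      through-u a≁v S l∈ = noC6bar (mkCopy C6bar (l ∷ a ∷ v ∷ u ∷ z ∷ b ∷ [])
          ((≁⇒false M.u≁v , l~v , ~-sym u~l , l~z , ≁⇒false M.u≁z , tt)
          , (≁⇒false a≁v , ~-sym u~a , a~z , a~b , tt)
          , (≁⇒false (u≁v ∘ ~-sym) , v~z , v~b , tt)
          , (≁⇒false u≁z , u~b , tt) , (≁⇒false (apart S z∈ b∈) , tt) , tt , tt) all-six)
        where
        z∈ = X-closed S l∈ l~z (≢-sym a≢z) (≢-sym v≢z) (≢-sym u≢z)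
        S′ = swap₁₂ S
        b∈ : b ∈ˢ Y S
        b∈ with nbrX (flip (swap₁₂ (swap₂₃ S)))
        ... | x , x∈ , e with Nu e
        ... | inj₁ refl        = ⊥-elim (disj S l∈ x∈)
        ... | inj₂ (inj₁ refl) = ⊥-elim (Y≢p S x∈ refl)
        ... | inj₂ (inj₂ refl) = x∈
        X⊆ : ∀ x → x ∈ˢ X S → x ≡ l ⊎ x ≡ z
        X⊆ x x∈ with x ≟ l | x ≟ z
        ... | yes q | _ = inj₁ q
        ... | no _ | yes q = inj₂ q
        ... | no x≢l | no x≢z = ⊥-elim (separated a z (λ x → x ∈ˢ X S × x ≢ l × x ≢ z) closed x u
               (x∈ , x≢l , x≢z) (X≢p S x∈) x≢z (λ m → X≢r S (proj₁ m) refl) u≢a u≢z)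
          where
          closed : ∀ x y → x ∈ˢ X S × x ≢ l × x ≢ z → x ~ y → y ≢ a → y ≢ z → y ∈ˢ X S × y ≢ l × y ≢ z
          closed x y (x∈ , x≢l , x≢z) e y≢a y≢z with X-nbr S x∈ e
          ... | inj₂ (inj₁ q) = ⊥-elim (y≢a q)
          ... | inj₂ (inj₂ (inj₁ refl)) = ⊥-elim ([ x≢l , x≢z ]′ (near-v S l∈ x∈ (~-sym e)))
          ... | inj₂ (inj₂ (inj₂ refl)) with Nu (~-sym e)
          ... | inj₁ q = ⊥-elim (x≢l q)
          ... | inj₂ (inj₁ refl) = ⊥-elim (X≢p S x∈ refl)
          ... | inj₂ (inj₂ refl) = ⊥-elim (disj S x∈ b∈)
          closed x y (x∈ , x≢l , x≢z) e y≢a y≢z | inj₁ y∈ = y∈ , (λ { refl → at-l (Nl (~-sym e)) }) , y≢z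
            where
            at-l : x ≡ u ⊎ x ≡ v ⊎ x ≡ z → ⊥
            at-l (inj₁ q)        = X≢r S x∈ q
            at-l (inj₂ (inj₁ q)) = X≢q S x∈ q
            at-l (inj₂ (inj₂ q)) = x≢z q
        a~z : a ~ z
        a~z with nbrX S
        ... | x , x∈ , e with X⊆ x x∈
        ... | inj₁ refl = ⊥-elim (M.u≁v (~-sym e))
        ... | inj₂ refl = e
        far-a : ∀ {y} → y ∈ˢ Y S → a ~ y → y ≡ b
        far-a {y} y∈ e with y ≟ b
        ... | yes q = q
        ... | no ne = ⊥-elim (claw (~-sym u~a) a~z e u≢z (λ { refl → Y≢r S y∈ refl })
                        (λ { refl → disj S z∈ y∈ }) u≁z u≁y (apart S z∈ y∈))
          where
          u≁y : ¬ u ~ y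
          u≁y f with Nu f
          ... | inj₁ refl        = disj S l∈ y∈
          ... | inj₂ (inj₁ refl) = Y≢p S y∈ refl
          ... | inj₂ (inj₂ q)    = ne q
        Y⊆ : ∀ y → y ∈ˢ Y S → y ≡ b
        Y⊆ y y∈ with y ≟ b
        ... | yes q = q
        ... | no ne = ⊥-elim (separated v b (λ x → x ∈ˢ Y S × x ≢ b) closed y u (y∈ , ne) (Y≢q S y∈) ne
                       (λ m → Y≢r S (proj₁ m) refl) u≢v u≢b)
          where
          closed : ∀ x y → x ∈ˢ Y S × x ≢ b → x ~ y → y ≢ v → y ≢ b → y ∈ˢ Y S × y ≢ b
          closed x y (x∈ , x≢b) e y≢v y≢b with X-nbr (flip S) x∈ e
          ... | inj₁ y∈ = y∈ , y≢b
          ... | inj₂ (inj₁ refl) = ⊥-elim (x≢b (far-a x∈ (~-sym e)))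
          ... | inj₂ (inj₂ (inj₁ q)) = ⊥-elim (y≢v q)
          ... | inj₂ (inj₂ (inj₂ refl)) with Nu (~-sym e)
          ... | inj₁ refl = ⊥-elim (disj S l∈ x∈)
          ... | inj₂ (inj₁ refl) = ⊥-elim (Y≢p S x∈ refl)
          ... | inj₂ (inj₂ q) = ⊥-elim (x≢b q)
        v~b : v ~ b
        v~b with nbrX (flip S′)
        ... | x , x∈ , e with Y⊆ x x∈
        ... | refl = e
        all-six : ∀ y → ∃ λ i → lookup (l ∷ a ∷ v ∷ u ∷ z ∷ b ∷ []) i ≡ y
        all-six y with cover S y
        ... | inj₁ (inj₁ q)        = suc zero , sym q
        ... | inj₁ (inj₂ (inj₁ q)) = suc (suc zero) , sym q
        ... | inj₁ (inj₂ (inj₂ q)) = suc (suc (suc zero)) , sym q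
        ... | inj₂ (inj₂ y∈)       = suc (suc (suc (suc (suc zero)))) , sym (Y⊆ y y∈)
        ... | inj₂ (inj₁ y∈) with X⊆ y y∈
        ... | inj₁ q = zero , sym q
        ... | inj₂ q = suc (suc (suc (suc zero))) , sym q

      through-t : ¬ a ~ v → ∀ {t} (S : Split a v t) → u ∈ˢ X S → t ≢ l → t ≢ b → t ≢ z → ⊥
      through-t a≁v {t} S u∈ t≢l t≢b t≢z = cuts l t (≢-sym t≢l) l≁t go
        where
        l∈ = X-closed S u∈ u~l l≢a l≢v (≢-sym t≢l)
        b∈ = X-closed S u∈ u~b (≢-sym a≢b) b≢v (≢-sym t≢b)
        z∈ = X-closed S l∈ l~z (≢-sym a≢z) (≢-sym v≢z) (≢-sym t≢z)
        t≢u = ≢-sym (X≢r S u∈)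
        l≁t : ¬ l ~ t
        l≁t e with Nl e
        ... | inj₁ refl        = t≢u refl
        ... | inj₂ (inj₁ refl) = q≢r S refl
        ... | inj₂ (inj₂ refl) = t≢z refl

        module _ {t′ : V} (S₃ : Split l t t′) (u∈₃ : u ∈ˢ X S₃) where

          no-exit : v ∉ˢ Y S₃ → z ∉ˢ Y S₃ → ⊥
          no-exit v∉ z∉ with nbrX (flip S₃)
          ... | y , y∈ , e with Nl e
          ... | inj₁ refl        = disj S₃ u∈₃ y∈
          ... | inj₂ (inj₁ refl) = v∉ y∈
          ... | inj₂ (inj₂ refl) = z∉ y∈

          v-beside-z : z ∈ˢ X S₃ → v ∉ˢ Y S₃
          v-beside-z z∈₃ v∈₃ = apart S₃ z∈₃ v∈₃ (~-sym v~z)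

          z-beside-v : v ∈ˢ X S₃ → z ∉ˢ Y S₃
          z-beside-v v∈₃ z∈₃ = apart S₃ v∈₃ z∈₃ v~z

          -- t′ is off the route u – a – Y S – v.
          far-route : t′ ∉ˢ Y S → t′ ≢ a → t′ ≢ v → ⊥
          far-route t′∉ t′≢a t′≢v = by-cases (v ∈ˢ X S₃) (λ v∈₃ → no-exit (disj S₃ v∈₃) (z-beside-v v∈₃)) λ v∉₃ →
              separated a t (λ x → x ∈ˢ Y S × x ∈ˢ X S₃) (closed v∉₃) y₀ u (y₀∈ , y₀∈₃) (Y≢p S y₀∈) (Y≢r S y₀∈)
                (λ m → disj S u∈ (proj₁ m)) u≢a (≢-sym t≢u)
            where
            a∈₃ = X-closed S₃ u∈₃ u~a (≢-sym l≢a) (p≢r S) (≢-sym t′≢a)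
            y₀ = proj₁ (nbrX (flip S))
            y₀∈ = proj₁ (proj₂ (nbrX (flip S)))
            y₀∈₃ = X-closed S₃ a∈₃ (proj₂ (proj₂ (nbrX (flip S)))) (λ { refl → disj S l∈ y₀∈ })
                     (Y≢r S y₀∈) (λ { refl → t′∉ y₀∈ })
            closed : v ∉ˢ X S₃ → ∀ x y → x ∈ˢ Y S × x ∈ˢ X S₃ → x ~ y → y ≢ a → y ≢ t → y ∈ˢ Y S × y ∈ˢ X S₃
            closed v∉₃ x y (x∈ , x∈₃) e y≢a y≢t with X-nbr (flip S) x∈ e
            ... | inj₁ y∈ = y∈ , X-closed S₃ x∈₃ e (λ { refl → disj S l∈ y∈ }) y≢t (λ { refl → t′∉ y∈ })
            ... | inj₂ (inj₁ q) = ⊥-elim (y≢a q)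
            ... | inj₂ (inj₂ (inj₂ q)) = ⊥-elim (y≢t q)
            ... | inj₂ (inj₂ (inj₁ refl)) = ⊥-elim (v∉₃ (X-closed S₃ x∈₃ e (≢-sym l≢v) y≢t (≢-sym t′≢v)))

          -- t′ is off the route u – b – X S – z.
          near-route : t′ ∉ˢ X S → ⊥
          near-route t′∉ = by-cases (z ∈ˢ X S₃) (λ z∈₃ → no-exit (v-beside-z z∈₃) (disj S₃ z∈₃)) contra
            where
            off : ∀ {x} → x ∈ˢ X S → x ≢ t′
            off m refl = t′∉ m
            b∈₃ = X-closed S₃ u∈₃ u~b (≢-sym l≢b) (≢-sym t≢b) (off b∈)
            contra : z ∉ˢ X S₃ → ⊥
            contra z∉₃ with side S₃ (≢-sym l≢z) (≢-sym t≢z) (off z∈)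
            ... | inj₁ m = z∉₃ m
            ... | inj₂ z∈₃ with nbrX (flip (swap₁₂ (swap₂₃ S)))
            ... | y , y∈ , t~y = claw t~b t~z t~y b≢z (λ { refl → disj S b∈ y∈ }) (λ { refl → disj S z∈ y∈ })
                                   (apart S₃ b∈₃ z∈₃) (apart S b∈ y∈) (apart S z∈ y∈)
              where
              b-alone : ∀ x → x ∈ˢ X S → x ≢ u → x ∈ˢ X S₃ → x ≡ b
              b-alone x x∈ x≢u x∈₃ with x ≟ b
              ... | yes q = q
              ... | no ne = ⊥-elim (separated b t (λ x → x ∈ˢ X S × x ≢ u × x ∈ˢ X S₃ × x ≢ b) closed x u (x∈ , x≢u , x∈₃ , ne)
                       ne (X≢r S x∈) (λ m → proj₁ (proj₂ m) refl) u≢b (≢-sym t≢u))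
                where
                closed : ∀ x y → x ∈ˢ X S × x ≢ u × x ∈ˢ X S₃ × x ≢ b → x ~ y → y ≢ b → y ≢ t → y ∈ˢ X S × y ≢ u × y ∈ˢ X S₃ × y ≢ b
                closed x y (x∈ , x≢u , x∈₃ , x≢b) e y≢b y≢t with X-nbr S x∈ e
                ... | inj₂ (inj₁ refl) = ⊥-elim ([ x≢u , x≢b ]′ (near-a S u∈ x∈ (~-sym e)))
                ... | inj₂ (inj₂ (inj₂ q)) = ⊥-elim (y≢t q)
                ... | inj₂ (inj₂ (inj₁ refl)) = ⊥-elim ([ (λ { refl → X≢p S₃ x∈₃ refl }) , (λ { refl → z∉₃ x∈₃ }) ]′ (near-v S l∈ x∈ (~-sym e)))
                ... | inj₁ y∈ = y∈ , (λ { refl → at-u (Nu (~-sym e)) }) ,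
                        X-closed S₃ x∈₃ e (λ { refl → at-l (Nl (~-sym e)) }) y≢t (off y∈) , y≢b
                  where
                  at-u : x ≡ l ⊎ x ≡ a ⊎ x ≡ b → ⊥
                  at-u (inj₁ q)        = X≢p S₃ x∈₃ q
                  at-u (inj₂ (inj₁ q)) = X≢p S x∈ q
                  at-u (inj₂ (inj₂ q)) = x≢b q
                  at-l : x ≡ u ⊎ x ≡ v ⊎ x ≡ z → ⊥
                  at-l (inj₁ q)           = x≢u q
                  at-l (inj₂ (inj₁ q))    = X≢q S x∈ q
                  at-l (inj₂ (inj₂ refl)) = z∉₃ x∈₃
              t~b : t ~ b
              t~b with neighbour-avoiding b a u a≢b u≢b
              ... | y , e , y≢a , y≢u with X-nbr S b∈ e
              ... | inj₂ (inj₁ q) = ⊥-elim (y≢a q)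
              ... | inj₂ (inj₂ (inj₂ refl)) = ~-sym e
              ... | inj₂ (inj₂ (inj₁ refl)) = ⊥-elim ([ l≢b ∘ sym , b≢z ]′ (near-v S l∈ b∈ (~-sym e)))
              ... | inj₁ y∈ = ⊥-elim (~-irrefl (subst (b ~_)
                     (b-alone y y∈ y≢u (X-closed S₃ b∈₃ e (λ { refl → M.u≁z (~-sym e) }) (X≢r S y∈) (off y∈))) e))
              z-alone : ∀ x → x ∈ˢ X S → x ≢ l → x ∈ˢ Y S₃ → x ≡ z
              z-alone x x∈ x≢l x∈₃ with x ≟ z
              ... | yes q = q
              ... | no ne = ⊥-elim (separated z t (λ x → x ∈ˢ X S × x ∈ˢ Y S₃ × x ≢ z) closed x u (x∈ , x∈₃ , ne)
                       ne (X≢r S x∈) (λ m → disj S₃ u∈₃ (proj₁ (proj₂ m))) u≢z (≢-sym t≢u))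
                where
                closed : ∀ x y → x ∈ˢ X S × x ∈ˢ Y S₃ × x ≢ z → x ~ y → y ≢ z → y ≢ t → y ∈ˢ X S × y ∈ˢ Y S₃ × y ≢ z
                closed x y (x∈ , x∈₃ , x≢z) e y≢z y≢t with X-nbr S x∈ e
                ... | inj₂ (inj₁ refl) = ⊥-elim ([ (λ { refl → disj S₃ u∈₃ x∈₃ }) , (λ { refl → disj S₃ b∈₃ x∈₃ }) ]′ (near-a S u∈ x∈ (~-sym e)))
                ... | inj₂ (inj₂ (inj₂ q)) = ⊥-elim (y≢t q)
                ... | inj₂ (inj₂ (inj₁ refl)) = ⊥-elim ([ (λ { refl → Y≢p S₃ x∈₃ refl }) , x≢z ]′ (near-v S l∈ x∈ (~-sym e)))
                ... | inj₁ y∈ = y∈ , X-closed (flip S₃) x∈₃ e (λ { refl → at-l (Nl (~-sym e)) }) y≢t (off y∈) , y≢z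
                  where
                  at-l : x ≡ u ⊎ x ≡ v ⊎ x ≡ z → ⊥
                  at-l (inj₁ refl)        = disj S₃ u∈₃ x∈₃
                  at-l (inj₂ (inj₁ q))    = X≢q S x∈ q
                  at-l (inj₂ (inj₂ q))    = x≢z q
              t~z : t ~ z
              t~z with neighbour-avoiding z v l v≢z l≢z
              ... | y , e , y≢v , y≢l with X-nbr S z∈ e
              ... | inj₂ (inj₂ (inj₁ q)) = ⊥-elim (y≢v q)
              ... | inj₂ (inj₂ (inj₂ refl)) = ~-sym e
              ... | inj₂ (inj₁ refl) = ⊥-elim ([ u≢z ∘ sym , b≢z ∘ sym ]′ (near-a S u∈ z∈ (~-sym e)))
              ... | inj₁ y∈ = ⊥-elim (~-irrefl (subst (z ~_)
                     (z-alone y y∈ y≢l (X-closed (flip S₃) z∈₃ e y≢l (X≢r S y∈) (off y∈))) e))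

        go₁ : ∀ {t′} (S₃ : Split l t t′) → u ∈ˢ X S₃ → ⊥
        go₁ {t′} S₃ u∈₃ with t′ ∈ˢ? X S
        ... | no t′∉  = near-route S₃ u∈₃ t′∉
        ... | yes t′∈ = far-route S₃ u∈₃ (disj S t′∈) (X≢p S t′∈) (X≢q S t′∈)

        go : ∀ t′ → Split l t t′ → ⊥
        go t′ S₃ with t′ ≟ u
        ... | no ne with side S₃ u≢l (≢-sym t≢u) (≢-sym ne)
        ... | inj₁ m = go₁ S₃ m
        ... | inj₂ m = go₁ (flip S₃) m
        go t′ S₃ | yes refl with nbrX S₃ | nbrX (flip S₃)
        ... | y₁ , y₁∈ , e₁ | y₂ , y₂∈ , e₂ with Nl e₁ | Nl e₂
        ... | inj₁ q | _ = X≢r S₃ y₁∈ q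
        ... | inj₂ _ | inj₁ q = Y≢r S₃ y₂∈ q
        ... | inj₂ (inj₁ refl) | inj₂ (inj₁ refl) = disj S₃ y₁∈ y₂∈
        ... | inj₂ (inj₁ refl) | inj₂ (inj₂ refl) = apart S₃ y₁∈ y₂∈ v~z
        ... | inj₂ (inj₂ refl) | inj₂ (inj₁ refl) = apart S₃ y₁∈ y₂∈ (~-sym v~z)
        ... | inj₂ (inj₂ refl) | inj₂ (inj₂ refl) = disj S₃ y₁∈ y₂∈

    frame-nonadjacent : ∀ {u l a b v z} → Frame u l a b v z → ¬ a ~ v → ⊥
    frame-nonadjacent {u} {l} {a} {b} {v} {z} F a≁v = cuts a v a≢v a≁v go
      where
      open Frame F
      go₁ : ∀ {t} (S : Split a v t) → u ∈ˢ X S → t ≢ l → ⊥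
      go₁ {t} S u∈ t≢l with t ≟ b | t ≟ z
      ... | yes refl | _        = Core.through-b F a≁v S u∈
      ... | no _     | yes refl = Core.through-b (mirror F) (a≁v ∘ ~-sym) (swap₁₂ S)
                                    (X-closed S u∈ u~l l≢a (~⇒≢ l~v) (≢-sym t≢l))
      ... | no t≢b   | no t≢z   = Core.through-t F a≁v S u∈ t≢l t≢b t≢z
      go : ∀ t → Split a v t → ⊥
      go t S with t ≟ u | t ≟ l
      ... | yes refl | _ with side S l≢a (~⇒≢ l~v) (≢-sym (~⇒≢ u~l))
      ... | inj₁ l∈ = Core.through-u F a≁v S l∈
      ... | inj₂ l∈ = Core.through-u F a≁v (flip S) l∈
      go t S | no t≢u | yes refl with side S (~⇒≢ u~a) u≢v (~⇒≢ u~l)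
      ... | inj₁ u∈ = Core.through-u (mirror F) (a≁v ∘ ~-sym) (swap₁₂ S) u∈
      ... | inj₂ u∈ = Core.through-u (mirror F) (a≁v ∘ ~-sym) (swap₁₂ (flip S)) u∈
      go t S | no t≢u | no t≢l with side S (~⇒≢ u~a) u≢v (≢-sym t≢u)
      ... | inj₁ u∈ = go₁ S u∈ t≢l
      ... | inj₂ u∈ = go₁ (flip S) u∈ t≢l

    frame-complete : ∀ {u l a b v z} → Frame u l a b v z → a ~ v → a ~ z → b ~ v → b ~ z → ⊥
    frame-complete {u} {l} {a} {b} {v} {z} F a~v a~z b~v b~z = by-cases
      (∃ λ y → y ∉ u ∷ l ∷ a ∷ b ∷ v ∷ z ∷ []) extra λ none → noSplitK5
        (mkCopy SplitK5 (u ∷ l ∷ a ∷ b ∷ v ∷ z ∷ [])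
          ((u~l , u~a , u~b , ≁⇒false u≁v , ≁⇒false u≁z , tt)
          , (≁⇒false M.u≁v , ≁⇒false M.u≁z , l~v , l~z , tt)
          , (a~b , a~v , a~z , tt) , (b~v , b~z , tt) , (v~z , tt) , tt , tt)
          (index none))
      where
      open Frame F
      module M = Frame (mirror F)
      index : (∃ (λ y → y ∉ u ∷ l ∷ a ∷ b ∷ v ∷ z ∷ []) → ⊥) → ∀ y → ∃ λ i → lookup (u ∷ l ∷ a ∷ b ∷ v ∷ z ∷ []) i ≡ y
      index none y with y ∈? (u ∷ l ∷ a ∷ b ∷ v ∷ z ∷ [])
      ... | no y∉ = ⊥-elim (none (y , y∉))
      ... | yes (here q) = zero , sym q
      ... | yes (there (here q)) = suc zero , sym q
      ... | yes (there (there (here q))) = suc (suc zero) , sym q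
      ... | yes (there (there (there (here q)))) = suc (suc (suc zero)) , sym q
      ... | yes (there (there (there (there (here q))))) = suc (suc (suc (suc zero))) , sym q
      ... | yes (there (there (there (there (there (here q)))))) = suc (suc (suc (suc (suc zero)))) , sym q
      extra : ∃ (λ y → y ∉ u ∷ l ∷ a ∷ b ∷ v ∷ z ∷ []) → ⊥
      extra (y , y∉) = cuts l y (λ { refl → y∉ (there (here refl)) }) l≁y λ t S → go t S
        where
        l≁y : ¬ l ~ y
        l≁y e with Nl e
        ... | inj₁ q        = y∉ (here q)
        ... | inj₂ (inj₁ q) = y∉ (there (there (there (there (here q)))))
        ... | inj₂ (inj₂ q) = y∉ (there (there (there (there (there (here q))))))
        y≢a : y ≢ a
        y≢a q = y∉ (there (there (here q)))
        y≢b : y ≢ b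
        y≢b q = y∉ (there (there (there (here q))))
        -- a or b survives in the cut and joins u to both v and z.
        bridge : ∀ {t} (S : Split l y t) → u ∈ˢ X S → ∀ {w} → a ~ w → b ~ w → w ∉ˢ Y S
        bridge {t} S u∈ aw bw w∈ with a ≟ t
        ... | no a≢t = apart S (X-closed S u∈ u~a (≢-sym l≢a) (≢-sym y≢a) a≢t) w∈ aw
        ... | yes refl = apart S (X-closed S u∈ u~b (≢-sym l≢b) (≢-sym y≢b) (≢-sym (~⇒≢ a~b))) w∈ bw
        go₁ : ∀ {t} (S : Split l y t) → u ∈ˢ X S → ⊥
        go₁ S u∈ with nbrX (flip S)
        ... | w , w∈ , e with Nl e
        ... | inj₁ refl        = disj S u∈ w∈
        ... | inj₂ (inj₁ refl) = bridge S u∈ a~v b~v w∈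
        ... | inj₂ (inj₂ refl) = bridge S u∈ a~z b~z w∈
        go : ∀ t → Split l y t → ⊥
        go t S with nbrX S | nbrX (flip S)
        ... | y₁ , y₁∈ , e₁ | y₂ , y₂∈ , e₂ with Nl e₁ | Nl e₂
        ... | inj₁ refl | _ = go₁ S y₁∈
        ... | inj₂ _ | inj₁ refl = go₁ (flip S) y₂∈
        ... | inj₂ (inj₁ refl) | inj₂ (inj₁ refl) = disj S y₁∈ y₂∈
        ... | inj₂ (inj₁ refl) | inj₂ (inj₂ refl) = apart S y₁∈ y₂∈ v~z
        ... | inj₂ (inj₂ refl) | inj₂ (inj₁ refl) = apart S y₁∈ y₂∈ (~-sym v~z)
        ... | inj₂ (inj₂ refl) | inj₂ (inj₂ refl) = disj S y₁∈ y₂∈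

    no-frame : ∀ {u l a b v z} → Frame u l a b v z → ⊥
    no-frame {u} {l} {a} {b} {v} {z} F with a ~? v | a ~? z | b ~? v | b ~? z
    ... | no ne | _     | _     | _     = frame-nonadjacent F ne
    ... | yes _ | no ne | _     | _     = frame-nonadjacent (swapVZ F) ne
    ... | yes _ | yes _ | no ne | _     = frame-nonadjacent (swapAB F) ne
    ... | yes _ | yes _ | yes _ | no ne = frame-nonadjacent (swapAB (swapVZ F)) ne
    ... | yes p | yes q | yes r | yes s = frame-complete F p q r s

    module Minimal {u v z : V} (S : Split u v z) (u≁v : ¬ u ~ v)
      (ih : ∀ {a b c} (S′ : Split a b c) → ¬ a ~ b → size (X S′) < size (X S) → ⊥) where

      v~ : ∀ {l} → l ∈ˢ X S → v ~ l
      v~ {l} l∈ with v ~? l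
      ... | yes e = e
      ... | no ne = ⊥-elim (shrink (swap₁₂ S) (u≁v ∘ ~-sym) l∈ ne λ (smaller S′ v≁ sub old gone) →
                      ih S′ v≁ (size-< sub old gone))

      u~ : ∀ {l} → l ∈ˢ X S → u ~ l
      u~ {l} l∈ with u ~? l
      ... | yes e = e
      ... | no ne = ⊥-elim (shrink S u≁v l∈ ne λ (smaller S′ u≁ sub old gone) → ih S′ u≁ (size-< sub old gone))

      clique : ∀ {l l′} → l ∈ˢ X S → l′ ∈ˢ X S → l ≢ l′ → l ~ l′
      clique l∈ l′∈ = X-clique S l∈ l′∈ (u~ l∈) (u~ l′∈)

      module Two {l₀ l′} (l₀∈ : l₀ ∈ˢ X S) (l′∈ : l′ ∈ˢ X S) (l′≢l₀ : l′ ≢ l₀)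
        (dominates : ∀ {l y} → l ∈ˢ X S → l ≢ l₀ → l₀ ~ y → y ≢ l → l ~ y) where

        third : ∀ {r t l} → r ∈ˢ Y S → Split l₀ r t → l ∈ˢ X S → l ≢ l₀ → l ≡ t
        third {r} {t} {l} r∈ S₂ l∈ l≢l₀ with l ≟ t
        ... | yes q = q
        ... | no ne with side S₂ l≢l₀ (λ { refl → disj S l∈ r∈ }) ne
        ... | inj₁ m = let (y , y∈ , e) = nbrX (flip S₂) in
                       ⊥-elim (apart S₂ m y∈ (dominates l∈ l≢l₀ e (λ { refl → disj S₂ m y∈ })))
        ... | inj₂ m = let (y , y∈ , e) = nbrX S₂ in
                       ⊥-elim (apart S₂ y∈ m (~-sym (dominates l∈ l≢l₀ e (λ { refl → disj S₂ y∈ m }))))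

        someR : ∃ λ r → r ∈ˢ Y S
        someR = someY S

        X⊆ : ∀ {x} → x ∈ˢ X S → x ≡ l₀ ⊎ x ≡ l′
        X⊆ {x} x∈ with x ≟ l₀ | x ≟ l′
        ... | yes q | _ = inj₁ q
        ... | no _ | yes q = inj₂ q
        ... | no a | no b = ⊥-elim (cuts l₀ r (λ { refl → disj S l₀∈ r∈ }) (apart S l₀∈ r∈) λ t S₂ →
                  b (trans (third r∈ S₂ x∈ a) (sym (third r∈ S₂ l′∈ l′≢l₀))))
          where
          r = proj₁ someR
          r∈ = proj₂ someR

        Nl₀ : ∀ {y} → l₀ ~ y → y ≡ l′ ⊎ y ≡ u ⊎ y ≡ v ⊎ y ≡ z
        Nl₀ e with X-nbr S l₀∈ e
        ... | inj₂ c = inj₂ c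
        ... | inj₁ m with X⊆ m
        ... | inj₁ refl = ⊥-elim (~-irrefl e)
        ... | inj₂ q = inj₁ q

        Nl′ : ∀ {y} → l′ ~ y → y ≡ l₀ ⊎ y ≡ u ⊎ y ≡ v ⊎ y ≡ z
        Nl′ e with X-nbr S l′∈ e
        ... | inj₂ c = inj₂ c
        ... | inj₁ m with X⊆ m
        ... | inj₁ q = inj₁ q
        ... | inj₂ refl = ⊥-elim (~-irrefl e)

        S≢ : ∀ {x} → x ∈ˢ X S → u ≢ x × v ≢ x × z ≢ x
        S≢ m = let (a , b , c) = X≢ S m in ≢-sym a , ≢-sym b , ≢-sym c
        R≢ : ∀ {x} → x ∈ˢ Y S → u ≢ x × v ≢ x × z ≢ x
        R≢ m = let (a , b , c) = Y≢ S m in ≢-sym a , ≢-sym b , ≢-sym c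

        Sep : V → Set
        Sep r = ∃ λ (S₂ : Split l₀ r l′) → u ∈ˢ X S₂ × v ∈ˢ Y S₂

        sep₁ : ∀ {r} → r ∈ˢ Y S → (S₂ : Split l₀ r l′) → u ∈ˢ X S₂ → Sep r
        sep₁ {r} r∈ S₂ u∈ with side S₂ (proj₁ (proj₂ (S≢ l₀∈))) (proj₁ (proj₂ (R≢ r∈))) (proj₁ (proj₂ (S≢ l′∈)))
        ... | inj₂ v∈ = S₂ , u∈ , v∈
        ... | inj₁ v∈ with nbrX (flip S₂)
        ... | y , y∈ , e with Nl₀ e
        ... | inj₁ q                      = ⊥-elim (Y≢r S₂ y∈ q)
        ... | inj₂ (inj₁ refl)            = ⊥-elim (disj S₂ u∈ y∈)
        ... | inj₂ (inj₂ (inj₁ refl))     = ⊥-elim (disj S₂ v∈ y∈)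
        ... | inj₂ (inj₂ (inj₂ refl))     = ⊥-elim (claw (~-sym (u~ l₀∈)) (~-sym (v~ l₀∈)) e (p≢q S) (p≢r S) (q≢r S)
                                              u≁v (apart S₂ u∈ y∈) (apart S₂ v∈ y∈))

        sep : ∀ {r} → r ∈ˢ Y S → ¬ ¬ Sep r
        sep {r} r∈ k = cuts l₀ r (λ { refl → disj S l₀∈ r∈ }) (apart S l₀∈ r∈) λ t S₂ → at t S₂ (third r∈ S₂ l′∈ l′≢l₀)
          where
          at : ∀ t → Split l₀ r t → l′ ≡ t → ⊥
          at t S₂ refl with side S₂ (proj₁ (S≢ l₀∈)) (proj₁ (R≢ r∈)) (proj₁ (S≢ l′∈))
          ... | inj₁ u∈ = k (sep₁ r∈ S₂ u∈)
          ... | inj₂ u∈ = k (sep₁ r∈ (flip S₂) u∈)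

        z-away : ∀ {p q r r₁} (S₂ : Split l₀ r l′) → p ∈ˢ X S₂ → q ∈ˢ Y S₂ →
                 (∀ {y} → l₀ ~ y → y ≡ l′ ⊎ y ≡ p ⊎ y ≡ q ⊎ y ≡ z) → (∀ {y} → l′ ~ y → y ≡ l₀ ⊎ y ≡ p ⊎ y ≡ q ⊎ y ≡ z) →
                 r ∈ˢ Y S → r₁ ∈ˢ Y S → p ~ r₁ → r₁ ≢ r → ¬ z ~ q
        z-away {p} {q} {r} {r₁} S₂ p∈ q∈ N₀ N′ r∈ r₁∈ p~r₁ r₁≢r z~q
          with side S₂ (proj₂ (proj₂ (S≢ l₀∈))) (proj₂ (proj₂ (R≢ r∈))) (proj₂ (proj₂ (S≢ l′∈)))
        ... | inj₁ z∈ = apart S₂ z∈ q∈ z~q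
        ... | inj₂ z∈ = separated p r (λ x → x ∈ˢ X S₂ × x ≢ p) closed r₁ q
              (X-closed S₂ p∈ p~r₁ (λ { refl → disj S l₀∈ r₁∈ }) r₁≢r (λ { refl → disj S l′∈ r₁∈ }) , ≢-sym (~⇒≢ p~r₁))
              (≢-sym (~⇒≢ p~r₁)) r₁≢r (λ m → disj S₂ (proj₁ m) q∈) (λ { refl → disj S₂ p∈ q∈ }) (Y≢q S₂ q∈)
          where
          not-seen : ∀ {x} → x ∈ˢ X S₂ → x ≢ p → ¬ (x ≡ p ⊎ x ≡ q ⊎ x ≡ z)
          not-seen x∈ x≢p (inj₁ e)           = x≢p e
          not-seen x∈ x≢p (inj₂ (inj₁ refl)) = disj S₂ x∈ q∈
          not-seen x∈ x≢p (inj₂ (inj₂ refl)) = disj S₂ x∈ z∈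
          closed : ∀ x y → x ∈ˢ X S₂ × x ≢ p → x ~ y → y ≢ p → y ≢ r → y ∈ˢ X S₂ × y ≢ p
          closed x y (x∈ , x≢p) e y≢p y≢r with X-nbr S₂ x∈ e
          ... | inj₁ y∈ = y∈ , y≢p
          ... | inj₂ (inj₂ (inj₁ e′)) = ⊥-elim (y≢r e′)
          ... | inj₂ (inj₁ refl) = ⊥-elim ([ X≢r S₂ x∈ , not-seen x∈ x≢p ]′ (N₀ (~-sym e)))
          ... | inj₂ (inj₂ (inj₂ refl)) = ⊥-elim ([ X≢p S₂ x∈ , not-seen x∈ x≢p ]′ (N′ (~-sym e)))

        lonely : ∀ {r} → ¬ ∃ (λ x → x ∈ˢ Y S × x ≢ r) → ⊥
        lonely {r} none = ih (flip S) u≁v (ℕₚ.≤-trans (s≤s one) two)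
          where
          only : ∀ {x} → x ∈ˢ Y S → x ≡ r
          only {x} x∈ with x ≟ r
          ... | yes q = q
          ... | no q  = ⊥-elim (none (x , x∈ , q))
          one : size (Y S) ≤ 1
          one = Unique-⊆-length _ {r ∷ []} (Unique-list (Y S)) (λ m → here (only (∈-list⁻ {Y S} m)))
          two : 2 ≤ size (X S)
          two = Unique-⊆-length (l₀ ∷ l′ ∷ []) ((≢-sym l′≢l₀ ∷ []) ∷ [] ∷ [])
                  λ { (here refl) → ∈-list l₀∈ ; (there (here refl)) → ∈-list l′∈ }

        impossible : ⊥
        impossible with nbrX (flip S) | nbrX (flip (swap₁₂ S))
        ... | r₁ , r₁∈ , u~r₁ | r₂ , r₂∈ , v~r₂ with any? (λ r → (r ∈ˢ? Y S) ×-dec ¬? (r ≟ r₁)) | any? (λ r → (r ∈ˢ? Y S) ×-dec ¬? (r ≟ r₂))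
        ... | no none | _ = lonely none
        ... | yes _ | no none = lonely none
        ... | yes (r , r∈ , r≢r₁) | yes (r′ , r′∈ , r′≢r₂) =
          sep r∈ λ (S₂ , u∈ , v∈) → sep r′∈ λ (S₃ , u∈₃ , v∈₃) →
            let z≁v = z-away S₂ u∈ v∈ Nl₀ Nl′ r∈ r₁∈ u~r₁ (≢-sym r≢r₁)
                z≁u = z-away (flip S₃) v∈₃ u∈₃ (sw ∘ Nl₀) (sw ∘ Nl′) r′∈ r₂∈ v~r₂ (≢-sym r′≢r₂)
                (l , l∈ , z~l) = nbrX (swap₁₂ (swap₂₃ S))
            in claw (~-sym (u~ l∈)) (~-sym (v~ l∈)) (~-sym z~l) (p≢q S) (p≢r S) (q≢r S) u≁v (z≁u ∘ ~-sym) (z≁v ∘ ~-sym)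
          where
          sw : ∀ {A B C D : Set} → A ⊎ B ⊎ C ⊎ D → A ⊎ C ⊎ B ⊎ D
          sw (inj₁ a) = inj₁ a
          sw (inj₂ (inj₁ b)) = inj₂ (inj₂ (inj₁ b))
          sw (inj₂ (inj₂ (inj₁ c))) = inj₂ (inj₁ c)
          sw (inj₂ (inj₂ (inj₂ d))) = inj₂ (inj₂ (inj₂ d))

      not-two : ∀ {l l′} → l ∈ˢ X S → l′ ∈ˢ X S → l ≢ l′ → ⊥
      not-two {l} {l′} l∈ l′∈ l≢l′ with any? (λ x → (x ∈ˢ? X S) ×-dec ¬? (x ~? z))
      ... | yes (l₀ , l₀∈ , l₀≁z) = pick (λ x∈ x≢l₀ e y≢x → dom x∈ x≢l₀ e y≢x (X-nbr S l₀∈ e)) l₀∈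
        where
        dom : ∀ {x y} → x ∈ˢ X S → x ≢ l₀ → l₀ ~ y → y ≢ x → y ∈ˢ X S ⊎ (y ≡ u ⊎ y ≡ v ⊎ y ≡ z) → x ~ y
        dom x∈ x≢l₀ e y≢x (inj₁ y∈) = clique x∈ y∈ (≢-sym y≢x)
        dom x∈ x≢l₀ e y≢x (inj₂ (inj₁ refl)) = ~-sym (u~ x∈)
        dom x∈ x≢l₀ e y≢x (inj₂ (inj₂ (inj₁ refl))) = ~-sym (v~ x∈)
        dom x∈ x≢l₀ e y≢x (inj₂ (inj₂ (inj₂ refl))) = ⊥-elim (l₀≁z e)
        pick : (∀ {x y} → x ∈ˢ X S → x ≢ l₀ → l₀ ~ y → y ≢ x → x ~ y) → l₀ ∈ˢ X S → ⊥
        pick d l₀∈ with l ≟ l₀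
        ... | yes refl = Two.impossible l₀∈ l′∈ (≢-sym l≢l′) d
        ... | no ne    = Two.impossible l₀∈ l∈ ne d
      ... | no none = Two.impossible l∈ l′∈ (≢-sym l≢l′) λ x∈ x≢l₀ e y≢x → dom x∈ y≢x (X-nbr S l∈ e)
        where
        dom : ∀ {x y} → x ∈ˢ X S → y ≢ x → y ∈ˢ X S ⊎ (y ≡ u ⊎ y ≡ v ⊎ y ≡ z) → x ~ y
        dom x∈ y≢x (inj₁ y∈) = clique x∈ y∈ (≢-sym y≢x)
        dom x∈ y≢x (inj₂ (inj₁ refl)) = ~-sym (u~ x∈)
        dom x∈ y≢x (inj₂ (inj₂ (inj₁ refl))) = ~-sym (v~ x∈)
        dom {x} x∈ y≢x (inj₂ (inj₂ (inj₂ refl))) with x ~? z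
        ... | yes e = e
        ... | no ne = ⊥-elim (none (x , x∈ , ne))

    module Single {u v z l : V} (S : Split u v z) (u≁v : ¬ u ~ v) (l∈ : l ∈ˢ X S) (only : ∀ {x} → x ∈ˢ X S → x ≡ l)
      (l~u : l ~ u) (l~v : l ~ v) where

      Nl : ∀ {y} → l ~ y → y ≡ u ⊎ y ≡ v ⊎ y ≡ z
      Nl e with X-nbr S l∈ e
      ... | inj₂ c = c
      ... | inj₁ m = ⊥-elim (~⇒≢ e (sym (only m)))

      l~z : l ~ z
      l~z with neighbour-avoiding l u v (≢-sym (~⇒≢ l~u)) (≢-sym (~⇒≢ l~v))
      ... | y , e , y≢u , y≢v with Nl e
      ... | inj₁ q           = ⊥-elim (y≢u q)
      ... | inj₂ (inj₁ q)    = ⊥-elim (y≢v q)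
      ... | inj₂ (inj₂ refl) = e

      l≢R : ∀ {r} → r ∈ˢ Y S → l ≢ r
      l≢R r∈ refl = disj S l∈ r∈

      -- Repeatedly shrinking the side of u in cuts through l isolates u.
      corner : ∀ m {p q} (T : Split l p q) → size (X T) < m → ¬ l ~ p → (∀ {x} → x ∈ˢ X T → l ~ x → x ≡ u) →
               (∀ {a b} → l ≢ a → l ≢ b → a ≢ b → (∀ {y} → u ~ y → y ≡ l ⊎ y ≡ a ⊎ y ≡ b) → ⊥) → ⊥
      corner (suc m) {p} {q} T (s≤s h) l≁p near k with any? (λ w → (w ∈ˢ? X T) ×-dec ¬? (l ~? w))
      ... | yes (w , w∈ , l≁w) = shrink T l≁p w∈ l≁w λ (smaller T′ l≁ sub old gone) →
              corner m T′ (ℕₚ.≤-trans (size-< sub old gone) h) l≁ (near ∘ sub) k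
      ... | no none = k (p≢q T) (p≢r T) (q≢r T) λ e → out (X-nbr T u∈ e) e
        where
        all-u : ∀ {x} → x ∈ˢ X T → x ≡ u
        all-u {x} x∈ with l ~? x
        ... | yes e = near x∈ e
        ... | no ne = ⊥-elim (none (x , x∈ , ne))
        u∈ : u ∈ˢ X T
        u∈ = subst (_∈ˢ X T) (all-u (proj₂ (someX T))) (proj₂ (someX T))
        out : ∀ {y} → y ∈ˢ X T ⊎ (y ≡ l ⊎ y ≡ p ⊎ y ≡ q) → u ~ y → y ≡ l ⊎ y ≡ p ⊎ y ≡ q
        out (inj₂ c) e = c
        out (inj₁ m) e = ⊥-elim (~⇒≢ e (sym (all-u m)))

      -- z sees exactly one of u, v: the two triangles l v z and u a b face each other.
      one-hinge : v ~ z → ¬ u ~ z → ⊥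
      one-hinge v~z u≁z = cuts l r (l≢R r∈) (apart S l∈ r∈) λ t T → go t T
        where
        r = proj₁ (someY S)
        r∈ = proj₂ (someY S)
        finish : ∀ {a b} → l ≢ a → l ≢ b → a ≢ b → (∀ {y} → u ~ y → y ≡ l ⊎ y ≡ a ⊎ y ≡ b) → ⊥
        finish {a} {b} l≢a l≢b a≢b Nu = no-frame (record
          { u~l = ~-sym l~u ; u~a = u~a ; u~b = u~b ; l~v = l~v ; l~z = l~z ; a~b = a~b ; v~z = v~z ; Nu = Nu ; Nl = Nl
          ; u≢v = p≢q S ; u≢z = p≢r S ; l≢a = l≢a ; l≢b = l≢b
          ; a≢v = λ { refl → u≁v u~a } ; a≢z = λ { refl → u≁z u~a } ; b≢v = λ { refl → u≁v u~b } ; b≢z = λ { refl → u≁z u~b } })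
          where
          u~a : u ~ a
          u~a with l ≟ u | b ≟ u
          ... | yes q | _ = ⊥-elim (~⇒≢ l~u q)
          ... | no l≢u | yes refl with neighbour-avoiding u l l l≢u l≢u
          ... | y , e , y≢l , _ with Nu e
          ... | inj₁ q = ⊥-elim (y≢l q)
          ... | inj₂ (inj₁ refl) = e
          ... | inj₂ (inj₂ refl) = ⊥-elim (~-irrefl e)
          u~a | no l≢u | no b≢u with neighbour-avoiding u l b l≢u b≢u
          ... | y , e , y≢l , y≢b with Nu e
          ... | inj₁ q = ⊥-elim (y≢l q)
          ... | inj₂ (inj₁ refl) = e
          ... | inj₂ (inj₂ q) = ⊥-elim (y≢b q)
          u~b : u ~ b
          u~b with neighbour-avoiding u l a (~⇒≢ l~u) (≢-sym (~⇒≢ u~a))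
          ... | y , e , y≢l , y≢a with Nu e
          ... | inj₁ q = ⊥-elim (y≢l q)
          ... | inj₂ (inj₁ q) = ⊥-elim (y≢a q)
          ... | inj₂ (inj₂ refl) = e
          l≁ : ∀ {x} → u ~ x → ¬ l ~ x
          l≁ e f with Nl f
          ... | inj₁ refl        = ~-irrefl e
          ... | inj₂ (inj₁ refl) = u≁v e
          ... | inj₂ (inj₂ refl) = u≁z e
          a~b : a ~ b
          a~b with a ~? b
          ... | yes e = e
          ... | no ne = ⊥-elim (claw (~-sym l~u) u~a u~b l≢a l≢b a≢b (l≁ u~a) (l≁ u~b) ne)
        go₁ : ∀ {t} (T : Split l r t) → u ∈ˢ X T → ⊥
        go₁ {t} T u∈ = corner (suc (size (X T))) T ℕₚ.≤-refl (apart S l∈ r∈) near finish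
          where
          -- v and z are adjacent, and one of them lies on the other side.
          near : ∀ {x} → x ∈ˢ X T → l ~ x → x ≡ u
          near x∈ e with Nl e | nbrX (flip T)
          ... | inj₁ q | _ = q
          ... | inj₂ x≡ | y , y∈ , f with x≡ | Nl f
          ... | _         | inj₁ refl        = ⊥-elim (disj T u∈ y∈)
          ... | inj₁ refl | inj₂ (inj₁ refl) = ⊥-elim (disj T x∈ y∈)
          ... | inj₁ refl | inj₂ (inj₂ refl) = ⊥-elim (apart T x∈ y∈ v~z)
          ... | inj₂ refl | inj₂ (inj₁ refl) = ⊥-elim (apart T x∈ y∈ (~-sym v~z))
          ... | inj₂ refl | inj₂ (inj₂ refl) = ⊥-elim (disj T x∈ y∈)
        go : ∀ t → Split l r t → ⊥
        go t T with nbrX T | nbrX (flip T)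
        ... | y₁ , y₁∈ , e₁ | y₂ , y₂∈ , e₂ with Nl e₁ | Nl e₂
        ... | inj₁ refl | _ = go₁ T y₁∈
        ... | inj₂ _ | inj₁ refl = go₁ (flip T) y₂∈
        ... | inj₂ (inj₁ refl) | inj₂ (inj₁ refl) = disj T y₁∈ y₂∈
        ... | inj₂ (inj₁ refl) | inj₂ (inj₂ refl) = apart T y₁∈ y₂∈ v~z
        ... | inj₂ (inj₂ refl) | inj₂ (inj₁ refl) = apart T y₁∈ y₂∈ (~-sym v~z)
        ... | inj₂ (inj₂ refl) | inj₂ (inj₂ refl) = disj T y₁∈ y₂∈

      -- z sees both u and v: the wheel with hub z.
      two-hinges : z ~ u → z ~ v → ⊥
      two-hinges z~u z~v = wheel
        where
        Sep : V → Set
        Sep r = ∃ λ (T : Split l r z) → u ∈ˢ X T × v ∈ˢ Y T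

        sep : ∀ {r} → r ∈ˢ Y S → ¬ ¬ Sep r
        sep {r} r∈ k = cuts l r (l≢R r∈) (apart S l∈ r∈) λ t T → at t T (z ≟ t)
          where
          at : ∀ t → Split l r t → Dec (z ≡ t) → ⊥
          at t T (yes refl) with nbrX T | nbrX (flip T)
          ... | y₁ , y₁∈ , e₁ | y₂ , y₂∈ , e₂ with Nl e₁ | Nl e₂
          ... | inj₂ (inj₂ refl) | _                = X≢r T y₁∈ refl
          ... | inj₁ _           | inj₂ (inj₂ refl) = Y≢r T y₂∈ refl
          ... | inj₂ (inj₁ _)    | inj₂ (inj₂ refl) = Y≢r T y₂∈ refl
          ... | inj₁ refl        | inj₁ refl        = disj T y₁∈ y₂∈
          ... | inj₁ refl        | inj₂ (inj₁ refl) = k (T , y₁∈ , y₂∈)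
          ... | inj₂ (inj₁ refl) | inj₁ refl        = k (flip T , y₂∈ , y₁∈)
          ... | inj₂ (inj₁ refl) | inj₂ (inj₁ refl) = disj T y₁∈ y₂∈
          at t T (no z≢t) with side T (≢-sym (~⇒≢ l~z)) (≢-sym (Y≢r S r∈)) z≢t
          ... | inj₁ z∈ with nbrX (flip T)
          ... | y , y∈ , e with Nl e
          ... | inj₁ refl        = apart T z∈ y∈ z~u
          ... | inj₂ (inj₁ refl) = apart T z∈ y∈ z~v
          ... | inj₂ (inj₂ refl) = disj T z∈ y∈
          at t T (no z≢t) | inj₂ z∈ with nbrX T
          ... | y , y∈ , e with Nl e
          ... | inj₁ refl        = apart T y∈ z∈ (~-sym z~u)
          ... | inj₂ (inj₁ refl) = apart T y∈ z∈ (~-sym z~v)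
          ... | inj₂ (inj₂ refl) = disj T y∈ z∈

        -- Two neighbours r, r′ of p in Y S: both would have to be passed on every way from p to q.
        uncross : ∀ {p q r r′} (T : Split l r z) (T′ : Split l r′ z) → p ∈ˢ X T → q ∈ˢ Y T → p ∈ˢ X T′ → q ∈ˢ Y T′ →
                  r ∈ˢ Y S → r′ ∈ˢ Y S → p ~ r → p ~ r′ → r ≢ r′ → ⊥
        uncross {p} {q} {r} {r′} T T′ p∈ q∈ p∈′ q∈′ r∈ r′∈ p~r p~r′ r≢r′ =
          separated l z (λ x → x ∈ˢ Y T × x ∈ˢ Y T′) closed q p (q∈ , q∈′) (Y≢p T q∈) (Y≢r T q∈)
            (λ m → disj T p∈ (proj₁ m)) (X≢p T p∈) (X≢r T p∈)
          where
          r∈′ : r ∈ˢ X T′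
          r∈′ = X-closed T′ p∈′ p~r (≢-sym (l≢R r∈)) r≢r′ (Y≢r S r∈)
          r′∈₁ : r′ ∈ˢ X T
          r′∈₁ = X-closed T p∈ p~r′ (≢-sym (l≢R r′∈)) (≢-sym r≢r′) (Y≢r S r′∈)
          closed : ∀ x y → x ∈ˢ Y T × x ∈ˢ Y T′ → x ~ y → y ≢ l → y ≢ z → y ∈ˢ Y T × y ∈ˢ Y T′
          closed x y (x∈ , x∈′) e y≢l y≢z with y ≟ r | y ≟ r′
          ... | yes refl | _ = ⊥-elim (apart T′ r∈′ x∈′ (~-sym e))
          ... | no _ | yes refl = ⊥-elim (apart T r′∈₁ x∈ (~-sym e))
          ... | no a | no b = X-closed (flip T) x∈ e y≢l a y≢z , X-closed (flip T′) x∈′ e y≢l b y≢z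

        unique-u : ∀ {r r′} → r ∈ˢ Y S → r′ ∈ˢ Y S → u ~ r → u ~ r′ → r ≡ r′
        unique-u {r} {r′} r∈ r′∈ e e′ with r ≟ r′
        ... | yes q = q
        ... | no ne = ⊥-elim (sep r∈ λ (T , u∈ , v∈) → sep r′∈ λ (T′ , u∈′ , v∈′) →
                        uncross T T′ u∈ v∈ u∈′ v∈′ r∈ r′∈ e e′ ne)

        unique-v : ∀ {r r′} → r ∈ˢ Y S → r′ ∈ˢ Y S → v ~ r → v ~ r′ → r ≡ r′
        unique-v {r} {r′} r∈ r′∈ e e′ with r ≟ r′
        ... | yes q = q
        ... | no ne = ⊥-elim (sep r∈ λ (T , u∈ , v∈) → sep r′∈ λ (T′ , u∈′ , v∈′) →
                        uncross (flip T) (flip T′) v∈ u∈ v∈′ u∈′ r∈ r′∈ e e′ ne)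

        r₁ = proj₁ (nbrX (flip S))
        r₁∈ : r₁ ∈ˢ Y S
        r₁∈ = proj₁ (proj₂ (nbrX (flip S)))
        u~r₁ : u ~ r₁
        u~r₁ = proj₂ (proj₂ (nbrX (flip S)))
        r₂ = proj₁ (nbrX (flip (swap₁₂ S)))
        r₂∈ : r₂ ∈ˢ Y S
        r₂∈ = proj₁ (proj₂ (nbrX (flip (swap₁₂ S))))
        v~r₂ : v ~ r₂
        v~r₂ = proj₂ (proj₂ (nbrX (flip (swap₁₂ S))))

        -- At the hub, u and v are nonadjacent, so a further neighbour sees one of them.
        hub-nbr : ∀ {k} → k ∈ˢ Y S → z ~ k → k ≡ r₁ ⊎ k ≡ r₂
        hub-nbr {k} k∈ e with u ~? k | v ~? k
        ... | yes f | _ = inj₁ (unique-u k∈ r₁∈ f u~r₁)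
        ... | no _ | yes f = inj₂ (unique-v k∈ r₂∈ f v~r₂)
        ... | no a | no b = ⊥-elim (claw z~u z~v e (p≢q S) (≢-sym (Y≢p S k∈)) (≢-sym (Y≢q S k∈)) u≁v a b)

        Y⊆ : ∀ {x} → x ∈ˢ Y S → x ≡ r₁ ⊎ x ≡ r₂
        Y⊆ {x} x∈ with x ≟ r₁ | x ≟ r₂
        ... | yes q | _ = inj₁ q
        ... | no _ | yes q = inj₂ q
        ... | no a | no b = ⊥-elim (separated r₁ r₂ (λ x → x ∈ˢ Y S × x ≢ r₁ × x ≢ r₂) closed x l (x∈ , a , b) a b
                              (λ m → disj S l∈ (proj₁ m)) (l≢R r₁∈) (l≢R r₂∈))
          where
          closed : ∀ x y → x ∈ˢ Y S × x ≢ r₁ × x ≢ r₂ → x ~ y → y ≢ r₁ → y ≢ r₂ → y ∈ˢ Y S × y ≢ r₁ × y ≢ r₂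
          closed x y (x∈ , a , b) e c d with X-nbr (flip S) x∈ e
          ... | inj₁ y∈ = y∈ , c , d
          ... | inj₂ (inj₁ refl) = ⊥-elim (a (unique-u x∈ r₁∈ (~-sym e) u~r₁))
          ... | inj₂ (inj₂ (inj₁ refl)) = ⊥-elim (b (unique-v x∈ r₂∈ (~-sym e) v~r₂))
          ... | inj₂ (inj₂ (inj₂ refl)) = ⊥-elim ([ a , b ]′ (hub-nbr x∈ (~-sym e)))

        l≁R : ∀ {r} → r ∈ˢ Y S → ¬ l ~ r
        l≁R = apart S l∈

        wheel : ⊥
        wheel with r₁ ≟ r₂
        ... | yes q = rim4 l~u u~r₁ (~-sym (subst (v ~_) (sym q) v~r₂)) (~-sym l~v) (l≢R r₁∈) (p≢q S)
                (λ { (here refl) → ~-irrefl l~z ; (there (here refl)) → ~-irrefl z~u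
                   ; (there (there (here e))) → Y≢r S r₁∈ (sym e)
                   ; (there (there (there (here refl)))) → ~-irrefl z~v })
                around
          where
          around : ∀ y → z ~ y → y ∈ l ∷ u ∷ r₁ ∷ v ∷ []
          around y e with cover S y
          ... | inj₁ (inj₁ refl)        = there (here refl)
          ... | inj₁ (inj₂ (inj₁ refl)) = there (there (there (here refl)))
          ... | inj₁ (inj₂ (inj₂ refl)) = ⊥-elim (~-irrefl e)
          ... | inj₂ (inj₁ m)           = here (only m)
          ... | inj₂ (inj₂ m) with Y⊆ m
          ... | inj₁ p = there (there (here p))
          ... | inj₂ p = there (there (here (trans p (sym q))))
        ... | no r₁≢r₂ = noW5 (mkCopy W5 (z ∷ l ∷ u ∷ r₁ ∷ r₂ ∷ v ∷ [])
            ((~-sym l~z , z~u , z~r₁ , z~r₂ , z~v , tt)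
            , (l~u , ≁⇒false (l≁R r₁∈) , ≁⇒false (l≁R r₂∈) , l~v , tt)
            , (u~r₁ , ≁⇒false u≁r₂ , ≁⇒false u≁v , tt)
            , (r₁~r₂ , ≁⇒false (v≁r₁ ∘ ~-sym) , tt) , (~-sym v~r₂ , tt) , tt , tt) all-six)
          where
          u≁r₂ : ¬ u ~ r₂
          u≁r₂ e = r₁≢r₂ (unique-u r₁∈ r₂∈ u~r₁ e)
          v≁r₁ : ¬ v ~ r₁
          v≁r₁ e = r₁≢r₂ (unique-v r₁∈ r₂∈ e v~r₂)
          u≢r₁ = ~⇒≢ u~r₁
          v≢r₂ = ~⇒≢ v~r₂
          z≢ : ∀ {r} → r ∈ˢ Y S → z ≢ r
          z≢ m = ≢-sym (Y≢r S m)
          Nr₁ : ∀ {y} → r₁ ~ y → y ≡ u ⊎ y ≡ r₂ ⊎ y ≡ z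
          Nr₁ e with X-nbr (flip S) r₁∈ e
          ... | inj₂ (inj₁ q) = inj₁ q
          ... | inj₂ (inj₂ (inj₁ refl)) = ⊥-elim (v≁r₁ (~-sym e))
          ... | inj₂ (inj₂ (inj₂ q)) = inj₂ (inj₂ q)
          ... | inj₁ m = [ (λ { refl → ⊥-elim (~-irrefl e) }) , inj₂ ∘ inj₁ ]′ (Y⊆ m)
          r₁~r₂ : r₁ ~ r₂
          r₁~r₂ with neighbour-avoiding r₁ u z u≢r₁ (z≢ r₁∈)
          ... | y , e , a , b with Nr₁ e
          ... | inj₁ q = ⊥-elim (a q)
          ... | inj₂ (inj₁ refl) = e
          ... | inj₂ (inj₂ q) = ⊥-elim (b q)
          z~r₁ : z ~ r₁
          z~r₁ with neighbour-avoiding r₁ u r₂ u≢r₁ (≢-sym r₁≢r₂)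
          ... | y , e , a , b with Nr₁ e
          ... | inj₁ q = ⊥-elim (a q)
          ... | inj₂ (inj₁ q) = ⊥-elim (b q)
          ... | inj₂ (inj₂ refl) = ~-sym e
          z~r₂ : z ~ r₂
          z~r₂ with neighbour-avoiding r₂ v r₁ v≢r₂ r₁≢r₂
          ... | y , e , a , b with X-nbr (flip S) r₂∈ e
          ... | inj₂ (inj₁ refl) = ⊥-elim (u≁r₂ (~-sym e))
          ... | inj₂ (inj₂ (inj₁ q)) = ⊥-elim (a q)
          ... | inj₂ (inj₂ (inj₂ refl)) = ~-sym e
          ... | inj₁ m = ⊥-elim ([ b , (λ { refl → ~-irrefl e }) ]′ (Y⊆ m))
          all-six : ∀ y → ∃ λ i → lookup (z ∷ l ∷ u ∷ r₁ ∷ r₂ ∷ v ∷ []) i ≡ y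
          all-six y with cover S y
          ... | inj₁ (inj₁ q)        = suc (suc zero) , sym q
          ... | inj₁ (inj₂ (inj₁ q)) = suc (suc (suc (suc (suc zero)))) , sym q
          ... | inj₁ (inj₂ (inj₂ q)) = zero , sym q
          ... | inj₂ (inj₁ m)        = suc zero , sym (only m)
          ... | inj₂ (inj₂ m) with Y⊆ m
          ... | inj₁ q = suc (suc (suc zero)) , sym q
          ... | inj₂ q = suc (suc (suc (suc zero))) , sym q

    no-split : ∀ m {u v z} (S : Split u v z) → ¬ u ~ v → size (X S) < m → ⊥
    no-split (suc m) {u} {v} {z} S u≁v (s≤s h) with someX S
    ... | l , l∈ with any? (λ x → (x ∈ˢ? X S) ×-dec ¬? (x ≟ l))
    ... | yes (l′ , l′∈ , ne) = M.not-two l′∈ l∈ ne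
      where module M = Minimal S u≁v (λ S′ ne lt → no-split m S′ ne (ℕₚ.≤-trans lt h))
    ... | no none = hinge (u ~? z) (v ~? z)
      where
      module M = Minimal S u≁v (λ S′ ne lt → no-split m S′ ne (ℕₚ.≤-trans lt h))
      only : ∀ {x} → x ∈ˢ X S → x ≡ l
      only {x} x∈ with x ≟ l
      ... | yes q = q
      ... | no ne = ⊥-elim (none (x , x∈ , ne))
      l~u = ~-sym (M.u~ l∈)
      l~v = ~-sym (M.v~ l∈)
      module A = Single S u≁v l∈ only l~u l~v
      module B = Single (swap₁₂ S) (u≁v ∘ ~-sym) l∈ only l~v l~u
      hinge : Dec (u ~ z) → Dec (v ~ z) → ⊥
      hinge (yes p) (yes q) = A.two-hinges (~-sym p) (~-sym q)
      hinge (no p)  (yes q) = A.one-hinge q p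
      hinge (yes p) (no q)  = B.one-hinge p q
      hinge (no p)  (no q)  = claw l~u l~v A.l~z (p≢q S) (p≢r S) (q≢r S) u≁v p q

    complete : ∀ u v → u ≢ v → u ~ v
    complete u v u≢v with u ~? v
    ... | yes e = e
    ... | no ne = ⊥-elim (cuts u v u≢v ne λ t S → no-split (suc (size (X S))) S ne ℕₚ.≤-refl)

module Links {n : ℕ} (G : Graph n) (simple : IsSimple G) (conn : ThreeConnected G) (clawfree : ClawFree G) (nice : CycleNice G) where

  open Walks G simple
  open Connected3 conn
  open Splits G simple conn clawfree
  open Split

  final : V → List V → V
  final x []       = x
  final x (y ∷ ys) = final y ys

  first-++ : ∀ m {y r z} → first (m ++ y ∷ r) z ≡ first m y
  first-++ []      = refl
  first-++ (_ ∷ _) = refl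

  final-++ : ∀ {x} m {y r} → final x (m ++ y ∷ r) ≡ final y r
  final-++ []      = refl
  final-++ (_ ∷ m) = final-++ m

  first-∈ : ∀ m {z} → first m z ∈ m ++ z ∷ []
  first-∈ []      = here refl
  first-∈ (_ ∷ _) = here refl

  arc-final : ∀ {x m y} → Arc x m y → final x m ~ y
  arc-final (edge e) = e
  arc-final (_ ◅ p)  = arc-final p

  record Link (v x : V) (m : List V) : Set where
    constructor link
    field
      cyc : Cycle x m
      v∉  : v ∉ x ∷ m
      N⊆  : ∀ {y} → v ~ y → y ∈ x ∷ m
  open Link

  abstract
    link-length : ∀ {v x m} → Link v x m → 3 ≤ length (x ∷ m)
    link-length {v} L = Unique-⊆-length (a ∷ b ∷ c ∷ []) ((a≢b ∷ a≢c ∷ []) ∷ (b≢c ∷ []) ∷ [] ∷ [])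
        λ { (here refl) → N⊆ L x~a ; (there (here refl)) → N⊆ L x~b ; (there (there (here refl))) → N⊆ L x~c }
      where open ThreeNeighbours (three-neighbours v)

  abstract
    not-even : ∀ {v x m} → Link v x m → ¬ Even (length (x ∷ m))
    not-even {v} {x} {m} L ev = isolated (nice x m (uniq (cyc L) , link-length L , ev , arc-linked (arc (cyc L))))
      where
      isolated : ¬ HasPerfectMatchingAvoiding G (x ∷ m)
      isolated (μ , matched) = let (μ∉ , e , _) = matched v (v∉ L) in μ∉ (N⊆ L e)

  link-↭ : ∀ {v x m x′ m′} → Link v x m → Arc x′ m′ x′ → x ∷ m ↭ x′ ∷ m′ → Link v x′ m′
  link-↭ L a p = link (cycle a (Unique-resp-↭ p (uniq (cyc L)))) (v∉ L ∘ ∈-resp-↭ (↭-sym p)) (∈-resp-↭ p ∘ N⊆ L)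

  rotate-↭ : ∀ {A : Set} {x w : A} m₁ {m₂} → x ∷ m₁ ++ w ∷ m₂ ↭ w ∷ m₂ ++ x ∷ m₁
  rotate-↭ {x = x} {w} m₁ {m₂} = let open ↭-Solver in
    solve 4 (λ x a w b → x ⊕ (a ⊕ (w ⊕ b)) ⊜ w ⊕ (b ⊕ (x ⊕ a))) ↭-refl (x ∷ []) m₁ (w ∷ []) m₂

  abstract
    link-rotate : ∀ {v x w} m₁ {m₂} → Link v x (m₁ ++ w ∷ m₂) → Link v w (m₂ ++ x ∷ m₁)
    link-rotate m₁ L = link-↭ L (arc (rotate m₁ (cyc L))) (rotate-↭ m₁)

  record RootedAt (v c : V) (vs : List V) : Set where
    constructor rooted
    field
      {rest} : List V
      lnk    : Link v c rest
      perm   : vs ↭ c ∷ rest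

  abstract
    root : ∀ {v x m c} → Link v x m → c ∈ x ∷ m → RootedAt v c (x ∷ m)
    root L (here refl) = rooted L ↭-refl
    root L (there c∈) with ∈-∃++ c∈
    ... | m₁ , m₂ , refl = rooted (link-rotate m₁ L) (rotate-↭ m₁)

  abstract
    link-insert : ∀ {v c m x} → Link v c m → x ∉ c ∷ m → x ≢ v → c ~ x → ¬ x ~ first m c
    link-insert {v} {c} {m} {x} L x∉ x≢v c~x x~s with even-or-odd (length (c ∷ m))
    ... | inj₁ ev = not-even L ev
    ... | inj₂ od = not-even (link {x = c} {m = x ∷ m} (cycle (c~x ◅ arc-rehead (arc (cyc L)) x~s)
                        (Unique-resp-↭ p (∉-Unique x∉ (uniq (cyc L)))))
                      (λ v∈ → [ (λ { refl → x≢v refl }) , v∉ L ]′ (split∈ (∈-resp-↭ (↭-sym p) v∈)))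
                      (∈-resp-↭ p ∘ there ∘ N⊆ L)) od
      where
      p : x ∷ c ∷ m ↭ c ∷ x ∷ m
      p = _↭_.swap x c ↭-refl
      split∈ : ∀ {y} → y ∈ x ∷ c ∷ m → y ≡ x ⊎ y ∈ c ∷ m
      split∈ (here e) = inj₁ e
      split∈ (there e) = inj₂ e

  abstract
    link-reverse : ∀ {v c m} → Link v c m → Link v c (reverse m)
    link-reverse {m = m} L = link-↭ L (arc-rev (arc (cyc L))) (prep _ (↭-sym (↭-reverse m)))

  first-reverse : ∀ {c} m → first (reverse m) c ≡ final c m
  first-reverse {c} m with initLast m
  ... | []       = refl
  ... | k ∷ʳ′ p rewrite reverse-++ k (p ∷ []) | final-++ {c} k {p} {[]} = refl

  record Attachment (v c : V) (m : List V) (x : V) : Set where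
    field
      v~c : v ~ c
      v~s : v ~ first m c
      v~p : v ~ final c m
      x≁s : ¬ x ~ first m c
      x≁p : ¬ x ~ final c m
      p~s : final c m ~ first m c
      p≢s : final c m ≢ first m c

  abstract
    attachment : ∀ {v c m x} → Link v c m → x ∉ c ∷ m → x ≢ v → c ~ x → Attachment v c m x
    attachment {m = []}    L _ _ _ = ⊥-elim (ℕₚ.<⇒≱ (s≤s (s≤s z≤n)) (link-length L))
    attachment {v} {c} {s ∷ m} {x} L x∉ x≢v c~x with initLast m
    ... | [] = ⊥-elim (ℕₚ.<⇒≱ (s≤s (s≤s (s≤s z≤n))) (link-length L))
    ... | k ∷ʳ′ p = record
        { v~c = v~c ; v~s = v~s ; v~p = subst (v ~_) (sym last) v~p ; x≁s = x≁s ; x≁p = x≁p ∘ subst (x ~_) last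
        ; p~s = subst (_~ s) (sym last) p~s ; p≢s = p≢s ∘ trans (sym last) }
      where
      last : final s (k ∷ʳ p) ≡ p
      last = final-++ {s} k
      u : Unique (c ∷ s ∷ (k ∷ʳ p))
      u = uniq (cyc L)
      p∈k : p ∈ k ∷ʳ p
      p∈k = ∈-++⁺ʳ k (here refl)
      p≢s : p ≢ s
      p≢s refl = Unique-head (Unique-++ʳ (c ∷ []) u) p∈k
      c~s : c ~ s
      c~s = arc-first (arc (cyc L))
      p~c : p ~ c
      p~c = subst (_~ c) last (arc-final (arc (cyc L)))
      x≁s : ¬ x ~ s
      x≁s = link-insert L x∉ x≢v c~x
      x≁p : ¬ x ~ p
      x≁p e = link-insert (link-reverse L) (x∉ ∘ ∈-resp-↭ (prep c (↭-reverse (s ∷ (k ∷ʳ p))))) x≢v c~x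
                (subst (x ~_) (sym (trans (first-reverse (s ∷ (k ∷ʳ p))) last)) e)
      x≢ : ∀ {y} → y ∈ c ∷ s ∷ (k ∷ʳ p) → x ≢ y
      x≢ y∈ refl = x∉ y∈
      p~s : p ~ s
      p~s with p ~? s
      ... | yes e = e
      ... | no ne = ⊥-elim (claw (~-sym p~c) c~s c~x p≢s (≢-sym (x≢ (there (there p∈k)))) (≢-sym (x≢ (there (here refl))))
                      ne (x≁p ∘ ~-sym) (x≁s ∘ ~-sym))
      tail-arc : Arc s (k ∷ʳ p) s
      tail-arc with arc (cyc L)
      ... | _ ◅ a = arc-++ (proj₁ (arc-split k a)) (edge p~s)
      v~c : v ~ c
      v~c with v ~? c
      ... | yes e = e
      ... | no ne = ⊥-elim (parity (even-or-odd (length (s ∷ (k ∷ʳ p)))))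
        where
        N⊆′ : ∀ {y} → v ~ y → y ∈ s ∷ (k ∷ʳ p)
        N⊆′ e with N⊆ L e
        ... | here refl = ⊥-elim (ne e)
        ... | there y∈ = y∈
        parity : Even (length (s ∷ (k ∷ʳ p))) ⊎ Even (suc (length (s ∷ (k ∷ʳ p)))) → ⊥
        parity (inj₂ od) = not-even L od
        parity (inj₁ ev) = not-even (link (cycle tail-arc (Unique-++ʳ (c ∷ []) u)) (v∉ L ∘ there) N⊆′) ev
      v≁x : ¬ v ~ x
      v≁x e = x∉ (N⊆ L e)
      v≢ : ∀ {y} → y ∈ c ∷ s ∷ (k ∷ʳ p) → v ≢ y
      v≢ y∈ refl = v∉ L y∈
      beside : ∀ {y} → y ∈ c ∷ s ∷ (k ∷ʳ p) → c ~ y → ¬ x ~ y → v ~ y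
      beside {y} y∈ e x≁y with v ~? y
      ... | yes f = f
      ... | no ne = ⊥-elim (claw (~-sym v~c) c~x e (≢-sym x≢v) (v≢ y∈) (x≢ y∈) v≁x ne x≁y)
      v~s : v ~ s
      v~s = beside (there (here refl)) c~s x≁s
      v~p : v ~ p
      v~p = beside (there (there p∈k)) (~-sym p~c) x≁p

  -- C + P: replace an edge next to c and one next to d by P and the chord between the successors of c and d.
  abstract
    reroute : ∀ {v c m₁ d m₂ P} → Link v c (m₁ ++ d ∷ m₂) → Arc c P d → Unique P →
              All (λ w → w ∉ c ∷ m₁ ++ d ∷ m₂ × w ≢ v) P → first m₁ d ~ first m₂ c →
              ∃ λ m → Link v c m × P ++ (c ∷ m₁ ++ d ∷ m₂) ↭ c ∷ m
    reroute {v} {c} {m₁} {d} {m₂} {P} L aP uP off chord = go m₁ refl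
      where
      big : Unique (P ++ (c ∷ m₁ ++ d ∷ m₂))
      big = Uniq.++⁺ uP (uniq (cyc L)) (λ (z∈P , z∈) → proj₁ (All.lookup off z∈P) z∈)
      v∉big : v ∉ P ++ (c ∷ m₁ ++ d ∷ m₂)
      v∉big v∈ = [ (λ z → proj₂ (All.lookup off z) refl) , v∉ L ]′ (∈-++⁻ P v∈)
      finish : ∀ {m} → Arc c m c → P ++ (c ∷ m₁ ++ d ∷ m₂) ↭ c ∷ m → ∃ λ m → Link v c m × P ++ (c ∷ m₁ ++ d ∷ m₂) ↭ c ∷ m
      finish {m} a p = m , link (cycle a (Unique-resp-↭ p big)) (v∉big ∘ ∈-resp-↭ (↭-sym p)) (∈-resp-↭ p ∘ ∈-++⁺ʳ P ∘ N⊆ L) , p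
      open ↭-Solver
      go : ∀ m → m ≡ m₁ → ∃ λ m → Link v c m × P ++ (c ∷ m₁ ++ d ∷ m₂) ↭ c ∷ m
      go [] refl = finish (arc-++ aP (proj₂ (arc-split [] (arc (cyc L)))))
        (solve 4 (λ P c d b → P ⊕ (c ⊕ (d ⊕ b)) ⊜ c ⊕ (P ⊕ (d ⊕ b))) ↭-refl P (c ∷ []) (d ∷ []) m₂)
      go (s ∷ k) refl with arc-split (s ∷ k) (arc (cyc L))
      ... | (_ ◅ sd) , dc = finish (arc-++ aP (arc-++ (arc-rev sd) (arc-rehead dc chord)))
        (↭-trans (++⁺ˡ P (prep c (prep s (++⁺ʳ (d ∷ m₂) (↭-sym (↭-reverse k))))))
          (solve 6 (λ P c s k d b → P ⊕ (c ⊕ (s ⊕ (k ⊕ (d ⊕ b)))) ⊜ c ⊕ (P ⊕ (d ⊕ (k ⊕ (s ⊕ b))))) ↭-refl P (c ∷ []) (s ∷ []) (reverse k) (d ∷ []) m₂))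

  -- A longest link of v avoiding u, and a path through u joining two of its vertices.
  record Tight (v u : V) : Set where
    field
      {x c d} : V
      {m P₁ P₂} : List V
      lnk  : Link v x m
      u∉   : u ∉ x ∷ m
      c∈   : c ∈ x ∷ m
      d∈   : d ∈ x ∷ m
      c≢d  : c ≢ d
      path : Arc c (P₁ ++ u ∷ P₂) d
      uP   : Unique (P₁ ++ u ∷ P₂)
      off  : All (λ w → w ∉ x ∷ m × w ≢ v) (P₁ ++ u ∷ P₂)
      Nu   : ∀ {y} → u ~ y → y ∈ x ∷ m ⊎ (y ≡ final c P₁ ⊎ y ≡ first P₂ d)

  module Tighten {v u : V} (u≢v : u ≢ v) (none : ¬ Tight v u) where

    record Foot (C : List V) (S : List V) : Set where
      constructor foot
      field
        {w c} : V
        reach : Reach (λ y → y ∉ C × y ≢ v) u w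
        w~c   : w ~ c
        c∈    : c ∈ C
        c∉    : c ∉ S

    module _ {x m} (L : Link v x m) (u∉ : u ∉ x ∷ m) where
      private
        Off : V → Set
        Off y = y ∉ x ∷ m × y ≢ v

      off-nbr : ∀ {a w} → Off a → a ~ w → w ∉ x ∷ m → Off w
      off-nbr (a∉ , _) e w∉ = w∉ , λ { refl → a∉ (N⊆ L (~-sym e)) }

      find-foot : ∀ S {a y} → Reach Off u a → Off a → WalkAvoiding G S a y → y ∈ x ∷ m → Foot (x ∷ m) S
      find-foot S r (a∉ , _) here y∈ = ⊥-elim (a∉ y∈)
      find-foot S r oa (step {w = w} e w∉S walk) y∈ with w ∈? (x ∷ m)
      ... | yes w∈ = foot r e w∈ w∉S
      ... | no w∉  = find-foot S (reach-∷ʳ r e (off-nbr oa e w∉)) (off-nbr oa e w∉) walk y∈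

      feet : (∀ S → Unique S → length S ≤ 2 → (∀ {y} → y ∈ S → y ∈ x ∷ m) → ∀ {y} → v ~ y → y ∉ S → Foot (x ∷ m) S)
      feet S uS lS S⊆ v~y y∉ = find-foot S here (u∉ , u≢v) (proj₂ conn S uS lS _ _ (u∉ ∘ S⊆) y∉) (N⊆ L v~y)

    Off : V → List V → V → Set
    Off c m y = y ∉ c ∷ m × y ≢ v

    Grows : ℕ → Set
    Grows f = ∀ {x m} → Link v x m → u ∉ x ∷ m → n ≤ f + length (x ∷ m) → ⊥

    shorten : ∀ {f} (ih : Grows f) g {c : V} {m₁ : List V} {d : V} {m₂ : List V} → let C = c ∷ m₁ ++ d ∷ m₂ in
           Link v c (m₁ ++ d ∷ m₂) → u ∉ C → n ≤ suc f + length C → first m₁ d ~ first m₂ c →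
           ∀ P → length P ≤ g → 1 ≤ length P → Arc c P d → Unique P → All (λ y → y ∉ C × y ≢ v) P → ⊥
    shorten ih zero _ _ _ _ P h h′ = ⊥-elim (ℕₚ.<⇒≱ h′ h)
    shorten {f} ih (suc g) {c} {m₁} {d} {m₂} L u∉ h chord P lP lP′ aP uP off
      with reroute {m₁ = m₁} {m₂ = m₂} L aP uP off chord | u ∈? P
    ... | m , Z , p | no u∉P = ih Z (λ u∈ → [ u∉P , u∉ ]′ (∈-++⁻ P (∈-resp-↭ (↭-sym p) u∈))) longer
      where
      C : List V
      C = c ∷ m₁ ++ d ∷ m₂
      longer : n ≤ f + length (c ∷ m)
      longer = begin
        n                             ≤⟨ h ⟩
        suc f + length C              ≡⟨ ℕₚ.+-suc f (length C) ⟨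
        f + suc (length C)            ≤⟨ ℕₚ.+-monoʳ-≤ f (ℕₚ.+-monoˡ-≤ (length C) lP′) ⟩
        f + (length P + length C)     ≡⟨ cong (f +_) (length-++ P) ⟨
        f + length (P ++ C)           ≡⟨ cong (f +_) (↭-length p) ⟩
        f + length (c ∷ m)            ∎
        where open ℕₚ.≤-Reasoning
    ... | m , Z , p | yes u∈P with ∈-∃++ u∈P
    ... | P₁ , P₂ , refl with any? (λ y → (u ~? y) ×-dec ¬? (y ∈? (c ∷ m₁ ++ d ∷ m₂)) ×-dec ¬? (y ≟ final c P₁) ×-dec ¬? (y ≟ first P₂ d))
    ... | no no-chord = none (record { lnk = L ; u∉ = u∉ ; c∈ = here refl ; d∈ = there (∈-++⁺ʳ m₁ (here refl))
            ; c≢d = (λ { refl → Unique-head (uniq (cyc L)) (∈-++⁺ʳ m₁ (here refl)) })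
            ; path = aP ; uP = uP ; off = off ; Nu = Nu })
      where
      Nu : ∀ {y} → u ~ y → y ∈ c ∷ m₁ ++ d ∷ m₂ ⊎ (y ≡ final c P₁ ⊎ y ≡ first P₂ d)
      Nu {y} e with y ∈? (c ∷ m₁ ++ d ∷ m₂) | y ≟ final c P₁ | y ≟ first P₂ d
      ... | yes q | _ | _ = inj₁ q
      ... | no _ | yes q | _ = inj₂ (inj₁ q)
      ... | no _ | no _ | yes q = inj₂ (inj₂ q)
      ... | no a | no b | no k = ⊥-elim (no-chord (y , e , a , b , k))
    ... | yes (y , u~y , y∉C , y≢p , y≢s) with y ∈? (P₁ ++ u ∷ P₂)
    ... | no y∉P with root Z (∈-resp-↭ p (∈-++⁺ˡ (∈-++⁺ʳ P₁ (here refl))))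
    ... | rooted Zu q = u∉ (N⊆ L (Attachment.v~c (attachment Zu
            (λ y∈ → [ y∉P , y∉C ]′ (∈-++⁻ (P₁ ++ u ∷ P₂) (∈-resp-↭ (↭-sym p) (∈-resp-↭ (↭-sym q) y∈))))
            (λ { refl → u∉ (N⊆ L (~-sym u~y)) }) u~y)))
    shorten {f} ih (suc g) {c} {m₁} {d} {m₂} L u∉ h chord P lP lP′ aP uP off
      | m , Z , p | yes u∈P | P₁ , P₂ , refl | yes (y , u~y , y∉C , y≢p , y≢s) | yes y∈P with ∈-++⁻ P₁ y∈P
    ... | inj₂ (here refl) = ~-irrefl u~y
    ... | inj₁ y∈₁ with ∈-∃++ y∈₁
    ... | r₁ , [] , refl = y≢p (sym (final-++ {c} r₁))
    ... | r₁ , z ∷ r₂ , refl with arc-split (r₁ ++ y ∷ z ∷ r₂) aP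
    ... | cu , ud with arc-split r₁ cu
    ... | cy , _ = shorten ih g {m₁ = m₁} L u∉ h chord (r₁ ++ y ∷ u ∷ P₂) (ℕₚ.≤-trans shorter (s≤s⁻¹ lP″)) (nonempty r₁)
            (arc-++ cy (~-sym u~y ◅ ud)) (Unique-++ˡ (r₁ ++ y ∷ u ∷ P₂) (Unique-resp-↭ q uP)) (AllP.++⁻ˡ (r₁ ++ y ∷ u ∷ P₂) (All-resp-↭ q off))
      where
      open ↭-Solver
      q : (r₁ ++ y ∷ z ∷ r₂) ++ u ∷ P₂ ↭ (r₁ ++ y ∷ u ∷ P₂) ++ z ∷ r₂
      q = solve 5 (λ r y z u P → (r ⊕ (y ⊕ z)) ⊕ (u ⊕ P) ⊜ (r ⊕ (y ⊕ (u ⊕ P))) ⊕ z) ↭-refl r₁ (y ∷ []) (z ∷ r₂) (u ∷ []) P₂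
      lP″ : suc (length (r₁ ++ y ∷ u ∷ P₂) + length r₂) ≤ suc g
      lP″ = ℕₚ.≤-trans (ℕₚ.≤-reflexive (trans (sym (ℕₚ.+-suc _ (length r₂))) (trans (sym (length-++ (r₁ ++ y ∷ u ∷ P₂))) (sym (↭-length q))))) lP
      shorter : length (r₁ ++ y ∷ u ∷ P₂) ≤ length (r₁ ++ y ∷ u ∷ P₂) + length r₂
      shorter = ℕₚ.m≤m+n _ _
    shorten {f} ih (suc g) {c} {m₁} {d} {m₂} L u∉ h chord P lP lP′ aP uP off
      | m , Z , p | yes u∈P | P₁ , P₂ , refl | yes (y , u~y , y∉C , y≢p , y≢s) | yes y∈P | inj₂ (there y∈₂) with ∈-∃++ y∈₂
    ... | [] , r₂ , refl = y≢s refl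
    ... | z ∷ r₁ , r₂ , refl with arc-split P₁ aP
    ... | cu , ud with arc-split (z ∷ r₁) ud
    ... | _ , yd = shorten ih g {m₁ = m₁} L u∉ h chord (P₁ ++ u ∷ y ∷ r₂) (ℕₚ.≤-trans shorter (s≤s⁻¹ lP″)) (nonempty P₁)
            (arc-++ cu (u~y ◅ yd)) (Unique-++ˡ (P₁ ++ u ∷ y ∷ r₂) (Unique-resp-↭ q uP)) (AllP.++⁻ˡ (P₁ ++ u ∷ y ∷ r₂) (All-resp-↭ q off))
      where
      open ↭-Solver
      q : P₁ ++ u ∷ z ∷ r₁ ++ y ∷ r₂ ↭ (P₁ ++ u ∷ y ∷ r₂) ++ z ∷ r₁
      q = solve 5 (λ P u z y r → P ⊕ (u ⊕ (z ⊕ (y ⊕ r))) ⊜ (P ⊕ (u ⊕ (y ⊕ r))) ⊕ z) ↭-refl P₁ (u ∷ []) (z ∷ r₁) (y ∷ []) r₂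
      lP″ : suc (length (P₁ ++ u ∷ y ∷ r₂) + length r₁) ≤ suc g
      lP″ = ℕₚ.≤-trans (ℕₚ.≤-reflexive (trans (sym (ℕₚ.+-suc _ (length r₁))) (trans (sym (length-++ (P₁ ++ u ∷ y ∷ r₂))) (sym (↭-length q))))) lP
      shorter : length (P₁ ++ u ∷ y ∷ r₂) ≤ length (P₁ ++ u ∷ y ∷ r₂) + length r₁
      shorter = ℕₚ.m≤m+n _ _

    join : ∀ {f} (ih : Grows f) {c : V} {m₁ : List V} {d : V} {m₂ : List V} {wc wd : V} →
           let C = c ∷ m₁ ++ d ∷ m₂ ; O = λ (y : V) → y ∉ C × y ≢ v in
           Link v c (m₁ ++ d ∷ m₂) → u ∉ C → n ≤ suc f + length C →
           Reach O u wc → wc ~ c → Reach O u wd → wd ~ d → first m₁ d ~ first m₂ c → ⊥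
    join ih {c} {m₁} {d} {m₂} {wc} {wd} L u∉ h rc wc~c rd wd~d chord
      with hit-path {Tgt = _≡ d} {Off = λ y → y ∉ c ∷ m₁ ++ d ∷ m₂ × y ≢ v} {A = λ y → (y ∉ c ∷ m₁ ++ d ∷ m₂ × y ≢ v) ⊎ y ≡ d}
             (λ { w (inj₁ o) → inj₂ o ; w (inj₂ e) → inj₁ e })
             (reach-∷ʳ (reach-mono inj₁ (reach-trans (reach-sym (u∉ , λ q → u≢v q) rc) rd)) wd~d (inj₂ refl))
             (reach-end (u∉ , λ q → u≢v q) rc) refl (λ o → proj₁ o (there (∈-++⁺ʳ m₁ (here refl))))
    ... | hit {p} path refl _ off uP = shorten ih (length (wc ∷ p)) L u∉ h chord (wc ∷ p) ℕₚ.≤-refl (s≤s z≤n)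
            (~-sym wc~c ◅ path) uP (reach-end (u∉ , λ q → u≢v q) rc ∷ All.map proj₁ off)

    -- The successors of three attachments are neighbours of v, so two of them are adjacent.
    triple : ∀ {f} (ih : Grows f) {c : V} {m₁ : List V} {d : V} {m₂ : List V} {e : V} {m₃ : List V} {wc wd we : V} →
             let C = c ∷ m₁ ++ d ∷ m₂ ++ e ∷ m₃ ; O = λ (y : V) → y ∉ C × y ≢ v in
             Link v c (m₁ ++ d ∷ m₂ ++ e ∷ m₃) → u ∉ C → n ≤ suc f + length C →
             Reach O u wc → wc ~ c → Reach O u wd → wd ~ d → Reach O u we → we ~ e → ⊥
    triple {f} ih {c} {m₁} {d} {m₂} {e} {m₃} {wc} {wd} {we} L u∉ h rc wc~c rd wd~d re we~e =
      claw v~c⁺ v~d⁺ v~e⁺ (d₁₂ ∘ sym ) d₁₃ d₂₃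
        (λ k → join ih {m₁ = m₁} {m₂ = m₂ ++ e ∷ m₃} L u∉ h rc wc~c rd wd~d (subst (first m₁ d ~_) (sym (first-++ m₂)) k))
        (λ k → join ih {m₁ = m₁ ++ d ∷ m₂} {m₂ = m₃} L₁₃ (u∉ ∘ ∈-resp-↭ p₁₃) (len p₁₃) (mv p₁₃ rc) wc~c (mv p₁₃ re) we~e
                 (subst (_~ first m₃ c) (sym (first-++ m₁)) k))
        (λ k → join ih {m₁ = m₂} {m₂ = m₃ ++ c ∷ m₁} L₂₃ (u∉ ∘ ∈-resp-↭ p₂₃) (len p₂₃) (mv p₂₃ rd) wd~d (mv p₂₃ re) we~e
                 (subst (first m₂ e ~_) (sym (first-++ m₃)) k))
      where
      C : List V
      C = c ∷ m₁ ++ d ∷ m₂ ++ e ∷ m₃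
      O : V → Set
      O y = y ∉ C × y ≢ v
      open ↭-Solver
      L₁₃ : Link v c ((m₁ ++ d ∷ m₂) ++ e ∷ m₃)
      L₁₃ = subst (Link v c) (sym (++-assoc m₁ (d ∷ m₂) (e ∷ m₃))) L
      p₁₃ : c ∷ (m₁ ++ d ∷ m₂) ++ e ∷ m₃ ↭ C
      p₁₃ = prep c (↭-reflexive (++-assoc m₁ (d ∷ m₂) (e ∷ m₃)))
      L₂ : Link v d ((m₂ ++ e ∷ m₃) ++ c ∷ m₁)
      L₂ = link-rotate m₁ L
      L₂₃ : Link v d (m₂ ++ e ∷ m₃ ++ c ∷ m₁)
      L₂₃ = subst (Link v d) (++-assoc m₂ (e ∷ m₃) (c ∷ m₁)) L₂
      p₂₃ : d ∷ m₂ ++ e ∷ m₃ ++ c ∷ m₁ ↭ C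
      p₂₃ = solve 6 (λ c a d b e k → d ⊕ (b ⊕ (e ⊕ (k ⊕ (c ⊕ a)))) ⊜ c ⊕ (a ⊕ (d ⊕ (b ⊕ (e ⊕ k))))) ↭-refl (c ∷ []) m₁ (d ∷ []) m₂ (e ∷ []) m₃
      L₃ : Link v e (m₃ ++ c ∷ (m₁ ++ d ∷ m₂))
      L₃ = link-rotate (m₁ ++ d ∷ m₂) L₁₃
      p₃ : e ∷ m₃ ++ c ∷ (m₁ ++ d ∷ m₂) ↭ C
      p₃ = solve 6 (λ c a d b e k → e ⊕ (k ⊕ (c ⊕ (a ⊕ (d ⊕ b)))) ⊜ c ⊕ (a ⊕ (d ⊕ (b ⊕ (e ⊕ k))))) ↭-refl (c ∷ []) m₁ (d ∷ []) m₂ (e ∷ []) m₃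
      len : ∀ {C′} → C′ ↭ C → n ≤ suc f + length C′
      len p = subst (λ k → n ≤ suc f + k) (sym (↭-length p)) h
      mv : ∀ {C′ w} → C′ ↭ C → Reach O u w → Reach (λ y → y ∉ C′ × y ≢ v) u w
      mv p = reach-mono (λ (a , b) → a ∘ ∈-resp-↭ p , b)
      at : ∀ {w} → Reach O u w → O w
      at = reach-end (u∉ , λ q → u≢v q)
      v~c⁺ : v ~ first m₁ d
      v~c⁺ = subst (v ~_) (first-++ m₁) (Attachment.v~s (attachment L (proj₁ (at rc)) (proj₂ (at rc)) (~-sym wc~c)))
      v~d⁺ : v ~ first m₂ e
      v~d⁺ = subst (v ~_) (first-++ m₂) (Attachment.v~s (attachment L₂₃ (proj₁ (at rd) ∘ ∈-resp-↭ p₂₃) (proj₂ (at rd)) (~-sym wd~d)))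
      v~e⁺ : v ~ first m₃ c
      v~e⁺ = subst (v ~_) (first-++ m₃) (Attachment.v~s (attachment L₃ (proj₁ (at re) ∘ ∈-resp-↭ p₃) (proj₂ (at re)) (~-sym we~e)))
      blocks : Unique ((m₁ ++ d ∷ []) ++ (m₂ ++ e ∷ []) ++ (m₃ ++ c ∷ []))
      blocks = Unique-resp-↭ (solve 6 (λ c a d b e k → c ⊕ (a ⊕ (d ⊕ (b ⊕ (e ⊕ k)))) ⊜ (a ⊕ d) ⊕ ((b ⊕ e) ⊕ (k ⊕ c))) ↭-refl (c ∷ []) m₁ (d ∷ []) m₂ (e ∷ []) m₃)
                 (uniq (cyc L))
      d₁₂ : first m₂ e ≢ first m₁ d
      d₁₂ q = Unique-disjoint (m₁ ++ d ∷ []) blocks (first-∈ m₁) (subst (_∈ _) q (∈-++⁺ˡ (first-∈ m₂)))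
      d₁₃ : first m₁ d ≢ first m₃ c
      d₁₃ q = Unique-disjoint (m₁ ++ d ∷ []) blocks (first-∈ m₁) (subst (_∈ _) (sym q) (∈-++⁺ʳ (m₂ ++ e ∷ []) (first-∈ m₃)))
      d₂₃ : first m₂ e ≢ first m₃ c
      d₂₃ q = Unique-disjoint (m₂ ++ e ∷ []) (Unique-++ʳ (m₁ ++ d ∷ []) blocks) (first-∈ m₂) (subst (_∈ _) (sym q) (first-∈ m₃))

    lengthen : ∀ f → Grows f
    lengthen zero {x} {m} L u∉ h = ℕₚ.<⇒≱
      (Unique-⊆-length (u ∷ x ∷ m) (∉-Unique u∉ (uniq (cyc L))) (λ {y} _ → ∈-allFin y))
      (ℕₚ.≤-trans (ℕₚ.≤-reflexive (length-tabulate id)) h)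
    lengthen (suc f) {x} {m} L u∉ h
      with feet L u∉ [] [] z≤n (λ ()) (ThreeNeighbours.x~a (three-neighbours v)) (λ ())
    ... | foot {wc} {c} rc wc~c c∈ _ with neighbour-avoiding v c c (λ { refl → v∉ L c∈ }) (λ { refl → v∉ L c∈ })
    ... | y , v~y , y≢c , _
      with feet L u∉ (c ∷ []) ([] ∷ []) (s≤s z≤n) (λ { (here refl) → c∈ }) v~y (λ { (here e) → y≢c e })
    ... | foot {wd} {d} rd wd~d d∈ d∉c with neighbour-avoiding v c d (λ { refl → v∉ L c∈ }) (λ { refl → v∉ L d∈ })
    ... | y′ , v~y′ , y′≢c , y′≢d
      with feet L u∉ (c ∷ d ∷ []) (((λ { refl → d∉c (here refl) }) ∷ []) ∷ [] ∷ []) (s≤s (s≤s z≤n))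
             (λ { (here refl) → c∈ ; (there (here refl)) → d∈ }) v~y′ (λ { (here e) → y′≢c e ; (there (here e)) → y′≢d e })
    ... | foot {we} {e} re we~e e∈ e∉ with root L c∈
    ... | rooted {r} L′ p with ∈-resp-↭ p d∈ | ∈-resp-↭ p e∈
    ... | here refl | _ = d∉c (here refl)
    ... | there _   | here refl = e∉ (here refl)
    ... | there d∈′ | there e∈′ with ∈-∃++ d∈′
    ... | m₁ , m₂ , refl with ∈-++⁻ m₁ e∈′
    ... | inj₂ (here refl) = e∉ (there (here refl))
    ... | inj₂ (there e∈₂) with ∈-∃++ e∈₂
    ... | m₂′ , m₃ , refl = triple (lengthen f) L′ u∉′ h′ (go rc) wc~c (go rd) wd~d (go re) we~e
      where
      u∉′ = u∉ ∘ ∈-resp-↭ (↭-sym p)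
      h′ : n ≤ suc f + length (c ∷ m₁ ++ d ∷ m₂′ ++ e ∷ m₃)
      h′ = subst (λ k → n ≤ suc f + k) (↭-length p) h
      go : ∀ {w} → Reach (λ y → y ∉ x ∷ m × y ≢ v) u w → Reach (λ y → y ∉ c ∷ m₁ ++ d ∷ m₂′ ++ e ∷ m₃ × y ≢ v) u w
      go = reach-mono (λ (a , b) → a ∘ ∈-resp-↭ (↭-sym p) , b)
    lengthen (suc f) {x} {m} L u∉ h
      | foot {wc} {c} rc wc~c c∈ _ | _ | foot {wd} {d} rd wd~d d∈ d∉c | _ | foot {we} {e} re we~e e∈ e∉ | rooted {r} L′ p
      | there d∈′ | there e∈′ | m₁ , m₂ , refl | inj₁ e∈₁ with ∈-∃++ e∈₁
    ... | m₁′ , m₃ , refl with subst (Link v c) (++-assoc m₁′ (e ∷ m₃) (d ∷ m₂)) L′ | subst (λ l → x ∷ m ↭ c ∷ l) (++-assoc m₁′ (e ∷ m₃) (d ∷ m₂)) p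
    ... | L″ | p″ = triple (lengthen f) L″ u∉′ h′ (go rc) wc~c (go re) we~e (go rd) wd~d
      where
      u∉′ = u∉ ∘ ∈-resp-↭ (↭-sym p″)
      h′ : n ≤ suc f + length (c ∷ m₁′ ++ e ∷ m₃ ++ d ∷ m₂)
      h′ = subst (λ k → n ≤ suc f + k) (↭-length p″) h
      go : ∀ {w} → Reach (λ y → y ∉ x ∷ m × y ≢ v) u w → Reach (λ y → y ∉ c ∷ m₁′ ++ e ∷ m₃ ++ d ∷ m₂ × y ≢ v) u w
      go = reach-mono (λ (a , b) → a ∘ ∈-resp-↭ (↭-sym p″) , b)

  tight-common : ∀ {u v} → Tight u v → ∃₂ λ s t → ∀ {y} → v ~ y → u ~ y ⊎ (y ≡ s ⊎ y ≡ t)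
  tight-common {u} {v} T = final c P₁ , first P₂ d , common
    where
    open Tight T
    common : ∀ {y} → v ~ y → u ~ y ⊎ (y ≡ final c P₁ ⊎ y ≡ first P₂ d)
    common {y} e with Nu e
    ... | inj₂ q = inj₂ q
    ... | inj₁ y∈ with root lnk y∈
    ... | rooted L p = inj₁ (Attachment.v~c (attachment L (u∉ ∘ ∈-resp-↭ (↭-sym p))
                              (proj₂ (All.lookup off (∈-++⁺ʳ P₁ (here refl)))) (~-sym e)))

  module Clash {v u : V} (T : Tight v u) (T′ : Tight u v) where
    open Tight T

    u-off : u ∉ x ∷ m × u ≢ v
    u-off = All.lookup off (∈-++⁺ʳ P₁ (here refl))

    s₁ s₂ : V
    s₁ = proj₁ (tight-common T′)
    s₂ = proj₁ (proj₂ (tight-common T′))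
    common : ∀ {y} → v ~ y → u ~ y ⊎ (y ≡ s₁ ⊎ y ≡ s₂)
    common = proj₂ (proj₂ (tight-common T′))

    cu : Arc c P₁ u
    cu = proj₁ (arc-split P₁ path)
    ud : Arc u P₂ d
    ud = proj₂ (arc-split P₁ path)

    -- The only neighbour t of u on the link, its two link neighbours s and p, and nothing else around v.
    module At {t s p : V} {k : List V} (L : Link v t (s ∷ (k ∷ʳ p))) (σ : x ∷ m ↭ t ∷ s ∷ (k ∷ʳ p)) (u~t : u ~ t) where

      C : List V
      C = t ∷ s ∷ (k ∷ʳ p)

      u∉C : u ∉ C
      u∉C = u∉ ∘ ∈-resp-↭ (↭-sym σ)

      att : Attachment v t (s ∷ (k ∷ʳ p)) u
      att = attachment L u∉C (proj₂ u-off) (~-sym u~t)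

      last : final s (k ∷ʳ p) ≡ p
      last = final-++ {s} k

      uC : Unique C
      uC = uniq (cyc L)

      v~s : v ~ s
      v~s = Attachment.v~s att
      v~p : v ~ p
      v~p = subst (v ~_) last (Attachment.v~p att)
      u≁s : ¬ u ~ s
      u≁s = Attachment.x≁s att
      u≁p : ¬ u ~ p
      u≁p = Attachment.x≁p att ∘ subst (u ~_) (sym last)
      p~s : p ~ s
      p~s = subst (_~ s) last (Attachment.p~s att)
      p≢s : p ≢ s
      p≢s = Attachment.p≢s att ∘ trans last

      only-sp : ∀ {y} → v ~ y → u ~ y ⊎ (y ≡ s ⊎ y ≡ p)
      only-sp {y} e with common e | common v~s | common v~p
      ... | inj₁ f | _ | _ = inj₁ f
      ... | inj₂ _ | inj₁ f | _ = ⊥-elim (u≁s f)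
      ... | inj₂ _ | inj₂ _ | inj₁ f = ⊥-elim (u≁p f)
      ... | inj₂ _ | inj₂ (inj₁ a) | inj₂ (inj₁ b) = ⊥-elim (p≢s (trans b (sym a)))
      ... | inj₂ _ | inj₂ (inj₂ a) | inj₂ (inj₂ b) = ⊥-elim (p≢s (trans b (sym a)))
      ... | inj₂ (inj₁ q) | inj₂ (inj₁ a) | inj₂ (inj₂ b) = inj₂ (inj₁ (trans q (sym a)))
      ... | inj₂ (inj₂ q) | inj₂ (inj₁ a) | inj₂ (inj₂ b) = inj₂ (inj₂ (trans q (sym b)))
      ... | inj₂ (inj₁ q) | inj₂ (inj₂ a) | inj₂ (inj₁ b) = inj₂ (inj₂ (trans q (sym b)))
      ... | inj₂ (inj₂ q) | inj₂ (inj₂ a) | inj₂ (inj₁ b) = inj₂ (inj₁ (trans q (sym a)))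

      p∈ : p ∈ k ∷ʳ p
      p∈ = ∈-++⁺ʳ k (here refl)

      u-on-C : ∀ {y} → u ~ y → y ∈ C → y ≡ t
      u-on-C f (here q) = q
      u-on-C f (there (here refl)) = ⊥-elim (u≁s f)
      u-on-C {y} f (there (there y∈)) with ∈-++⁻ k y∈
      ... | inj₂ (here refl) = ⊥-elim (u≁p f)
      ... | inj₁ y∈k with ∈-∃++ y∈k
      ... | k₁ , k₂ , refl = ⊥-elim square
        where
        -- A second such vertex y would make the link the 4-cycle t s y p.
        square : ⊥
        square with subst (Link v t) (cong (s ∷_) (++-assoc k₁ (y ∷ k₂) (p ∷ []))) L
                             | subst (λ l → Unique (t ∷ s ∷ l)) (++-assoc k₁ (y ∷ k₂) (p ∷ [])) uC
                             | subst (λ l → u ∉ t ∷ s ∷ l) (++-assoc k₁ (y ∷ k₂) (p ∷ [])) u∉C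
        ... | L′ | uC′ | u∉′ = finish k₁ k₂ L′ uC′ (attachment (link-rotate (s ∷ k₁) L′) (u∉′ ∘ ∈-resp-↭ (↭-sym (rotate-↭ (s ∷ k₁)))) (proj₂ u-off) (~-sym f))
          where
          finish : ∀ k₁ k₂ → Link v t (s ∷ k₁ ++ y ∷ (k₂ ∷ʳ p)) → Unique (t ∷ s ∷ k₁ ++ y ∷ (k₂ ∷ʳ p)) →
                   Attachment v y ((k₂ ∷ʳ p) ++ t ∷ s ∷ k₁) u → ⊥
          finish k₁ (z ∷ k₂) L′ uC′ A with only-sp (Attachment.v~s A)
          ... | inj₁ g = Attachment.x≁s A g
          ... | inj₂ (inj₁ refl) = Unique-head (Unique-++ʳ (t ∷ []) uC′) (∈-++⁺ʳ k₁ (there (here refl)))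
          ... | inj₂ (inj₂ refl) = Unique-head (Unique-++ʳ (y ∷ []) (Unique-++ʳ (t ∷ s ∷ k₁) uC′)) (∈-++⁺ʳ k₂ (here refl))
          finish k₁ [] L′ uC′ A with initLast k₁
          ... | [] = not-even L′ (divides 2 refl)
          ... | k₃ ∷ʳ′ z with only-sp (Attachment.v~p A) | final-++ {s} k₃ {z} {[]}
          ... | inj₁ g | _ = Attachment.x≁p A g
          ... | inj₂ (inj₁ q) | fin = Unique-head (Unique-++ʳ (t ∷ []) uC′) (∈-++⁺ˡ (∈-++⁺ʳ k₃ (here (trans (sym q) fin))))
          ... | inj₂ (inj₂ q) | fin = Unique-disjoint (t ∷ s ∷ (k₃ ++ z ∷ [])) uC′
                                        (there (there (∈-++⁺ʳ k₃ (here (trans (sym q) fin))))) (there (here refl))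

      Nv : ∀ {y} → v ~ y → y ≡ t ⊎ y ≡ s ⊎ y ≡ p
      Nv e with only-sp e
      ... | inj₁ f = inj₁ (u-on-C f (N⊆ L e))
      ... | inj₂ q = inj₂ q

      ends-seen : ∀ {y w} → y ∈ C → w ∉ C → w ≢ v → w ~ y → y ≡ t ⊎ y ≡ s ⊎ y ≡ p
      ends-seen y∈ w∉ w≢v e with root L y∈
      ... | rooted L′ ρ = Nv (Attachment.v~c (attachment L′ (w∉ ∘ ∈-resp-↭ (↭-sym ρ)) w≢v (~-sym e)))

      triangle-s : ∀ {w} → w ∉ C → w ≢ v → w ~ s → k ≡ []
      triangle-s {w} w∉ w≢v e = go k refl
        where
        go : ∀ k′ → k′ ≡ k → k ≡ []
        go [] q = sym q
        go (y ∷ k′) refl with attachment (link-rotate [] L) (w∉ ∘ ∈-resp-↭ (↭-sym (rotate-↭ []))) w≢v (~-sym e)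
        ... | A with Nv (Attachment.v~s A)
        ... | inj₁ refl = ⊥-elim (Unique-head uC (there (here refl)))
        ... | inj₂ (inj₁ refl) = ⊥-elim (Unique-head (Unique-++ʳ (t ∷ []) uC) (here refl))
        ... | inj₂ (inj₂ refl) = ⊥-elim (Unique-head (Unique-++ʳ (t ∷ s ∷ []) uC) (∈-++⁺ʳ k′ (here refl)))

      triangle-p : ∀ {w} → w ∉ C → w ≢ v → w ~ p → k ≡ []
      triangle-p {w} w∉ w≢v e with attachment (link-rotate (s ∷ k) L) (w∉ ∘ ∈-resp-↭ (↭-sym (rotate-↭ (s ∷ k)))) w≢v (~-sym e) | initLast k
      ... | A | [] = refl
      ... | A | k′ ∷ʳ′ y with Nv (subst (v ~_) (final-++ {s} k′) (Attachment.v~p A))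
      ... | inj₁ refl = ⊥-elim (Unique-head uC (there (∈-++⁺ˡ (∈-++⁺ʳ k′ (here refl)))))
      ... | inj₂ (inj₁ refl) = ⊥-elim (Unique-head (Unique-++ʳ (t ∷ []) uC) (∈-++⁺ˡ (∈-++⁺ʳ k′ (here refl))))
      ... | inj₂ (inj₂ refl) = ⊥-elim (Unique-disjoint (t ∷ s ∷ (k′ ++ y ∷ [])) uC (there (there (∈-++⁺ʳ k′ (here refl)))) (here refl))

      off′ : All (λ w → w ∉ C × w ≢ v) (P₁ ++ u ∷ P₂)
      off′ = All.map (λ (a , b) → a ∘ ∈-resp-↭ (↭-sym σ) , b) off

      first-P : V
      first-P = first (P₁ ++ u ∷ P₂) d
      first-P-off : first-P ∉ C × first-P ≢ v
      first-P-off = go P₁ off′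
        where
        go : ∀ P → All (λ w → w ∉ C × w ≢ v) (P ++ u ∷ P₂) → first (P ++ u ∷ P₂) d ∉ C × first (P ++ u ∷ P₂) d ≢ v
        go []      (o ∷ _) = o
        go (_ ∷ _) (o ∷ _) = o
      c~first : c ~ first-P
      c~first = arc-first path
      last-P : V
      last-P = final u P₂
      last-P-off : last-P ∉ C × last-P ≢ v
      last-P-off = All.lookup off′ (∈-++⁺ʳ P₁ (go u P₂))
        where
        go : ∀ a P → final a P ∈ a ∷ P
        go a []      = here refl
        go a (b ∷ P) = there (go b P)
      last~d : last-P ~ d
      last~d = arc-final ud

      c∈C : c ∈ C
      c∈C = ∈-resp-↭ σ c∈
      d∈C : d ∈ C
      d∈C = ∈-resp-↭ σ d∈

      c-seen : c ≡ t ⊎ c ≡ s ⊎ c ≡ p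
      c-seen = ends-seen c∈C (proj₁ first-P-off) (proj₂ first-P-off) (~-sym c~first)
      d-seen : d ≡ t ⊎ d ≡ s ⊎ d ≡ p
      d-seen = ends-seen d∈C (proj₁ last-P-off) (proj₂ last-P-off) last~d

      k≡[] : k ≡ []
      k≡[] with c-seen | d-seen
      ... | inj₂ (inj₁ refl) | _ = triangle-s (proj₁ first-P-off) (proj₂ first-P-off) (~-sym c~first)
      ... | inj₂ (inj₂ refl) | _ = triangle-p (proj₁ first-P-off) (proj₂ first-P-off) (~-sym c~first)
      ... | inj₁ _ | inj₂ (inj₁ refl) = triangle-s (proj₁ last-P-off) (proj₂ last-P-off) last~d
      ... | inj₁ _ | inj₂ (inj₂ refl) = triangle-p (proj₁ last-P-off) (proj₂ last-P-off) last~d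
      ... | inj₁ a | inj₁ b = ⊥-elim (c≢d (trans a (sym b)))

      P₁≢[] : P₁ ≢ []
      P₁≢[] P₁≡ with neighbour-avoiding u t (first P₂ d) (≢-sym (~⇒≢ u~t)) (≢-sym (~⇒≢ (arc-first ud)))
      ... | y , e , y≢t , y≢f with Nu e
      ... | inj₁ y∈ = y≢t (u-on-C e (∈-resp-↭ σ y∈))
      ... | inj₂ (inj₂ q) = y≢f q
      ... | inj₂ (inj₁ q) = y≢t (u-on-C e (subst (_∈ C) (sym (trans q (cong (final c) P₁≡))) c∈C))

      P₂≢[] : P₂ ≢ []
      P₂≢[] P₂≡ with neighbour-avoiding u t (final c P₁) (≢-sym (~⇒≢ u~t)) (~⇒≢ (arc-final cu))
      ... | y , e , y≢t , y≢f with Nu e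
      ... | inj₁ y∈ = y≢t (u-on-C e (∈-resp-↭ σ y∈))
      ... | inj₂ (inj₁ q) = y≢f q
      ... | inj₂ (inj₂ q) = y≢t (u-on-C e (subst (_∈ C) (sym (trans q (cong (λ P → first P d) P₂≡))) d∈C))

    -- The triangle t s p grows by the part of the path on one side of u; the other neighbour of u stays outside.
    grow : ∀ {t s p z : V} {Q : List V} {w : V} → Link v t (s ∷ p ∷ []) → u ∉ t ∷ s ∷ p ∷ [] → p ~ s → u ~ t →
           z ≡ s ⊎ z ≡ p → Arc u Q z → Unique (u ∷ Q) → All (λ y → y ∉ t ∷ s ∷ p ∷ [] × y ≢ v) (u ∷ Q) →
           u ~ w → w ∉ t ∷ s ∷ p ∷ [] → w ≢ v → w ∉ u ∷ Q → ⊥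
    grow {t} {s} {p} {z} {Q} {w} L u∉C p~s u~t z≡ aQ uQ offQ u~w w∉ w≢v w∉Q = go z≡
      where
      C : List V
      C = t ∷ s ∷ p ∷ []
      finish : ∃ (λ m′ → Link v t m′ × (u ∷ Q) ++ C ↭ t ∷ m′) → ⊥
      finish (m′ , Z , ρ) with root Z (∈-resp-↭ ρ (here refl))
      ... | rooted Zu τ = u∉C (N⊆ L (Attachment.v~c (attachment Zu
              (λ w∈ → [ w∉Q , w∉ ]′ (∈-++⁻ (u ∷ Q) (∈-resp-↭ (↭-sym ρ) (∈-resp-↭ (↭-sym τ) w∈)))) w≢v u~w)))
      go : z ≡ s ⊎ z ≡ p → ⊥
      go (inj₁ refl) = finish (reroute {m₁ = []} {m₂ = p ∷ []} L (~-sym u~t ◅ aQ) uQ offQ (~-sym p~s))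
      go (inj₂ refl) = finish (reroute {m₁ = s ∷ []} {m₂ = []} L (~-sym u~t ◅ aQ) uQ offQ (~-sym (arc-first (arc (cyc L)))))

    clash-at : ∀ {t s p : V} {k : List V} (L : Link v t (s ∷ (k ∷ʳ p))) (σ : x ∷ m ↭ t ∷ s ∷ (k ∷ʳ p)) → u ~ t → k ≡ [] → ⊥
    clash-at {t} {s} {p} {.[]} L σ u~t refl with At.d-seen {k = []} L σ u~t | At.c-seen {k = []} L σ u~t
    ... | inj₁ d≡t | inj₁ c≡t = c≢d (trans c≡t (sym d≡t))
    ... | inj₂ d≡ | _ = grow L A.u∉C A.p~s u~t d≡ ud (Unique-++ʳ P₁ uP) (AllP.++⁻ʳ P₁ A.off′)
            (~-sym (arc-final cu)) (proj₁ w-off) (proj₂ w-off) (λ w∈ → Unique-disjoint P₁ uP w∈P₁ w∈)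
      where
      module A = At {k = []} L σ u~t
      w∈P₁ : final c P₁ ∈ P₁
      w∈P₁ = go P₁ A.P₁≢[]
        where
        fin : ∀ a P → final a P ∈ a ∷ P
        fin a []      = here refl
        fin a (b ∷ P) = there (fin b P)
        go : ∀ P → P ≢ [] → final c P ∈ P
        go []      ne = ⊥-elim (ne refl)
        go (a ∷ P) _  = fin a P
      w-off = All.lookup A.off′ (∈-++⁺ˡ w∈P₁)
    ... | inj₁ _ | inj₂ c≡ = grow L A.u∉C A.p~s u~t c≡ (arc-rev cu)
            (Unique-resp-↭ (prep u (↭-sym (↭-reverse P₁))) uP₁)
            (All-resp-↭ (prep u (↭-sym (↭-reverse P₁))) (All.lookup A.off′ (∈-++⁺ʳ P₁ (here refl)) ∷ AllP.++⁻ˡ P₁ A.off′))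
            (arc-first ud) (proj₁ w-off) (proj₂ w-off)
            (λ w∈ → w∉ (∈-resp-↭ (prep u (↭-reverse P₁)) w∈))
      where
      module A = At {k = []} L σ u~t
      w∈P₂ : first P₂ d ∈ P₂
      w∈P₂ = go P₂ A.P₂≢[]
        where
        go : ∀ P → P ≢ [] → first P d ∈ P
        go []      ne = ⊥-elim (ne refl)
        go (a ∷ P) _  = here refl
      w-off = All.lookup A.off′ (∈-++⁺ʳ P₁ (there w∈P₂))
      open ↭-Solver
      uP′ : Unique ((u ∷ P₁) ++ P₂)
      uP′ = Unique-resp-↭ (solve 3 (λ a u b → a ⊕ (u ⊕ b) ⊜ (u ⊕ a) ⊕ b) ↭-refl P₁ (u ∷ []) P₂) uP
      uP₁ : Unique (u ∷ P₁)
      uP₁ = Unique-++ˡ (u ∷ P₁) uP′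
      w∉ : first P₂ d ∉ u ∷ P₁
      w∉ w∈ = Unique-disjoint (u ∷ P₁) uP′ w∈ w∈P₂

    clash : ⊥
    clash with neighbour-avoiding u (final c P₁) (first P₂ d) (~⇒≢ (arc-final cu)) (≢-sym (~⇒≢ (arc-first ud)))
    ... | t , u~t , t≢p , t≢s with Nu u~t
    ... | inj₂ (inj₁ q) = t≢p q
    ... | inj₂ (inj₂ q) = t≢s q
    ... | inj₁ t∈ with root lnk t∈
    ... | rooted {[]} L σ = ℕₚ.<⇒≱ (s≤s (s≤s z≤n)) (link-length L)
    ... | rooted {s ∷ r} L σ with initLast r
    ... | [] = ℕₚ.<⇒≱ (s≤s (s≤s (s≤s z≤n))) (link-length L)
    ... | k ∷ʳ′ p = clash-at L σ u~t (At.k≡[] L σ u~t)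

  Unique-part : ∀ {P : V → Set} (new : List V) {rest B} → new ++ rest ↭ B → Unique B → All P B → Unique new × All P new
  Unique-part new p uB aB = Unique-++ˡ new (Unique-resp-↭ (↭-sym p) uB) , AllP.++⁻ˡ new (All-resp-↭ (↭-sym p) aB)

  first-in : ∀ {P : V → Set} (P? : ∀ x → Dec (P x)) m →
             (∀ {x} → x ∈ m → ¬ P x) ⊎ (∃ λ f → ∃ λ x → ∃ λ g → m ≡ f ++ x ∷ g × P x × (∀ {y} → y ∈ f → ¬ P y))
  first-in P? [] = inj₁ λ ()
  first-in P? (x ∷ m) with P? x
  ... | yes px = inj₂ ([] , x , m , refl , px , λ ())
  ... | no ¬px with first-in P? m
  ... | inj₁ none = inj₁ λ { (here refl) → ¬px ; (there y∈) → none y∈ }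
  ... | inj₂ (f , y , g , refl , py , none) = inj₂ (x ∷ f , y , g , refl , py , λ { (here refl) → ¬px ; (there z∈) → none z∈ })

  module TwoConnected {u v : V} (no-cut : ∀ t → Split u v t → ⊥) where

    Free : V → Set
    Free y = y ≢ u × y ≢ v

    connected : ∀ z {a b} → Free a → a ≢ z → Free b → b ≢ z → ¬ ¬ Reach (λ w → Free w × w ≢ z) a b
    connected z {a} {b} fa a≢z fb b≢z k = decide-all (Reach (λ w → Free w × w ≢ z) a) λ d →
      no-cut z (split d (λ r → let ((p , q) , s) = reach-end (fa , a≢z) r in p , q , s)
        (λ x y r e p q s → reach-∷ʳ r e ((p , q) , s)) (a , here) (b , k , proj₁ fb , proj₂ fb , b≢z))

    record Ear (C : List V) (a : V) : Set where
      constructor ear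
      field
        {c₁ c₂} : V
        {q}     : List V
        arc     : Arc c₁ q c₂
        c₁∈     : c₁ ∈ C
        c₂∈     : c₂ ∈ C
        c₁≢c₂   : c₁ ≢ c₂
        a∈q     : a ∈ q
        uq      : Unique q
        off     : All (λ y → y ∉ C × Free y) q

    module Ears {C : List V} (C-free : ∀ {y} → y ∈ C → Free y) where

      push : ∀ {a w} → Ear C w → w ≢ a → a ~ w → a ∉ C → Free a → (Ear C a → ⊥) → ⊥
      push {a} {w} (ear {c₁} {c₂} {q} aq c₁∈ c₂∈ c₁≢c₂ w∈q uq off) w≢a a~w a∉C fa k with a ∈? q
      ... | yes a∈q = k (ear aq c₁∈ c₂∈ c₁≢c₂ a∈q uq off)
      ... | no a∉q with ∈-∃++ w∈q
      ... | q₁ , q₂ , refl = connected w fa (≢-sym w≢a) (C-free c₁∈) (λ { refl → w∉C c₁∈ }) λ r →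
                land (hit-path dich r (a∉C , a∉q) (inj₁ c₁∈) (λ o → proj₁ o c₁∈))
        where
        open ↭-Solver
        w∉C : w ∉ C
        w∉C = proj₁ (All.lookup off (∈-++⁺ʳ q₁ (here refl)))
        cw : Arc c₁ q₁ w
        cw = proj₁ (arc-split q₁ aq)
        wc : Arc w q₂ c₂
        wc = proj₂ (arc-split q₁ aq)
        Tgt Out : V → Set
        Tgt y = y ∈ C ⊎ y ∈ q₁ ++ w ∷ q₂
        Out y = y ∉ C × y ∉ q₁ ++ w ∷ q₂
        dich : ∀ y → Free y × y ≢ w → Tgt y ⊎ Out y
        dich y _ with y ∈? C | y ∈? (q₁ ++ w ∷ q₂)
        ... | yes p | _ = inj₁ (inj₁ p)
        ... | no _ | yes p = inj₁ (inj₂ p)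
        ... | no a | no b = inj₂ (a , b)
        land : HitPath Tgt Out (λ y → Free y × y ≢ w) a → ⊥
        land (hit {m} {y} path h (_ , y≢w) offm um) = at h
          where
          B : List V
          B = (a ∷ m) ++ (q₁ ++ w ∷ q₂)
          out : ∀ {z} → z ∈ a ∷ m → z ∉ q₁ ++ w ∷ q₂
          out (here refl) = a∉q
          out (there z∈)  = proj₂ (proj₁ (All.lookup offm z∈))
          uB : Unique B
          uB = Uniq.++⁺ um uq (λ (p , q) → out p q)
          aB : All (λ z → z ∉ C × Free z) B
          aB = AllP.++⁺ ((a∉C , fa) ∷ All.map (λ ((p , _) , (f , _)) → p , f) offm) off
          w~a : w ~ a
          w~a = ~-sym a~w
          done : ∀ {e₁ e₂} new {rest} → Arc e₁ new e₂ → e₁ ∈ C → e₂ ∈ C → e₁ ≢ e₂ → a ∈ new → new ++ rest ↭ B → ⊥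
          done new ar e₁∈ e₂∈ ne a∈ p with Unique-part new p uB aB
          ... | un , an = k (ear ar e₁∈ e₂∈ ne a∈ un an)
          at : Tgt y → ⊥
          at (inj₁ y∈C) with y ≟ c₁
          ... | no y≢c₁ = done (q₁ ++ w ∷ a ∷ m) {q₂} (arc-++ cw (w~a ◅ path)) c₁∈ y∈C (≢-sym y≢c₁) (∈-++⁺ʳ q₁ (there (here refl)))
                (solve 5 (λ x w a m y → (x ⊕ (w ⊕ (a ⊕ m))) ⊕ y ⊜ (a ⊕ m) ⊕ (x ⊕ (w ⊕ y))) ↭-refl q₁ (w ∷ []) (a ∷ []) m q₂)
          ... | yes refl = done (reverse q₂ ++ w ∷ a ∷ m) {q₁} (arc-++ (arc-rev wc) (w~a ◅ path)) c₂∈ y∈C (≢-sym c₁≢c₂) (∈-++⁺ʳ (reverse q₂) (there (here refl)))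
                (↭-trans (solve 5 (λ x w a m y → (y ⊕ (w ⊕ (a ⊕ m))) ⊕ x ⊜ (a ⊕ m) ⊕ (x ⊕ (w ⊕ y))) ↭-refl q₁ (w ∷ []) (a ∷ []) m (reverse q₂))
                         (++⁺ˡ (a ∷ m) (++⁺ˡ q₁ (prep w (↭-reverse q₂)))))
          at (inj₂ y∈q) with ∈-++⁻ q₁ y∈q
          ... | inj₂ (here e) = y≢w e
          ... | inj₁ y∈₁ with ∈-∃++ y∈₁
          ... | r₁ , r₂ , refl = done (r₁ ++ y ∷ reverse m ++ a ∷ w ∷ q₂) {r₂}
                (arc-++ (proj₁ (arc-split r₁ cw)) (arc-++ (arc-rev path) (a~w ◅ wc))) c₁∈ c₂∈ c₁≢c₂
                (∈-++⁺ʳ r₁ (there (∈-++⁺ʳ (reverse m) (here refl))))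
                (↭-trans (solve 7 (λ r y m a w q s → (r ⊕ (y ⊕ (m ⊕ (a ⊕ (w ⊕ q))))) ⊕ s ⊜ (a ⊕ m) ⊕ ((r ⊕ (y ⊕ s)) ⊕ (w ⊕ q))) ↭-refl
                           r₁ (y ∷ []) (reverse m) (a ∷ []) (w ∷ []) q₂ r₂)
                         (++⁺ʳ ((r₁ ++ y ∷ r₂) ++ w ∷ q₂) (prep a (↭-reverse m))))
          at (inj₂ y∈q) | inj₂ (there y∈₂) with ∈-∃++ y∈₂
          ... | r₁ , r₂ , refl = done (q₁ ++ w ∷ a ∷ m ++ y ∷ r₂) {r₁}
                (arc-++ cw (w~a ◅ arc-++ path (proj₂ (arc-split r₁ wc)))) c₁∈ c₂∈ c₁≢c₂ (∈-++⁺ʳ q₁ (there (here refl)))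
                (solve 7 (λ x w a m y s r → (x ⊕ (w ⊕ (a ⊕ (m ⊕ (y ⊕ s))))) ⊕ r ⊜ (a ⊕ m) ⊕ (x ⊕ (w ⊕ (r ⊕ (y ⊕ s))))) ↭-refl
                           q₁ (w ∷ []) (a ∷ []) m (y ∷ []) r₂ r₁)

      find-ear : ∀ {a c} → Reach Free a c → c ∈ C → a ∉ C → Free a → (∀ w → ∃ λ c′ → c′ ∈ C × c′ ≢ w) → (Ear C a → ⊥) → ⊥
      find-ear here c∈ a∉ fa other k = a∉ c∈
      find-ear {a} (step {w = w} a~w fw r) c∈ a∉ fa other k with w ∈? C
      ... | no w∉ = find-ear r c∈ w∉ fw other λ E → push E (≢-sym (~⇒≢ a~w)) a~w a∉ fa k
      ... | yes w∈ with other w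
      ... | c′ , c′∈ , c′≢w = connected w fa (~⇒≢ a~w) (C-free c′∈) c′≢w λ r′ →
              finish (hit-path {Tgt = _∈ C} {Off = _∉ C} (λ y _ → dec (y ∈? C)) r′ a∉ c′∈ (λ n → n c′∈))
        where
        dec : ∀ {y} → Dec (y ∈ C) → y ∈ C ⊎ y ∉ C
        dec (yes p) = inj₁ p
        dec (no p)  = inj₂ p
        finish : HitPath (_∈ C) (_∉ C) (λ y → Free y × y ≢ w) a → ⊥
        finish (hit path y∈ (_ , y≢w) off um) = k (ear (~-sym a~w ◅ path) w∈ y∈ (≢-sym y≢w) (here refl) um
            ((a∉ , fa) ∷ All.map (λ (p , (f , _)) → p , f) off))

    record Through (ns : List V) : Set where
      constructor through
      field
        {x} : V
        {m} : List V
        cyc : Cycle x m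
        free : All Free (x ∷ m)
        ns⊆  : ∀ {y} → y ∈ ns → y ∈ x ∷ m

    module Absorb {ns : List V} {a : V} (v~ns : ∀ {y} → y ∈ ns → v ~ y) (v~a : v ~ a) where

      module _ {c₁ c₂ : V} {m₁ m₂ q : List V} (A₁ : Arc c₁ m₁ c₂) (A₂ : Arc c₂ m₂ c₁) (Aq : Arc c₁ q c₂) (a∈q : a ∈ q)
        (uB : Unique (q ++ c₁ ∷ m₁ ++ c₂ ∷ m₂)) (fB : All Free (q ++ c₁ ∷ m₁ ++ c₂ ∷ m₂))
        (kept : ∀ {y} → y ∈ ns → y ∈ c₁ ∷ m₁ ++ c₂ ∷ m₂) where

        open ↭-Solver

        finish : ∀ {x′} m′ rest → Arc x′ m′ x′ → (x′ ∷ m′) ++ rest ↭ q ++ c₁ ∷ m₁ ++ c₂ ∷ m₂ → a ∈ x′ ∷ m′ →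
                 (∀ {y} → y ∈ rest → y ∉ ns) → Through (a ∷ ns)
        finish {x′} m′ rest ar p a∈ lost with Unique-part (x′ ∷ m′) p uB fB
        ... | un , fn = through (cycle ar un) fn λ { (here refl) → a∈ ; (there y∈) → sub y∈ (∈-++⁻ (x′ ∷ m′) (∈-resp-↭ (↭-sym p) (∈-++⁺ʳ q (kept y∈)))) }
          where
          sub : ∀ {y} → y ∈ ns → y ∈ x′ ∷ m′ ⊎ y ∈ rest → y ∈ x′ ∷ m′
          sub y∈ (inj₁ z) = z
          sub y∈ (inj₂ z) = ⊥-elim (lost z y∈)

        skip : (∀ {y} → y ∈ m₁ → y ∉ ns) → Through (a ∷ ns)
        skip lost = finish (q ++ c₂ ∷ m₂) m₁ (arc-++ Aq A₂)
          (solve 5 (λ c q d b r → (c ⊕ (q ⊕ (d ⊕ b))) ⊕ r ⊜ q ⊕ (c ⊕ (r ⊕ (d ⊕ b)))) ↭-refl (c₁ ∷ []) q (c₂ ∷ []) m₂ m₁)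
          (there (∈-++⁺ˡ a∈q)) lost

        jump : ∀ f {n₁ g} → m₁ ≡ f ++ n₁ ∷ g → (∀ {y} → y ∈ f → y ∉ ns) → a ~ n₁ → Through (a ∷ ns)
        jump f {n₁} {g} refl lost a~n with ∈-∃++ a∈q
        ... | q₁ , q₂ , refl = finish (q₁ ++ a ∷ n₁ ∷ g ++ c₂ ∷ m₂) (q₂ ++ f)
          (arc-++ (proj₁ (arc-split q₁ Aq)) (a~n ◅ arc-++ (proj₂ (arc-split f A₁)) A₂))
          (solve 9 (λ c q a n g d b r f → (c ⊕ (q ⊕ (a ⊕ (n ⊕ (g ⊕ (d ⊕ b)))))) ⊕ (r ⊕ f) ⊜ (q ⊕ (a ⊕ r)) ⊕ (c ⊕ ((f ⊕ (n ⊕ g)) ⊕ (d ⊕ b)))) ↭-refl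
             (c₁ ∷ []) q₁ (a ∷ []) (n₁ ∷ []) g (c₂ ∷ []) m₂ q₂ f)
          (there (∈-++⁺ʳ q₁ (here refl)))
          (λ y∈ → [ (λ z k → Unique-disjoint (q₁ ++ a ∷ q₂) uB (∈-++⁺ʳ q₁ (there z)) (kept k)) , lost ]′ (∈-++⁻ q₂ y∈))

        cross : ∀ f₁ {n₁ g₁} f₂ {n₂ g₂} → m₁ ≡ f₁ ++ n₁ ∷ g₁ → m₂ ≡ f₂ ++ n₂ ∷ g₂ →
                (∀ {y} → y ∈ f₁ → y ∉ ns) → (∀ {y} → y ∈ f₂ → y ∉ ns) → n₁ ~ n₂ → Through (a ∷ ns)
        cross f₁ {n₁} {g₁} f₂ {n₂} {g₂} refl refl lost₁ lost₂ e = finish (q ++ c₂ ∷ reverse g₁ ++ n₁ ∷ n₂ ∷ g₂) (f₁ ++ f₂)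
          (arc-++ Aq (arc-++ (arc-rev (proj₂ (arc-split f₁ A₁))) (e ◅ proj₂ (arc-split f₂ A₂))))
          (↭-trans (solve 9 (λ c q d g n o h f i → (c ⊕ (q ⊕ (d ⊕ (g ⊕ (n ⊕ (o ⊕ h)))))) ⊕ (f ⊕ i) ⊜ q ⊕ (c ⊕ ((f ⊕ (n ⊕ g)) ⊕ (d ⊕ (i ⊕ (o ⊕ h)))))) ↭-refl
                     (c₁ ∷ []) q (c₂ ∷ []) (reverse g₁) (n₁ ∷ []) (n₂ ∷ []) g₂ f₁ f₂)
                   (++⁺ˡ q (prep c₁ (++⁺ʳ (c₂ ∷ f₂ ++ n₂ ∷ g₂) (++⁺ˡ f₁ (prep n₁ (↭-reverse g₁)))))))
          (there (∈-++⁺ˡ a∈q))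
          (λ y∈ → [ lost₁ , lost₂ ]′ (∈-++⁻ f₁ y∈))

      -- n₁ and n₂ are the first kept vertices after the two ends of the ear; with a they cannot be independent.
      absorb-ear : ∀ {c₁ c₂ : V} {m₁ m₂ q : List V} → Arc c₁ m₁ c₂ → Arc c₂ m₂ c₁ → Arc c₁ q c₂ → a ∈ q →
        Unique (q ++ c₁ ∷ m₁ ++ c₂ ∷ m₂) → All Free (q ++ c₁ ∷ m₁ ++ c₂ ∷ m₂) →
        (∀ {y} → y ∈ ns → y ∈ c₁ ∷ m₁ ++ c₂ ∷ m₂) → Through (a ∷ ns)
      absorb-ear {c₁} {c₂} {m₁} {m₂} {q} A₁ A₂ Aq a∈q uB fB kept = go (first-in (_∈? ns) m₁) (first-in (_∈? ns) m₂)
        where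
        σ : q ++ c₁ ∷ m₁ ++ c₂ ∷ m₂ ↭ reverse q ++ c₂ ∷ m₂ ++ c₁ ∷ m₁
        σ = ↭-trans (++⁺ʳ (c₁ ∷ m₁ ++ c₂ ∷ m₂) (↭-sym (↭-reverse q))) (++⁺ˡ (reverse q) (rotate-↭ m₁))
        a∈q′ : a ∈ reverse q
        a∈q′ = ∈-resp-↭ (↭-sym (↭-reverse q)) a∈q
        kept′ : ∀ {y} → y ∈ ns → y ∈ c₂ ∷ m₂ ++ c₁ ∷ m₁
        kept′ y∈ = ∈-resp-↭ (rotate-↭ m₁) (kept y∈)
        FirstIn : List V → Set
        FirstIn m = (∀ {x} → x ∈ m → x ∉ ns) ⊎ (∃ λ f → ∃ λ x → ∃ λ g → m ≡ f ++ x ∷ g × x ∈ ns × (∀ {y} → y ∈ f → y ∉ ns))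
        go : FirstIn m₁ → FirstIn m₂ → Through (a ∷ ns)
        go (inj₁ none) _           = skip A₁ A₂ Aq a∈q uB fB kept none
        go (inj₂ _)    (inj₁ none) = skip A₂ A₁ (arc-rev Aq) a∈q′ (Unique-resp-↭ σ uB) (All-resp-↭ σ fB) kept′ none
        go (inj₂ (f₁ , n₁ , g₁ , e₁ , k₁ , l₁)) (inj₂ (f₂ , n₂ , g₂ , e₂ , k₂ , l₂)) with a ~? n₁ | a ~? n₂ | n₁ ~? n₂
        ... | yes e | _ | _        = jump A₁ A₂ Aq a∈q uB fB kept f₁ e₁ l₁ e
        ... | no _ | yes e | _     = jump A₂ A₁ (arc-rev Aq) a∈q′ (Unique-resp-↭ σ uB) (All-resp-↭ σ fB) kept′ f₂ e₂ l₂ e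
        ... | no _ | no _ | yes e  = cross A₁ A₂ Aq a∈q uB fB kept f₁ f₂ e₁ e₂ l₁ l₂ e
        ... | no ¬a₁ | no ¬a₂ | no ¬n = ⊥-elim (claw v~a (v~ns k₁) (v~ns k₂) (a≢ k₁) (a≢ k₂) n₁≢n₂ ¬a₁ ¬a₂ ¬n)
          where
          a≢ : ∀ {y} → y ∈ ns → a ≢ y
          a≢ y∈ refl = Unique-disjoint q uB a∈q (kept y∈)
          n₁∈ : n₁ ∈ c₁ ∷ m₁
          n₁∈ = there (subst (n₁ ∈_) (sym e₁) (∈-++⁺ʳ f₁ (here refl)))
          n₂∈ : n₂ ∈ c₂ ∷ m₂
          n₂∈ = there (subst (n₂ ∈_) (sym e₂) (∈-++⁺ʳ f₂ (here refl)))
          n₁≢n₂ : n₁ ≢ n₂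
          n₁≢n₂ refl = Unique-disjoint (c₁ ∷ m₁) (Unique-++ʳ q uB) n₁∈ n₂∈

      absorb : Free a → Through ns → (Through (a ∷ ns) → ⊥) → ⊥
      absorb fa (through {x} {m} C fC ns⊆) k with a ∈? (x ∷ m)
      ... | yes a∈ = k (through C fC λ { (here refl) → a∈ ; (there y∈) → ns⊆ y∈ })
      ... | no a∉ = connected u fa (proj₁ fa) (All.lookup fC (here refl)) (proj₁ (All.lookup fC (here refl))) λ r →
          Ears.find-ear (All.lookup fC) (reach-mono proj₁ r) (here refl) a∉ fa (other (arc C) (uniq C)) λ E → k (use E)
        where
        other : ∀ {m} → Arc x m x → Unique (x ∷ m) → ∀ w → ∃ λ c′ → c′ ∈ x ∷ m × c′ ≢ w
        other ar un w with x ≟ w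
        ... | no ne = x , here refl , ne
        other (edge e)        un w | yes refl = ⊥-elim (~-irrefl e)
        other (_◅_ {w = y} _ _) un w | yes refl = y , there (here refl) , λ { refl → Unique-head un (here refl) }
        rooted-cycle : ∀ {c} → c ∈ x ∷ m → ∃ λ m′ → Cycle c m′ × x ∷ m ↭ c ∷ m′
        rooted-cycle (here refl) = m , C , ↭-refl
        rooted-cycle (there c∈) with ∈-∃++ c∈
        ... | m₁ , m₂ , refl = m₂ ++ x ∷ m₁ , rotate m₁ C , rotate-↭ m₁
        use : Ear (x ∷ m) a → Through (a ∷ ns)
        use (ear {c₁} {c₂} {q} aq c₁∈ c₂∈ c₁≢c₂ a∈q uq off) with rooted-cycle c₁∈
        ... | m′ , C′ , p with ∈-resp-↭ p c₂∈
        ... | here e = ⊥-elim (c₁≢c₂ (sym e))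
        ... | there c₂∈′ with ∈-∃++ c₂∈′
        ... | m₁ , m₂ , refl = absorb-ear (proj₁ (arc-split m₁ (arc C′))) (proj₂ (arc-split m₁ (arc C′))) aq a∈q
                (Uniq.++⁺ uq (uniq C′) (λ (z∈ , z∈′) → proj₁ (All.lookup off z∈) (∈-resp-↭ (↭-sym p) z∈′)))
                (AllP.++⁺ (All.map proj₂ off) (All-resp-↭ p fC)) (∈-resp-↭ p ∘ ns⊆)

    some-cycle : ∀ {x y y′} → Free x → Free y → Free y′ → x ≢ y → x ≢ y′ → y ≢ y′ → (Through [] → ⊥) → ⊥
    some-cycle {x} {y} {y′} fx fy fy′ x≢y x≢y′ y≢y′ k =
      connected u fx (proj₁ fx) fy (proj₁ fy) λ { here → x≢y refl ; (step {w = w} x~w (fw , _) _) → second w x~w fw }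
      where
      close : ∀ {w w′} → x ~ w → x ~ w′ → Free w → Free w′ → w′ ≢ w → ⊥
      close {w} {w′} x~w x~w′ fw fw′ w′≢w = connected x fw′ (≢-sym (~⇒≢ x~w′)) fw (≢-sym (~⇒≢ x~w)) λ r →
        finish (hit-path {Tgt = _≡ w} {Off = _≢ w} (λ z _ → dec (z ≟ w)) r w′≢w refl (λ n → n refl))
        where
        dec : ∀ {z} → Dec (z ≡ w) → z ≡ w ⊎ z ≢ w
        dec (yes p) = inj₁ p
        dec (no p)  = inj₂ p
        finish : HitPath (_≡ w) (_≢ w) (λ z → Free z × z ≢ x) w′ → ⊥
        finish (hit {m} path refl _ off um) = k (through (cycle (x~w′ ◅ arc-++ path (edge (~-sym x~w))) un) fr λ ())
          where
          open ↭-Solver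
          w∉ : w ∉ w′ ∷ m
          w∉ (here e)   = w′≢w (sym e)
          w∉ (there w∈) = proj₁ (All.lookup off w∈) refl
          x∉ : x ∉ w ∷ w′ ∷ m
          x∉ (here refl)         = ~-irrefl x~w
          x∉ (there (here refl)) = ~-irrefl x~w′
          x∉ (there (there x∈))  = proj₂ (proj₂ (All.lookup off x∈)) refl
          p : x ∷ w ∷ w′ ∷ m ↭ x ∷ w′ ∷ m ++ w ∷ []
          p = prep x (solve 3 (λ w w′ m → w ⊕ (w′ ⊕ m) ⊜ w′ ⊕ (m ⊕ w)) ↭-refl (w ∷ []) (w′ ∷ []) m)
          un : Unique (x ∷ w′ ∷ m ++ w ∷ [])
          un = Unique-resp-↭ p (∉-Unique x∉ (∉-Unique w∉ um))
          fr : All Free (x ∷ w′ ∷ m ++ w ∷ [])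
          fr = All-resp-↭ p (fx ∷ fw ∷ fw′ ∷ All.map (proj₁ ∘ proj₂) off)
      third : ∀ w → x ~ w → Free w → ∀ {z} → Free z → x ≢ z → z ≢ w → ⊥
      third w x~w fw fz x≢z z≢w = connected w fx (~⇒≢ x~w) fz z≢w
        λ { here → x≢z refl ; (step x~w′ (fw′ , w′≢w) _) → close x~w x~w′ fw fw′ w′≢w }
      second : ∀ w → x ~ w → Free w → ⊥
      second w x~w fw with y ≟ w
      ... | no y≢w = third w x~w fw fy x≢y y≢w
      ... | yes refl = third w x~w fw fy′ x≢y′ (≢-sym y≢y′)

    neighbour-free : ¬ u ~ v → ∀ {y} → v ~ y → Free y
    neighbour-free u≁v e = (λ { refl → u≁v (~-sym e) }) , ≢-sym (~⇒≢ e)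

    collect : ¬ u ~ v → ∀ ns → (∀ {y} → y ∈ ns → v ~ y) → (Through ns → ⊥) → ⊥
    collect u≁v [] v~ k = some-cycle (neighbour-free u≁v x~a) (neighbour-free u≁v x~b) (neighbour-free u≁v x~c) a≢b a≢c b≢c k
      where open ThreeNeighbours (three-neighbours v)
    collect u≁v (a ∷ ns) v~ k = collect u≁v ns (v~ ∘ there) λ T →
      Absorb.absorb (v~ ∘ there) (v~ (here refl)) (neighbour-free u≁v (v~ (here refl))) T k

    some-link : ¬ u ~ v → (∀ {x m} → Link v x m → u ∉ x ∷ m → ⊥) → ⊥
    some-link u≁v k = collect u≁v (filterᵇ (G v) (allFin n)) (λ {y} → ∈-list⁻ {G v}) λ (through C f ns⊆) →
      k (link C (λ v∈ → proj₂ (All.lookup f v∈) refl) (λ e → ns⊆ (∈-list {G v} e))) (λ u∈ → proj₁ (All.lookup f u∈) refl)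

    tight : u ≢ v → ¬ u ~ v → ¬ ¬ Tight v u
    tight u≢v u≁v k = some-link u≁v λ {x} {m} L u∉ → Tighten.lengthen u≢v k n L u∉ (ℕₚ.m≤m+n n (length (x ∷ m)))

  nonadjacent-cut : ∀ u v → u ≢ v → ¬ u ~ v → (∀ t → Split u v t → ⊥) → ⊥
  nonadjacent-cut u v u≢v u≁v no-cut =
    TwoConnected.tight no-cut u≢v u≁v λ T →
    TwoConnected.tight (λ t S → no-cut t (swap₁₂ S)) (≢-sym u≢v) (u≁v ∘ ~-sym) λ T′ → Clash.clash T T′

  no-rim : ∀ {a b c d z} → a ~ b → b ~ c → c ~ d → d ~ a → a ≢ c → b ≢ d →
           z ∉ a ∷ b ∷ c ∷ d ∷ [] → (∀ y → z ~ y → y ∈ a ∷ b ∷ c ∷ d ∷ []) → ⊥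
  no-rim a~b b~c c~d d~a a≢c b≢d z∉ N = not-even (link (cycle (a~b ◅ b~c ◅ c~d ◅ edge d~a)
      ((~⇒≢ a~b ∷ a≢c ∷ ≢-sym (~⇒≢ d~a) ∷ []) ∷ (~⇒≢ b~c ∷ b≢d ∷ []) ∷ (~⇒≢ c~d ∷ []) ∷ [] ∷ [])) z∉ (N _)) (divides 2 refl)

module Faces {n : ℕ} (G : Graph n) (simple : IsSimple G) (conn : ThreeConnected G)
  (ρ : Fin n → Fin n → Fin n) (rot : IsRotationSystem G ρ) where

  open Walks G simple
  open Connected3 conn
  open IsRotationSystem rot

  φ : Dart n → Dart n
  φ = faceStep ρ

  IsDart : Dart n → Set
  IsDart (u , v) = u ~ v

  _^_ : ℕ → Dart n → Dart n
  k ^ d = iter φ k d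

  φ-dart : ∀ {d} → IsDart d → IsDart (φ d)
  φ-dart {u , v} e = closed v u (~-sym e)

  ^-dart : ∀ k {d} → IsDart d → IsDart (k ^ d)
  ^-dart zero    e = e
  ^-dart (suc k) e = φ-dart (^-dart k e)

  φ-injective : ∀ {d d′} → IsDart d → IsDart d′ → φ d ≡ φ d′ → d ≡ d′
  φ-injective {u , v} {u′ , v′} e e′ eq with cong proj₁ eq
  ... | refl = cong (_, v) (injective v u u′ (~-sym e) (~-sym e′) (cong proj₂ eq))

  ^-injective : ∀ k {d d′} → IsDart d → IsDart d′ → k ^ d ≡ k ^ d′ → d ≡ d′
  ^-injective zero    e e′ eq = eq
  ^-injective (suc k) e e′ eq = ^-injective k e e′ (φ-injective (^-dart k e) (^-dart k e′) eq)

  ^-+ : ∀ i j d → (i + j) ^ d ≡ i ^ (j ^ d)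
  ^-+ zero    j d = refl
  ^-+ (suc i) j d = cong φ (^-+ i j d)

  ^-comm : ∀ i j d → i ^ (j ^ d) ≡ j ^ (i ^ d)
  ^-comm i j d = trans (sym (^-+ i j d)) (trans (cong (_^ d) (ℕₚ.+-comm i j)) (^-+ j i d))

  abstract
    ρ-moves : ∀ {u v} → v ~ u → ρ v u ≢ u
    ρ-moves {u} {v} e fixed = a≢b (trans (at-u x~a) (sym (at-u x~b)))
      where
      open ThreeNeighbours (three-neighbours v)
      stays : ∀ k → iter (ρ v) k u ≡ u
      stays zero    = refl
      stays (suc k) = trans (cong (ρ v) (stays k)) fixed
      at-u : ∀ {w} → v ~ w → w ≡ u
      at-u {w} f with cyclic v u w e f
      ... | k , eq = trans (sym eq) (stays k)

  1^≢ : ∀ {d} → IsDart d → 1 ^ d ≢ d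
  1^≢ {u , v} e eq = ~-irrefl (subst (u ~_) (cong proj₁ eq) e)

  2^≢ : ∀ {d} → IsDart d → 2 ^ d ≢ d
  2^≢ {u , v} e eq = ρ-moves (~-sym e) (cong proj₁ eq)

  code : Dart n → Fin (n * n)
  code (u , v) = combine u v

  abstract
    code-injective : ∀ {d d′} → code d ≡ code d′ → d ≡ d′
    code-injective {u , v} {u′ , v′} eq with combine-injective u v u′ v′ eq
    ... | refl , refl = refl

  key≡code : ∀ d → dartKey d ≡ toℕ (code d)
  key≡code (u , v) = sym (trans (toℕ-combine {n} {n} u v) (cong (_+ toℕ v) (ℕₚ.*-comm n (toℕ u))))

  abstract
    key-injective : ∀ {d d′ : Dart n} → dartKey d ≡ dartKey d′ → d ≡ d′
    key-injective {d} {d′} eq = code-injective (toℕ-injective (trans (sym (key≡code d)) (trans eq (key≡code d′))))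

  Period : Dart n → ℕ → Set
  Period d p = 1 ≤ p × p ^ d ≡ d

  abstract
    period : ∀ {d} → IsDart d → ∃ λ p → Period d p × p ≤ n * n
    period {d} e with pigeonhole (ℕₚ.n<1+n (n * n)) (λ i → code (toℕ i ^ d))
    ... | i , j , i<j , eq = toℕ j ∸ toℕ i , (ℕₚ.m<n⇒0<n∸m i<j , ^-injective (toℕ i) (^-dart (toℕ j ∸ toℕ i) e) e
            (trans (sym (^-+ (toℕ i) (toℕ j ∸ toℕ i) d)) (trans (cong (_^ d) (ℕₚ.m+[n∸m]≡n (ℕₚ.<⇒≤ i<j))) (sym (code-injective eq)))))
          , ℕₚ.≤-trans (ℕₚ.m∸n≤m (toℕ j) (toℕ i)) (s≤s⁻¹ (toℕ<n j))

  abstract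
    reduce : ∀ {d p} → Period d p → ∀ k → ∃ λ k′ → k′ < p × k ^ d ≡ k′ ^ d
    reduce (1≤p , _) zero = 0 , 1≤p , refl
    reduce {d} {p} P (suc k) with reduce P k
    ... | k′ , k′<p , eq with suc k′ ℕₚ.<? p
    ... | yes lt = suc k′ , lt , cong φ eq
    ... | no ge  = 0 , proj₁ P , trans (cong φ eq) (trans (cong (_^ d) (ℕₚ.≤-antisym k′<p (ℕₚ.≮⇒≥ ge))) (proj₂ P))

  abstract
    back : ∀ {d} → IsDart d → ∀ k → ∃ λ k′ → k′ ^ (k ^ d) ≡ d
    back {d} e k with period e
    ... | p , P , _ with reduce P k
    ... | k′ , k′<p , eq = p ∸ k′ , trans (cong ((p ∸ k′) ^_) eq)
            (trans (sym (^-+ (p ∸ k′) k′ d)) (trans (cong (_^ d) (ℕₚ.m∸n+n≡m (ℕₚ.<⇒≤ k′<p))) (proj₂ P)))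

  Least : Dart n → Set
  Least d = ∀ k → dartKey d ≤ dartKey (k ^ d)

  abstract
    rep⇒least : ∀ {d} → IsDart d → T (isFaceRep ρ d) → Least d
    rep⇒least {d} e t k with period e
    ... | p , P , p≤ with reduce P k
    ... | k′ , k′<p , eq = subst (λ x → dartKey d ≤ dartKey x) (sym eq)
            (ℕₚ.≤ᵇ⇒≤ (dartKey d) (dartKey (k′ ^ d))
              (All.lookup (AllP.all⁺ (λ k → dartKey d ≤ᵇ dartKey (k ^ d)) (upTo (n * n)) t) (∈-upTo⁺ (ℕₚ.≤-trans k′<p p≤))))

  abstract
    same-face : ∀ {r r′} → IsDart r → IsDart r′ → Least r → Least r′ → ∀ a b → a ^ r ≡ b ^ r′ → r ≡ r′
    same-face {r} {r′} e e′ l l′ a b eq with back e′ b | back e a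
    ... | c , ceq | c′ , ceq′ = key-injective (ℕₚ.≤-antisym
          (subst (λ x → dartKey r ≤ dartKey x) (trans (^-+ c a r) (trans (cong (c ^_) eq) ceq)) (l (c + a)))
          (subst (λ x → dartKey r′ ≤ dartKey x) (trans (^-+ c′ b r′) (trans (cong (c′ ^_) (sym eq)) ceq′)) (l′ (c′ + b))))

  abstract
    argmin : ∀ (f : ℕ → ℕ) m → ∃ λ k → ∀ j → j ≤ m → f k ≤ f j
    argmin f zero = 0 , λ { .0 z≤n → ℕₚ.≤-refl }
    argmin f (suc m) with argmin f m
    ... | k , h with ℕₚ.≤-total (f k) (f (suc m))
    ... | inj₁ le = k , λ j j≤ → [ (λ lt → h j (s≤s⁻¹ lt)) , (λ { refl → le }) ]′ (ℕₚ.m≤n⇒m<n∨m≡n j≤)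
    ... | inj₂ ge = suc m , λ j j≤ → [ (λ lt → ℕₚ.≤-trans ge (h j (s≤s⁻¹ lt))) , (λ { refl → ℕₚ.≤-refl }) ]′ (ℕₚ.m≤n⇒m<n∨m≡n j≤)

  abstract
    least-on-face : ∀ {d} → IsDart d → ∃ λ r → IsDart r × Least r × ∃ λ k → k ^ r ≡ d
    least-on-face {d} e with period e
    ... | p , P , _ with argmin (λ k → dartKey (k ^ d)) p
    ... | k , h = k ^ d , ^-dart k e , least , back e k
      where
      least : Least (k ^ d)
      least j with reduce P (j + k)
      ... | k′ , k′<p , eq = subst (λ x → dartKey (k ^ d) ≤ dartKey x) (trans (sym eq) (^-+ j k d)) (h k′ (ℕₚ.<⇒≤ k′<p))

  pairs : List (Dart n)
  pairs = concatMap (λ u → map (λ v → (u , v)) (allFin n)) (allFin n)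

  Unique-darts : Unique (darts G)
  Unique-darts = Uniq.filter⁺ (T? ∘ (λ d → G (proj₁ d) (proj₂ d)))
    (Uniq.concat⁺ (AllP.map⁺ (All.tabulate λ _ → Uniq.map⁺ (cong proj₂) (Uniq.allFin⁺ n)))
      (AllPairsP.map⁺ (AllPairs.map disjoint (Uniq.allFin⁺ n))))
    where
    disjoint : ∀ {u u′ : Fin n} → u ≢ u′ → ∀ {d} → d ∈ map (u ,_) (allFin n) × d ∈ map (u′ ,_) (allFin n) → ⊥
    disjoint ne (p , q) with ∈-map⁻ _ p | ∈-map⁻ _ q
    ... | _ , _ , refl | _ , _ , refl = ne refl

  dart∈ : ∀ {d} → IsDart d → d ∈ darts G
  dart∈ {u , v} e = ∈-filter⁺ (T? ∘ (λ d → G (proj₁ d) (proj₂ d)))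
    (∈-concat⁺′ (∈-map⁺ (u ,_) (∈-allFin v)) (∈-map⁺ (λ u → map (u ,_) (allFin n)) (∈-allFin u))) (subst T (sym e) _)

  ∈dart : ∀ {d} → d ∈ darts G → IsDart d
  ∈dart {u , v} m with G u v | proj₂ (∈-filter⁻ (T? ∘ (λ d → G (proj₁ d) (proj₂ d))) {xs = pairs} m)
  ... | true | _ = refl

  reps : List (Dart n)
  reps = filterᵇ (isFaceRep ρ) (darts G)

  abstract
    reps-least : ∀ {r} → r ∈ reps → IsDart r × Least r
    reps-least m with ∈-filter⁻ (T? ∘ isFaceRep ρ) {xs = darts G} m
    ... | d∈ , t = ∈dart d∈ , rep⇒least (∈dart d∈) t

  triples : List (Dart n) → List (Dart n)
  triples []       = []
  triples (r ∷ rs) = 0 ^ r ∷ 1 ^ r ∷ 2 ^ r ∷ triples rs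

  ∈-triples : ∀ {x} rs → x ∈ triples rs → ∃ λ r → r ∈ rs × ∃ λ i → i < 3 × x ≡ i ^ r
  ∈-triples (r ∷ rs) (here e)                 = r , here refl , 0 , s≤s z≤n , e
  ∈-triples (r ∷ rs) (there (here e))         = r , here refl , 1 , s≤s (s≤s z≤n) , e
  ∈-triples (r ∷ rs) (there (there (here e))) = r , here refl , 2 , s≤s (s≤s (s≤s z≤n)) , e
  ∈-triples (r ∷ rs) (there (there (there m))) with ∈-triples rs m
  ... | r′ , r′∈ , rest = r′ , there r′∈ , rest

  length-triples : ∀ rs → length (triples rs) ≡ 3 * length rs
  length-triples []       = refl
  length-triples (r ∷ rs) = trans (cong (3 +_) (length-triples rs)) (sym (ℕₚ.*-suc 3 (length rs)))

  Unique-triples : ∀ {rs} → Unique rs → (∀ {r} → r ∈ rs → IsDart r × Least r) → Unique (triples rs)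
  Unique-triples {[]} _ _ = []
  Unique-triples {r ∷ rs} (r∉ ∷ u) good =
    ∉-Unique (λ { (here q) → 1^≢ e (sym q) ; (there (here q)) → 2^≢ e (sym q) ; (there (there m)) → fresh 0 m })
      (∉-Unique (λ { (here q) → 1^≢ (φ-dart e) (sym q) ; (there m) → fresh 1 m })
        (∉-Unique (fresh 2) (Unique-triples u (good ∘ there))))
    where
    e = proj₁ (good (here refl))
    fresh : ∀ i → i ^ r ∉ triples rs
    fresh i m with ∈-triples rs m
    ... | r′ , r′∈ , j , _ , eq = All.lookup r∉ r′∈
            (same-face e (proj₁ (good (there r′∈))) (proj₂ (good (here refl))) (proj₂ (good (there r′∈))) i j eq)

  Unique-reps : Unique reps
  Unique-reps = Uniq.filter⁺ (T? ∘ isFaceRep ρ) Unique-darts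

  triples⊆darts : ∀ {x} → x ∈ triples reps → x ∈ darts G
  triples⊆darts m with ∈-triples reps m
  ... | r , r∈ , i , _ , refl = dart∈ (^-dart i (proj₁ (reps-least r∈)))

  abstract
    three-per-face : 3 * numFaces G ρ ≤ numDarts G
    three-per-face = subst (_≤ numDarts G) (length-triples reps)
      (Unique-⊆-length (triples reps) (Unique-triples Unique-reps reps-least) triples⊆darts)

  -- An edge in no triangle lies on no triangular face, so two darts are left over.
  spare-darts : ∀ {u l} → u ~ l → (∀ w → u ~ w → ¬ l ~ w) → 2 + 3 * numFaces G ρ ≤ numDarts G
  spare-darts {u} {l} u~l apart with least-on-face {u , l} u~l | least-on-face {l , u} (~-sym u~l)
  ... | r , e , lst , m , at | r′ , e′ , lst′ , m′ , at′ = pick (code (3 ^ r) ≟ code (3 ^ r′))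
    where
    long : ∀ {x y} → x ~ y → (∀ w → x ~ w → ¬ y ~ w) → 3 ^ (x , y) ≢ (x , y)
    long {x} {y} x~y none eq = none (ρ y x)
      (~-sym (subst (ρ y x ~_) (cong proj₁ eq) (closed (ρ y x) y (~-sym (closed y x (~-sym x~y)))))) (closed y x (~-sym x~y))
    no3 : ∀ {x y s k} → x ~ y → (∀ w → x ~ w → ¬ y ~ w) → k ^ s ≡ (x , y) → 3 ^ s ≢ s
    no3 {x} {y} {s} {k} x~y none at eq = long x~y none
      (trans (cong (3 ^_) (sym at)) (trans (^-comm 3 k s) (trans (cong (k ^_) eq) at)))
    3^r≢ : 3 ^ r ≢ r
    3^r≢ = no3 {k = m} u~l apart at
    3^r′≢ : 3 ^ r′ ≢ r′
    3^r′≢ = no3 {k = m′} (~-sym u~l) (λ w p q → apart w q p) at′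
    outside : ∀ {s} j → IsDart s → Least s → (∀ i → i < 3 → j ^ s ≢ i ^ s) → j ^ s ∉ triples reps
    outside {s} j es ls ne mem with ∈-triples reps mem
    ... | t , t∈ , i , i<3 , eq with same-face es (proj₁ (reps-least t∈)) ls (proj₂ (reps-least t∈)) j i eq
    ... | refl = ne i i<3 eq
    ne3 : ∀ {s} → IsDart s → 3 ^ s ≢ s → ∀ i → i < 3 → 3 ^ s ≢ i ^ s
    ne3 es ¬3 0 _ eq = ¬3 eq
    ne3 es ¬3 1 _ eq = 2^≢ es (^-injective 1 (^-dart 2 es) es eq)
    ne3 es ¬3 2 _ eq = 1^≢ es (^-injective 2 (^-dart 1 es) es eq)
    ne3 es ¬3 (suc (suc (suc _))) (s≤s (s≤s (s≤s ()))) _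
    count : ∀ {x y} → x ≢ y → IsDart x → IsDart y → x ∉ triples reps → y ∉ triples reps → 2 + 3 * numFaces G ρ ≤ numDarts G
    count {x} {y} x≢y ex ey x∉ y∉ = subst (λ k → 2 + k ≤ numDarts G) (length-triples reps)
      (Unique-⊆-length (x ∷ y ∷ triples reps)
        (∉-Unique (λ { (here q) → x≢y q ; (there q) → x∉ q }) (∉-Unique y∉ (Unique-triples Unique-reps reps-least)))
        λ { (here refl) → dart∈ ex ; (there (here refl)) → dart∈ ey ; (there (there q)) → triples⊆darts q })
    pick : Dec (code (3 ^ r) ≡ code (3 ^ r′)) → 2 + 3 * numFaces G ρ ≤ numDarts G
    pick (no ne) = count (ne ∘ cong code) (^-dart 3 e) (^-dart 3 e′) (outside 3 e lst (ne3 e 3^r≢)) (outside 3 e′ lst′ (ne3 e′ 3^r′≢))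
    pick (yes eq) with same-face e e′ lst lst′ 3 3 (code-injective eq)
    ... | refl = count {3 ^ r} {4 ^ r} (λ q → 1^≢ (^-dart 3 e) (sym q)) (^-dart 3 e) (^-dart 4 e) (outside 3 e lst (ne3 e 3^r≢)) (outside 4 e lst ne4)
      where
      d : Dart n
      d = u , l
      flipped : ∃ λ k → k ^ d ≡ (l , u)
      flipped with back e m
      ... | k , eq′ = m′ + k , trans (^-+ m′ k d) (trans (cong (λ x → m′ ^ (k ^ x)) (sym at)) (trans (cong (m′ ^_) eq′) at′))
      not4 : 4 ^ r ≢ r
      not4 q with reduce {d} {4} (s≤s z≤n , trans (cong (4 ^_) (sym at)) (trans (^-comm 4 m r) (trans (cong (m ^_) q) at))) (proj₁ flipped)
      ... | 0 , _ , eq′ = ~-irrefl (subst (u ~_) (cong proj₁ (trans (sym (proj₂ flipped)) eq′)) u~l)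
      ... | 1 , _ , eq′ = ρ-moves (~-sym u~l) (sym (cong proj₂ (trans (sym (proj₂ flipped)) eq′)))
      ... | 2 , _ , eq′ = ~-irrefl (subst (l ~_) (sym (cong proj₁ (trans (sym (proj₂ flipped)) eq′))) (closed l u (~-sym u~l)))
      ... | 3 , _ , eq′ = ρ-moves u~l (cong proj₂ (trans (cong φ (trans (sym (proj₂ flipped)) eq′))
              (trans (cong (4 ^_) (sym at)) (trans (^-comm 4 m r) (trans (cong (m ^_) q) at)))))
      ... | suc (suc (suc (suc _))) , s≤s (s≤s (s≤s (s≤s ()))) , _
      ne4 : ∀ i → i < 3 → 4 ^ r ≢ i ^ r
      ne4 0 _ q = not4 q
      ne4 1 _ q = 3^r≢ (^-injective 1 (^-dart 3 e) e q)
      ne4 2 _ q = 2^≢ e (^-injective 2 (^-dart 2 e) e q)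
      ne4 (suc (suc (suc _))) (s≤s (s≤s (s≤s ()))) _

  module Euler (euler : 2 * n + 2 * numFaces G ρ ≡ 4 + numDarts G) where

    few-darts : ∀ s → s + 3 * numFaces G ρ ≤ numDarts G → 2 * s + 12 + numDarts G ≤ 6 * n
    few-darts s h = ℕₚ.+-cancelʳ-≤ (2 * D) _ _ (begin
        2 * s + 12 + D + 2 * D        ≡⟨ left s D ⟩
        2 * s + 3 * (4 + D)           ≡⟨ cong (λ x → 2 * s + 3 * x) (sym euler) ⟩
        2 * s + 3 * (2 * n + 2 * F)   ≡⟨ right s n F ⟩
        6 * n + 2 * (s + 3 * F)       ≤⟨ ℕₚ.+-monoʳ-≤ (6 * n) (ℕₚ.*-monoʳ-≤ 2 h) ⟩
        6 * n + 2 * D                 ∎)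
      where
      open ℕₚ.≤-Reasoning
      D F : ℕ
      D = numDarts G
      F = numFaces G ρ
      left : ∀ s D → 2 * s + 12 + D + 2 * D ≡ 2 * s + 3 * (4 + D)
      left = solve-∀
      right : ∀ s n F → 2 * s + 3 * (2 * n + 2 * F) ≡ 6 * n + 2 * (s + 3 * F)
      right = solve-∀

    many-darts : ∀ (missing : List (Dart n)) → (∀ u v → u ≢ v → ¬ u ~ v → (u , v) ∈ missing) →
                 n * n ≤ numDarts G + (n + length missing)
    many-darts missing listed = subst₂ _≤_ lhs rhs (Unique-⊆-length (cartesianProduct (allFin n) (allFin n))
        (Uniq.cartesianProduct⁺ (Uniq.allFin⁺ n) (Uniq.allFin⁺ n)) (λ {d} _ → covered d))
      where
      length-product : ∀ (xs : List (Fin n)) {ys : List (Fin n)} → length (cartesianProduct xs ys) ≡ length xs * length ys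
      length-product []       = refl
      length-product (x ∷ xs) {ys} = trans (length-++ (map (x ,_) ys)) (cong₂ _+_ (length-map (x ,_) ys) (length-product xs))
      all-n : length (allFin n) ≡ n
      all-n = length-tabulate id
      lhs : length (cartesianProduct (allFin n) (allFin n)) ≡ n * n
      lhs = trans (length-product (allFin n)) (cong₂ _*_ all-n all-n)
      rhs : length (darts G ++ map (λ v → v , v) (allFin n) ++ missing) ≡ numDarts G + (n + length missing)
      rhs = trans (length-++ (darts G)) (cong (numDarts G +_) (trans (length-++ (map (λ v → v , v) (allFin n)))
              (cong (_+ length missing) (trans (length-map _ (allFin n)) all-n))))
      covered : ∀ d → d ∈ darts G ++ map (λ v → v , v) (allFin n) ++ missing
      covered (u , v) with u ≟ v | u ~? v
      ... | yes refl | _ = ∈-++⁺ʳ (darts G) (∈-++⁺ˡ (∈-map⁺ (λ v → v , v) (∈-allFin u)))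
      ... | no _ | yes e = ∈-++⁺ˡ (dart∈ e)
      ... | no ne | no ne′ = ∈-++⁺ʳ (darts G) (∈-++⁺ʳ (map (λ v → v , v) (allFin n)) (listed u v ne ne′))

    complete-small : (∀ u v → u ≢ v → u ~ v) → n ≤ 4
    complete-small full = bound n (begin
        n * n + 12                          ≤⟨ ℕₚ.+-monoˡ-≤ 12 (many-darts [] λ u v ne ne′ → ⊥-elim (ne′ (full u v ne))) ⟩
        numDarts G + (n + 0) + 12           ≡⟨ shuffle (numDarts G) n ⟩
        (12 + numDarts G) + n               ≤⟨ ℕₚ.+-monoˡ-≤ n (few-darts 0 three-per-face) ⟩
        6 * n + n                           ∎)
      where
      open ℕₚ.≤-Reasoning
      shuffle : ∀ D n → D + (n + 0) + 12 ≡ (12 + D) + n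
      shuffle = solve-∀
      expand : ∀ k → (5 + k) * (5 + k) + 12 ≡ suc (6 * (5 + k) + (5 + k)) + (1 + 3 * k + k * k)
      expand = solve-∀
      bound : ∀ n → n * n + 12 ≤ 6 * n + n → n ≤ 4
      bound 0 _ = z≤n
      bound 1 _ = s≤s z≤n
      bound 2 _ = s≤s (s≤s z≤n)
      bound 3 _ = s≤s (s≤s (s≤s z≤n))
      bound 4 _ = s≤s (s≤s (s≤s (s≤s z≤n)))
      bound (suc (suc (suc (suc (suc k))))) h = ⊥-elim (ℕₚ.<⇒≱
        (ℕₚ.m≤m+n (suc (6 * (5 + k) + (5 + k))) (1 + 3 * k + k * k)) (subst (_≤ 6 * (5 + k) + (5 + k)) (expand k) h))

    -- With 8 ordered nonadjacent pairs and two spare darts, n² + 8 ≤ 7 n.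
    no-split-K5 : ∀ {u l} → u ~ l → (∀ w → u ~ w → ¬ l ~ w) → ∀ missing → length missing ≡ 8 →
                  (∀ u v → u ≢ v → ¬ u ~ v → (u , v) ∈ missing) → 6 ≤ n → ⊥
    no-split-K5 u~l apart missing eight listed 6≤n = bound (n ∸ 6) (subst (λ k → k * k + 16 ≤ 6 * k + (k + 8)) (sym (ℕₚ.m+[n∸m]≡n 6≤n)) (begin
        n * n + 16                             ≤⟨ ℕₚ.+-monoˡ-≤ 16 (many-darts missing listed) ⟩
        numDarts G + (n + length missing) + 16 ≡⟨ cong (λ k → numDarts G + (n + k) + 16) eight ⟩
        numDarts G + (n + 8) + 16              ≡⟨ shuffle (numDarts G) n ⟩
        (16 + numDarts G) + (n + 8)            ≤⟨ ℕₚ.+-monoˡ-≤ (n + 8) (few-darts 2 (spare-darts u~l apart)) ⟩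
        6 * n + (n + 8)                        ∎))
      where
      open ℕₚ.≤-Reasoning
      shuffle : ∀ D n → D + (n + 8) + 16 ≡ (16 + D) + (n + 8)
      shuffle = solve-∀
      expand : ∀ k → (6 + k) * (6 + k) + 16 ≡ suc (6 * (6 + k) + ((6 + k) + 8)) + (1 + 5 * k + k * k)
      expand = solve-∀
      bound : ∀ k → (6 + k) * (6 + k) + 16 ≤ 6 * (6 + k) + ((6 + k) + 8) → ⊥
      bound k h = ℕₚ.<⇒≱
        (ℕₚ.m≤m+n (suc (6 * (6 + k) + ((6 + k) + 8))) (1 + 5 * k + k * k)) (subst (_≤ 6 * (6 + k) + ((6 + k) + 8)) (expand k) h)

RowsDiffer : ∀ {k} → Graph k → Set
RowsDiffer H = ∀ i j → i ≢ j → ∃ λ l → H i l ≢ H j l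

rowsDiffer? : ∀ {k} (H : Graph k) → Dec (RowsDiffer H)
rowsDiffer? H = all? λ i → all? λ j → ¬? (i ≟ j) →-dec any? λ l → ¬? (H i l ≟ᵇ H j l)

module _ {n k : ℕ} {G : Graph n} {H : Graph k} where

  copy-injective : RowsDiffer H → (C : Copy G H) → ∀ {i j} → lookup (Copy.verts C) i ≡ lookup (Copy.verts C) j → i ≡ j
  copy-injective differ C {i} {j} eq with i ≟ j
  ... | yes q = q
  ... | no ne with differ i j ne
  ... | l , neq = ⊥-elim (neq (trans (sym (agree i l)) (trans (cong (λ x → G x (lookup verts l)) eq) (agree j l))))
    where open Copy C

  copy⇒≅ : RowsDiffer H → Copy G H → G ≅ H
  copy⇒≅ differ C = mk↔ₛ′ (proj₁ ∘ onto) (lookup verts)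
      (λ i → copy-injective differ C (proj₂ (onto (lookup verts i)))) (proj₂ ∘ onto)
    , λ u v → trans (sym (cong₂ G (proj₂ (onto u)) (proj₂ (onto v)))) (agree (proj₁ (onto u)) (proj₁ (onto v)))
    where open Copy C

any-vec? : ∀ {n} k {P : Vec (Fin n) k → Set} → (∀ xs → Dec (P xs)) → Dec (∃ P)
any-vec? zero    P? = map′ (λ p → [] , p) (λ { ([] , p) → p }) (P? [])
any-vec? (suc k) P? = map′ (λ (x , xs , p) → x ∷ xs , p) (λ { (x ∷ xs , p) → x , xs , p })
  (any? λ x → any-vec? k λ xs → P? (x ∷ xs))

copy? : ∀ {n k} (G : Graph n) (H : Graph k) → Dec (Copy G H)
copy? {n} {k} G H = map′ (λ (xs , a , o) → copy xs a o) (λ (copy xs a o) → xs , a , o)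
  (any-vec? k λ xs → (all? λ i → all? λ j → G (lookup xs i) (lookup xs j) ≟ᵇ H i j)
    ×-dec (all? λ y → any? λ i → lookup xs i ≟ y))

spanning : ∀ {n} {S : List (Fin n)} → Unique S → n ≤ length S → ∀ x → x ∈ S
spanning {n} {S} u h x with x ∈? S
  where open import Data.List.Membership.DecPropositional (_≟_ {n}) using (_∈?_)
... | yes x∈ = x∈
... | no x∉ = ⊥-elim (ℕₚ.<⇒≱ (Unique-⊆-length (x ∷ S) (∉-Unique x∉ u) (λ {y} _ → ∈-allFin y))
                        (ℕₚ.≤-trans (ℕₚ.≤-reflexive (length-tabulate id)) h))

spanning-matching : ∀ {n} (G : Graph n) {S} → (∀ x → x ∈ S) → HasPerfectMatchingAvoiding G S
spanning-matching G all∈ = id , λ x x∉ → ⊥-elim (x∉ (all∈ x))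

Opposite : ∀ {k} → Graph k → Set
Opposite H = ∀ v a → Adj H v a → ∀ b → Adj H a b → b ≢ v → ∀ c → Adj H b c → Adj H c v → c ≢ a →
  ∀ x → x ∉ v ∷ a ∷ b ∷ c ∷ [] → ∀ y → y ∉ v ∷ a ∷ b ∷ c ∷ [] → x ≢ y → Adj H x y

opposite? : ∀ {k} (H : Graph k) → Dec (Opposite H)
opposite? {k} H = all? λ v → all? λ a → adj? v a →-dec all? λ b → adj? a b →-dec ¬? (b ≟ v) →-dec
  all? λ c → adj? b c →-dec adj? c v →-dec ¬? (c ≟ a) →-dec
  all? λ x → ¬? (x ∈? (v ∷ a ∷ b ∷ c ∷ [])) →-dec all? λ y → ¬? (y ∈? (v ∷ a ∷ b ∷ c ∷ [])) →-dec ¬? (x ≟ y) →-dec adj? x y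
  where
  open import Data.List.Membership.DecPropositional (_≟_ {k}) using (_∈?_)
  adj? : ∀ x y → Dec (Adj H x y)
  adj? x y = H x y ≟ᵇ true

opposite-transfer : ∀ {n k} {G : Graph n} {H : Graph k} → G ≅ H → Opposite H → Opposite G
opposite-transfer {G = G} {H} (f , same) opp v a va b ab b≢v c bc cv c≢a x x∉ y y∉ x≢y =
  to⁻ (opp (F v) (F a) (to⁺ va) (F b) (to⁺ ab) (b≢v ∘ F-inj) (F c) (to⁺ bc) (to⁺ cv) (c≢a ∘ F-inj)
        (F x) (out x∉) (F y) (out y∉) (x≢y ∘ F-inj))
  where
  F = Inverse.to f
  F-inj : ∀ {x y} → F x ≡ F y → x ≡ y
  F-inj {x} {y} e = trans (sym (Inverse.strictlyInverseʳ f x)) (trans (cong (Inverse.from f) e) (Inverse.strictlyInverseʳ f y))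
  to⁺ : ∀ {x y} → Adj G x y → Adj H (F x) (F y)
  to⁺ {x} {y} e = trans (sym (same x y)) e
  to⁻ : ∀ {x y} → Adj H (F x) (F y) → Adj G x y
  to⁻ {x} {y} e = trans (same x y) e
  out : ∀ {x} → x ∉ v ∷ a ∷ b ∷ c ∷ [] → F x ∉ F v ∷ F a ∷ F b ∷ F c ∷ []
  out x∉ (here e)                         = x∉ (here (F-inj e))
  out x∉ (there (here e))                 = x∉ (there (here (F-inj e)))
  out x∉ (there (there (here e)))         = x∉ (there (there (here (F-inj e))))
  out x∉ (there (there (there (here e)))) = x∉ (there (there (there (here (F-inj e)))))

nice-4 : ∀ {n} (G : Graph n) → n ≡ 4 → CycleNice G
nice-4 {n} G n≡4 v rest (u , 3≤ , ev , _) =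
  spanning-matching G (spanning u (subst (_≤ length (v ∷ rest)) (sym n≡4) (four (length (v ∷ rest)) 3≤ ev)))
  where
  four : ∀ m → 3 ≤ m → 2 ∣ m → 4 ≤ m
  four 3 _ e = ⊥-elim (from-yes (¬? (2 ∣? 3)) e)
  four 1 (s≤s ()) _
  four 2 (s≤s (s≤s ())) _
  four (suc (suc (suc (suc m)))) _ _ = s≤s (s≤s (s≤s (s≤s z≤n)))

module SixVertices {n : ℕ} (G : Graph n) (n≡6 : n ≡ 6) where

  open import Data.List.Membership.DecPropositional (_≟_ {n}) using (_∈?_)

  module Square {S : List (Fin n)} (u : Unique S) (four : length S ≡ 4)
    (opp : ∀ x → x ∉ S → ∀ y → y ∉ S → x ≢ y → Adj G x y) where

    Partner : Fin n → Fin n → Set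
    Partner x y = y ≢ x × y ∉ S

    partner : ∀ x → ∃ (Partner x)
    partner x with any? (λ y → ¬? (y ≟ x) ×-dec ¬? (y ∈? S))
    ... | yes p = p
    ... | no none = ⊥-elim (ℕₚ.<⇒≱ (ℕₚ.≤-reflexive (trans (cong (2 +_) four) (sym n≡6)))
            (ℕₚ.≤-trans (ℕₚ.≤-reflexive (sym (length-tabulate id))) (Unique-⊆-length (allFin n) {x ∷ S} (Uniq.allFin⁺ n) (λ {y} _ → member y))))
      where
      member : ∀ y → y ∈ x ∷ S
      member y with y ≟ x | y ∈? S
      ... | yes q | _ = here q
      ... | no _ | yes q = there q
      ... | no p | no q = ⊥-elim (none (y , p , q))

    μ : Fin n → Fin n
    μ x = proj₁ (partner x)

    involutive : ∀ x → x ∉ S → μ (μ x) ≡ x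
    involutive x x∉ = last-one (proj₂ (partner x)) (proj₂ (partner (μ x)))
      where
      last-one : ∀ {y z} → Partner x y → Partner y z → z ≡ x
      last-one {y} {z} (y≢x , y∉) (z≢y , z∉) with
        spanning {S = y ∷ x ∷ S} (∉-Unique (λ { (here q) → y≢x q ; (there q) → y∉ q }) (∉-Unique x∉ u))
          (ℕₚ.≤-reflexive (trans n≡6 (sym (cong (2 +_) four)))) z
      ... | here q           = ⊥-elim (z≢y q)
      ... | there (here q)   = q
      ... | there (there z∈) = ⊥-elim (z∉ z∈)

    matching : HasPerfectMatchingAvoiding G S
    matching = μ , λ x x∉ → let (y≢x , y∉) = proj₂ (partner x) in
      y∉ , opp x x∉ (μ x) y∉ (≢-sym y≢x) , involutive x x∉

  nice-6 : Opposite G → CycleNice G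
  nice-6 opp v [] (_ , s≤s () , _)
  nice-6 opp v (a ∷ []) (_ , s≤s (s≤s ()) , _)
  nice-6 opp v (a ∷ b ∷ []) (_ , _ , ev , _) = ⊥-elim (from-yes (¬? (2 ∣? 3)) ev)
  nice-6 opp v (a ∷ b ∷ c ∷ []) (u@((v≢a ∷ v≢b ∷ _) ∷ (_ ∷ a≢c ∷ _) ∷ _) , _ , _ , va ∷ ab ∷ bc ∷ cv ∷ _) =
    Square.matching u refl (opp v a va b ab (≢-sym v≢b) c bc cv (≢-sym a≢c))
  nice-6 opp v (a ∷ b ∷ c ∷ d ∷ e) (u , _ , ev , _) =
    spanning-matching G (spanning u (subst (_≤ length (v ∷ a ∷ b ∷ c ∷ d ∷ e)) (sym n≡6) (six e ev)))
    where
    six : ∀ (e : List (Fin n)) → 2 ∣ length (v ∷ a ∷ b ∷ c ∷ d ∷ e) → 6 ≤ length (v ∷ a ∷ b ∷ c ∷ d ∷ e)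
    six []      ev = ⊥-elim (from-yes (¬? (2 ∣? 5)) ev)
    six (_ ∷ _) _  = s≤s (s≤s (s≤s (s≤s (s≤s (s≤s z≤n)))))

complete⇒K4 : ∀ {n} (G : Graph n) → IsSimple G → (∀ u v → u ≢ v → Adj G u v) → 4 ≤ n → n ≤ 4 → G ≅ K4
complete⇒K4 G simple full 4≤n n≤4 with ℕₚ.≤-antisym n≤4 4≤n
... | refl = mk↔ₛ′ id id (λ _ → refl) (λ _ → refl) , agree
  where
  agree : ∀ u v → G u v ≡ K4 u v
  agree u v with u ≟ v
  ... | yes refl = trans (IsSimple.irrefl simple u) (sym (from-yes (all? λ u → K4 u u ≟ᵇ false) u))
  ... | no u≢v   = trans (full u v u≢v) (sym (from-yes (all? λ u → all? λ v → ¬? (u ≟ v) →-dec K4 u v ≟ᵇ true) u v u≢v))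

module NotSplitK5 {n : ℕ} (G : Graph n) (simple : IsSimple G) (conn : ThreeConnected G)
  (ρ : Fin n → Fin n → Fin n) (rot : IsRotationSystem G ρ) (euler : 2 * n + 2 * numFaces G ρ ≡ 4 + numDarts G) where

  open Faces G simple conn ρ rot
  open Euler euler

  NonEdge : Fin 6 × Fin 6 → Set
  NonEdge (i , j) = i ≢ j × SplitK5 i j ≡ false

  nonEdge? : ∀ p → Dec (NonEdge p)
  nonEdge? (i , j) = ¬? (i ≟ j) ×-dec (SplitK5 i j ≟ᵇ false)

  nonEdges : List (Fin 6 × Fin 6)
  nonEdges = filter nonEdge? (cartesianProduct (allFin 6) (allFin 6))

  no-copy : ¬ Copy G SplitK5
  no-copy C = no-split-K5 (agree zero (suc zero)) no-common missing (length-map x² nonEdges) listed six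
    where
    open Copy C
    x : Fin 6 → Fin n
    x = lookup verts
    x² : Fin 6 × Fin 6 → Fin n × Fin n
    x² (i , j) = x i , x j
    missing : List (Fin n × Fin n)
    missing = map x² nonEdges
    no-common : ∀ w → Adj G (x zero) w → ¬ Adj G (x (suc zero)) w
    no-common w e e′ with onto w
    ... | k , refl = from-yes (all? λ k → (SplitK5 zero k ≟ᵇ true) →-dec ¬? (SplitK5 (suc zero) k ≟ᵇ true)) k
                       (trans (sym (agree zero k)) e) (trans (sym (agree (suc zero) k)) e′)
    listed : ∀ u v → u ≢ v → ¬ Adj G u v → (u , v) ∈ missing
    listed u v u≢v u≁v with onto u | onto v
    ... | i , refl | j , refl = ∈-map⁺ x² (∈-filter⁺ nonEdge? (∈-cartesianProduct⁺ (∈-allFin i) (∈-allFin j))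
            ((λ { refl → u≢v refl }) , trans (sym (agree i j)) (non-adj u≁v)))
      where
      non-adj : ∀ {b} → b ≢ true → b ≡ false
      non-adj {true}  ne = ⊥-elim (ne refl)
      non-adj {false} _  = refl
    six : 6 ≤ n
    six = subst (6 ≤_) (length-tabulate id) (Unique-⊆-length (map x (allFin 6))
            (Uniq.map⁺ (copy-injective (from-yes (rowsDiffer? SplitK5)) C) (Uniq.allFin⁺ 6)) (λ {y} _ → ∈-allFin y))

theorem3p1 : (n : ℕ) (G : Graph n) → IsSimple G → ThreeConnected G → ClawFree G → Plane G →
    (CycleNice G ⇔ (G ≅ K4 ⊎ G ≅ W5 ⊎ G ≅ C6bar))
theorem3p1 n G simple conn clawfree (ρ , rot , euler) = mk⇔ forward backward
  where
  forward : CycleNice G → G ≅ K4 ⊎ G ≅ W5 ⊎ G ≅ C6bar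
  forward nice with copy? G W5 | copy? G C6bar
  ... | yes C | _     = inj₂ (inj₁ (copy⇒≅ (from-yes (rowsDiffer? W5)) C))
  ... | no _  | yes C = inj₂ (inj₂ (copy⇒≅ (from-yes (rowsDiffer? C6bar)) C))
  ... | no ¬W | no ¬P = inj₁ (complete⇒K4 G simple full (proj₁ conn) (complete-small full))
    where
    open Faces G simple conn ρ rot using (module Euler)
    open Euler euler using (complete-small)
    module L = Links G simple conn clawfree nice
    full : ∀ u v → u ≢ v → Adj G u v
    full = Classify.complete G simple conn clawfree L.nonadjacent-cut L.no-rim ¬W ¬P (NotSplitK5.no-copy G simple conn ρ rot euler)
  backward : G ≅ K4 ⊎ G ≅ W5 ⊎ G ≅ C6bar → CycleNice G
  backward (inj₁ g)        = nice-4 G (↔⇒≡ (proj₁ g))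
  backward (inj₂ (inj₁ g)) = SixVertices.nice-6 G (↔⇒≡ (proj₁ g)) (opposite-transfer {G = G} {W5} g (from-yes (opposite? W5)))
  backward (inj₂ (inj₂ g)) = SixVertices.nice-6 G (↔⇒≡ (proj₁ g)) (opposite-transfer {G = G} {C6bar} g (from-yes (opposite? C6bar)))
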